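{- There are algorithms which, given a finite presentation of a suffix recognizable graph $G$ of finite degree, decide whether $G$ is a Cayley graph of a left-cancellative monoid, whether $G$ is a Cayley graph of a cancellative monoid, whether $G$ is a Cayley graph of a group, and whether $G$ is a generalized Cayley graph of a left-quasigroup, of a quasigroup, of a group. Moreover, in each affirmative case, there are a vertex $r$ and a computable binary operation $\cdot$ on $V_G$ making $V_G$ a structure of the corresponding kind such that $G=\mathcal{C}\langle V_G,\to_G(r)\rangle$ for this operation, where $\langle s\rangle=a$ whenever $r\xrightarrow{a}_G s$.
   Context: A graph is a non-empty set $G\subseteq V\times A\times V$ of labeled edges $s\xrightarrow{a}_G t$; $s\to_G t$ means such an edge exists for some $a$; $V_G$ is the set of vertices occurring in edges, and $\to_G(r)=\{s: r\to_G s\}$. $G$ has finite degree if every vertex is source or target of only finitely many edges. For a finite alphabet $N$, a suffix recognizable graph over $N$ is a graph of the form $\bigcup_{i=1}^n W_i(U_i\xrightarrow{a_i}V_i)$ with $n\ge 0$, labels $a_i$, and regular languages $U_i,V_i,W_i\subseteq N^*$, where $W(U\xrightarrow{a}V)=\{(wu,a,wv): w\in W, u\in U, v\in V\}$; it is presented by finite automata for the languages and the labels. For a magma $(M,\cdot)$, $Q\subseteq M$ and injective $\langle\,\rangle:Q\to A$, $\mathcal{C}\langle M,Q\rangle=\{(p,\langle q\rangle,p\cdot q): p\in M,\ q\in Q\}$. A Cayley graph of a monoid (resp. group) $M$ is $\mathcal{C}\langle M,Q\rangle$ with $Q$ generating $M$ as a monoid (resp. as a group); a generalized Cayley graph of a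 magma $M$ is $\mathcal{C}\langle M,Q\rangle$ for arbitrary $Q\subseteq M$. A magma is left-cancellative if $r\cdot p=r\cdot q\Rightarrow p=q$, cancellative if also $p\cdot r=q\cdot r\Rightarrow p=q$; a left-quasigroup if for all $p,q$ there is a unique $r$ with $p\cdot r=q$; a quasigroup if in addition there is a unique $s$ with $s\cdot p=q$. -}

module Defs where

open import Data.Nat using (ℕ)
open import Data.Fin using (Fin)
open import Data.Bool using (Bool; true)
open import Data.List using (List; []; _∷_; _++_)
open import Data.List.Membership.Propositional using (_∈_)
open import Data.Product using (Σ; _×_; _,_)
open import Data.Sum using (_⊎_)
open import Relation.Binary.PropositionalEquality using (_≡_)

Word : ℕ → Set
Word n = List (Fin n)

record DFA (n : ℕ) : Set where
  field
    states : ℕ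
    start  : Fin states
    accept : Fin states → Bool
    step   : Fin states → Fin n → Fin states

  run : Fin states → Word n → Fin states
  run q []       = q
  run q (x ∷ xs) = run (step q x) xs

Accepts : {n : ℕ} → DFA n → Word n → Set
Accepts d w = DFA.accept d (DFA.run d (DFA.start d) w) ≡ true

-- Finite presentation of a suffix recognizable graph
--   ⋃ᵢ Wᵢ (Uᵢ --aᵢ--> Vᵢ)

record Rule (n : ℕ) (A : Set) : Set where
  field
    W U V : DFA n
    label : A

Presentation : ℕ → Set → Set
Presentation n A = List (Rule n A)

RuleEdge : {n : ℕ} {A : Set} → Rule n A → Word n → A → Word n → Set
RuleEdge {n} ρ s a t =
  Σ (Word n) λ w → Σ (Word n) λ u → Σ (Word n) λ v →
    Accepts (Rule.W ρ) w × Accepts (Rule.U ρ) u × Accepts (Rule.V ρ) v ×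
    s ≡ w ++ u × t ≡ w ++ v × a ≡ Rule.label ρ

Edge : {n : ℕ} {A : Set} → Presentation n A → Word n → A → Word n → Set
Edge P s a t = Σ _ λ ρ → ρ ∈ P × RuleEdge ρ s a t

NonEmpty : {n : ℕ} {A : Set} → Presentation n A → Set
NonEmpty {n} {A} P = Σ (Word n) λ s → Σ A λ a → Σ (Word n) λ t → Edge P s a t

Vertex : {n : ℕ} {A : Set} → Presentation n A → Word n → Set
Vertex {n} {A} P s =
  Σ A λ a → Σ (Word n) λ t → Edge P s a t ⊎ Edge P t a s

Succ : {n : ℕ} {A : Set} → Presentation n A → Word n → Word n → Set
Succ {n} {A} P r s = Σ A λ a → Edge P r a s

FiniteDegree : {n : ℕ} {A : Set} → Presentation n A → Set
FiniteDegree {n} {A} P =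
  (x : Word n) → Σ (List (Word n × A × Word n)) λ L →
    (s : Word n) (a : A) (t : Word n) → Edge P s a t →
    (s ≡ x ⊎ t ≡ x) → (s , a , t) ∈ L

module _ {n : ℕ} (V : Word n → Set) (op : Word n → Word n → Word n) where

  Closed : Set
  Closed = ∀ p q → V p → V q → V (op p q)

  Assoc : Set
  Assoc = ∀ p q r → V p → V q → V r → op (op p q) r ≡ op p (op q r)

  MonoidWith : Word n → Set
  MonoidWith e = V e × Assoc × (∀ p → V p → op e p ≡ p × op p e ≡ p)

  GroupWith : Word n → Set
  GroupWith e = MonoidWith e ×
    (∀ p → V p → Σ (Word n) λ q → V q × op p q ≡ e × op q p ≡ e)

  LeftCancellative : Set
  LeftCancellative = ∀ r p q → V r → V p → V q → op r p ≡ op r q → p ≡ q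

  RightCancellative : Set
  RightCancellative = ∀ r p q → V r → V p → V q → op p r ≡ op q r → p ≡ q

  LeftQuasigroup : Set
  LeftQuasigroup = ∀ p q → V p → V q →
    (Σ (Word n) λ r → V r × op p r ≡ q) ×
    (∀ r r′ → V r → V r′ → op p r ≡ q → op p r′ ≡ q → r ≡ r′)

  Quasigroup : Set
  Quasigroup = LeftQuasigroup × (∀ p q → V p → V q →
    (Σ (Word n) λ s → V s × op s p ≡ q) ×
    (∀ s s′ → V s → V s′ → op s p ≡ q → op s′ p ≡ q → s ≡ s′))

  data GenMonoid (Q : Word n → Set) (e : Word n) : Word n → Set where
    gen-e  : GenMonoid Q e e
    gen-q  : ∀ {q} → Q q → GenMonoid Q e q
    gen-op : ∀ {p q} → GenMonoid Q e p → GenMonoid Q e q → GenMonoid Q e (op p q)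

  data GenGroup (Q : Word n → Set) (e : Word n) : Word n → Set where
    gen-e   : GenGroup Q e e
    gen-q   : ∀ {q} → Q q → GenGroup Q e q
    gen-op  : ∀ {p q} → GenGroup Q e p → GenGroup Q e q → GenGroup Q e (op p q)
    gen-inv : ∀ {p x} → GenGroup Q e p → V x → op p x ≡ e → op x p ≡ e →
              GenGroup Q e x

data Kind : Set where
  cayley-leftCancMonoid    : Kind
  cayley-cancMonoid        : Kind
  cayley-group             : Kind
  gen-cayley-leftQuasigroup : Kind
  gen-cayley-quasigroup    : Kind
  gen-cayley-group         : Kind

module _ {n : ℕ} {A : Set} (P : Presentation n A) where

  KindAxioms : Kind → (Word n → Word n → Word n) → (Word n → Set) → Set
  KindAxioms cayley-leftCancMonoid op Q = Σ (Word n) λ e →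
    MonoidWith (Vertex P) op e × LeftCancellative (Vertex P) op ×
    (∀ p → Vertex P p → GenMonoid (Vertex P) op Q e p)
  KindAxioms cayley-cancMonoid op Q = Σ (Word n) λ e →
    MonoidWith (Vertex P) op e × LeftCancellative (Vertex P) op ×
    RightCancellative (Vertex P) op ×
    (∀ p → Vertex P p → GenMonoid (Vertex P) op Q e p)
  KindAxioms cayley-group op Q = Σ (Word n) λ e →
    GroupWith (Vertex P) op e ×
    (∀ p → Vertex P p → GenGroup (Vertex P) op Q e p)
  KindAxioms gen-cayley-leftQuasigroup op Q = LeftQuasigroup (Vertex P) op
  KindAxioms gen-cayley-quasigroup op Q = Quasigroup (Vertex P) op
  KindAxioms gen-cayley-group op Q = Σ (Word n) λ e → GroupWith (Vertex P) op e

  IsCayleyGraphOf : (Word n → Word n → Word n) → (Word n → Set) → (Word n → A) → Set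
  IsCayleyGraphOf op Q lab =
    ∀ s a t → (Edge P s a t →
                 Vertex P s × Σ (Word n) λ q → Q q × lab q ≡ a × t ≡ op s q)
            × (Vertex P s × (Σ (Word n) λ q → Q q × lab q ≡ a × t ≡ op s q) →
                 Edge P s a t)

  CayleyData : Kind → (Word n → Word n → Word n) → (Word n → Set) → (Word n → A) → Set
  CayleyData k op Q lab =
    Closed (Vertex P) op ×
    (∀ q → Q q → Vertex P q) ×
    (∀ q q′ → Q q → Q q′ → lab q ≡ lab q′ → q ≡ q′) ×
    IsCayleyGraphOf op Q lab ×
    KindAxioms k op Q

  IsKind : Kind → Set₁
  IsKind k = Σ (Word n → Word n → Word n) λ op → Σ (Word n → Set) λ Q →
    Σ (Word n → A) λ lab → CayleyData k op Q lab

  Realization : Kind → Set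
  Realization k = Σ (Word n) λ r → Vertex P r ×
    Σ (Word n → Word n → Word n) λ op → Σ (Word n → A) λ lab →
      (∀ s a → Edge P r a s → lab s ≡ a) ×
      CayleyData k op (Succ P r) lab

{-# OPTIONS --safe #-}
-- Finite degree forces every non-trivial rule W (U → V) to have finite U and V. A vertex is then a stack with its top
-- at the right end, and the part of the graph above a prefix w depends only on the state q of a finite automaton after
-- reading w. Reachability between short words above q is a least fixpoint, hence decidable, and predecessors of regular
-- sets are regular.
--
-- Whether two vertices r, s of a deterministic graph satisfy the same equations r·u = r·v is decided by a greatest
-- fixpoint over finitely many local pictures of the isomorphism r·u ↦ s·u. A component of a cone is separated from the
-- rest of the graph by a set of bounded diameter, and so is its image; hence the image lies in a cone whose apex is at
-- bounded distance, and the isomorphism is described by a finite top-down transducer.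
--
-- Left-cancellative monoids correspond to simple, out-complete graphs with a root r satisfying the same equations as
-- its successors, a root being found among the vertices playing the role of units; groups to graphs, symmetrised,
-- in which all vertices satisfy the same equations, the components being indexed by ℤ/k or ℤ. Left multiplications
-- of a left-quasigroup are extensions of finite injections to permutations. A quasigroup table on an infinite graph is
-- completed greedily, on a finite graph found by exhaustive search.

module Submission where

-- The hard question is whether two vertices have the same kernel: a condition on infinitely many
-- pairs of words in a graph that may be infinite. A finite description of the isomorphism exists
-- because a step changes boundedly many letters: a cone meets the rest of the graph in finitely
-- many short words, and distances between short words of a cone are bounded uniformly over all
-- prefixes. Otherwise images could drift arbitrarily far from the prefix relative to which they are
-- stored, and the tables of values would not range over a finite set.
--
-- Equality of all kernels is what makes `(b i · u) (b j · v) = b (i ∙ j) · u v` well defined. For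
-- groups the result is the direct product of `I` with the group read off one component, so any
-- group with as many elements as there are components serves as `I`.
--
-- For monoids the identity has to be guessed, but one guess is enough: left multiplication by a
-- unit is an automorphism, so in a Cayley graph every unit can serve as root.
--
-- Every decision returns a `Realization` or a refutation of `IsKind`, which gives both halves of
-- the theorem.

open import Defs
open import Data.Nat using (ℕ; zero; suc; _+_; _*_; _∸_; _⊔_; _≤_; _<_; z≤n; s≤s; _≤?_)
open import Data.Nat.DivMod using (_%_; m%n<n; %-distribˡ-+; m<n⇒m%n≡m; n%n≡0; m%n%n≡m%n)
open import Data.Nat.Properties using (≤-refl; ≤-reflexive; ≤-trans; ≤-pred; <-irrefl; <-≤-trans; <⇒≤; ≰⇒>; n≤1+n; m≤m+n; m≤n+m; m≤m⊔n; m≤n⊔m; +-comm; +-assoc; +-suc; +-identityʳ; +-mono-≤; +-monoˡ-≤; +-monoʳ-≤; +-cancelˡ-≤; *-monoʳ-≤; *-suc; m+[n∸m]≡n; m∸n+n≡m; m∸n≤m; m∸[m∸n]≡n; m≤n⇒m⊓n≡m)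
open import Data.Fin using (Fin; zero; suc; toℕ; fromℕ<)
open import Data.Fin.Properties using (toℕ<n; toℕ-fromℕ<; toℕ-injective) renaming (any? to anyFin?; all? to allFin?; _≟_ to _≟ᶠ_)
import Data.Integer as ℤ
import Data.Integer.Properties as ℤ
open import Data.Bool using (Bool; true; false; if_then_else_) renaming (_≟_ to _≟ᵇ_)
open import Data.Unit using (⊤; tt)
open import Data.Empty using (⊥; ⊥-elim)
open import Data.Maybe using (Maybe; just; nothing)
open import Data.Vec using (Vec; []; _∷_)
open import Data.List using (List; []; _∷_; _++_; _∷ʳ_; [_]; length; map; filter; foldl; concatMap; allFin; cartesianProductWith; drop; take)
open import Data.List.Properties using (≡-dec; ++-assoc; ++-identityʳ; ++-cancelˡ; length-++; ∷-injective; ∷-injectiveʳ; foldl-++; ∷ʳ-++; length-take; length-drop; take++drop≡id)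
open import Data.List.Membership.Propositional using (_∈_; _∉_; find; lose)
open import Data.List.Membership.Propositional.Properties using (∈-map⁺; ∈-map⁻; ∈-++⁺ˡ; ∈-++⁺ʳ; ∈-++⁻; ∈-concatMap⁺; ∈-concatMap⁻; ∈-cartesianProductWith⁺; ∈-cartesianProductWith⁻; ∈-allFin; ∈-filter⁺; ∈-filter⁻)
open import Data.List.Relation.Unary.Any using (here; there; any?)
open import Data.List.Relation.Unary.All using ([]; _∷_; all?) renaming (lookup to lookupAll; tabulate to tabulateAll)
open import Data.Product using (Σ; ∃; ∃₂; _×_; _,_; proj₁; proj₂)
open import Data.Product.Properties using () renaming (≡-dec to ×-≡-dec)
open import Data.Sum using (_⊎_; inj₁; inj₂)
open import Function using (_∘_; id; case_of_)
open import Relation.Nullary using (Dec; yes; no; ¬_; does)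
open import Relation.Nullary.Decidable using (map′; _×-dec_; _⊎-dec_; _→-dec_; ¬?; decidable-stable)
open import Relation.Binary.Definitions using (DecidableEquality)
open import Relation.Binary.PropositionalEquality using (_≡_; _≢_; refl; sym; trans; cong; subst; subst₂)

-- Least fixpoints on finite sets

module LeastFixpoint {X : Set} (_≟_ : DecidableEquality X) (U : List X)
  (Φ : (X → Set) → X → Set)
  (mono : ∀ {P R : X → Set} → (∀ x → P x → R x) → ∀ x → Φ P x → Φ R x)
  (dec : ∀ {P : X → Set} → (∀ x → Dec (P x)) → ∀ x → Dec (Φ P x)) where

  open import Data.List.Membership.DecPropositional _≟_ using (_∈?_)

  stage : ℕ → X → Set
  stage zero x = ⊥
  stage (suc k) x = x ∈ U × Φ (stage k) x

  stage? : ∀ k x → Dec (stage k x)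
  stage? zero x = no λ ()
  stage? (suc k) x = (x ∈? U) ×-dec dec (stage? k) x

  stage-mono : ∀ k x → stage k x → stage (suc k) x
  stage-mono (suc k) x (m , p) = m , mono (stage-mono k) x p

  count : ℕ → List X → ℕ
  count k [] = 0
  count k (x ∷ xs) with stage? k x
  ... | yes _ = suc (count k xs)
  ... | no  _ = count k xs

  count≤length : ∀ k xs → count k xs ≤ length xs
  count≤length k [] = z≤n
  count≤length k (x ∷ xs) with stage? k x
  ... | yes _ = s≤s (count≤length k xs)
  ... | no  _ = ≤-trans (count≤length k xs) (n≤1+n _)

  count-mono : ∀ k xs → count k xs ≤ count (suc k) xs
  count-mono k [] = z≤n
  count-mono k (x ∷ xs) with stage? k x | stage? (suc k) x
  ... | yes _ | yes _ = s≤s (count-mono k xs)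
  ... | yes p | no ¬p = ⊥-elim (¬p (stage-mono k x p))
  ... | no  _ | yes _ = ≤-trans (count-mono k xs) (n≤1+n _)
  ... | no  _ | no  _ = count-mono k xs

  stable-or-grows : ∀ k xs →
    (∀ {x} → x ∈ xs → stage (suc k) x → stage k x) ⊎ count k xs < count (suc k) xs
  stable-or-grows k [] = inj₁ λ ()
  stable-or-grows k (x ∷ xs) with stage? k x | stage? (suc k) x
  ... | no ¬p | yes _ = inj₂ (s≤s (count-mono k xs))
  ... | yes p | no ¬p = ⊥-elim (¬p (stage-mono k x p))
  ... | yes p | yes _ with stable-or-grows k xs
  ...   | inj₁ s = inj₁ λ { (here refl) _ → p ; (there m) → s m }
  ...   | inj₂ g = inj₂ (s≤s g)
  stable-or-grows k (x ∷ xs) | no _ | no ¬p with stable-or-grows k xs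
  ...   | inj₁ s = inj₁ λ { (here refl) q → ⊥-elim (¬p q) ; (there m) → s m }
  ...   | inj₂ g = inj₂ g

  -- `fuel` bounds how many elements of `U` may still enter: each strict growth of `count` spends
  -- one unit, and growth at fuel zero would push `count` beyond `length U`.
  stabilises : ∀ fuel k → length U ≤ count k U + fuel →
    Σ ℕ λ j → ∀ {x} → x ∈ U → stage (suc j) x → stage j x
  stabilises fuel k h with stable-or-grows k U
  stabilises fuel k h | inj₁ s = k , s
  stabilises zero k h | inj₂ g = ⊥-elim (<-irrefl refl
    (<-≤-trans g (≤-trans (count≤length (suc k) U) (subst (length U ≤_) (+-identityʳ _) h))))
  stabilises (suc fuel) k h | inj₂ g =
    stabilises fuel (suc k) (≤-trans h (subst (_≤ count (suc k) U + fuel) (sym (+-suc _ fuel)) (+-monoˡ-≤ fuel g)))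

  opaque
    height : ℕ
    height = proj₁ (stabilises (length U) 0 (m≤n+m _ _))

    lfp : X → Set
    lfp = stage height

    lfp? : ∀ x → Dec (lfp x)
    lfp? = stage? height

    lfp-closed : ∀ {x} → x ∈ U → Φ lfp x → lfp x
    lfp-closed m p = proj₂ (stabilises (length U) 0 (m≤n+m _ _)) m (m , p)

    stage-least : ∀ (R : X → Set) → (∀ {x} → x ∈ U → Φ R x → R x) → ∀ k x → stage k x → R x
    stage-least R h (suc k) x (m , p) = h m (mono (stage-least R h k) x p)

    lfp-least : ∀ (R : X → Set) → (∀ {x} → x ∈ U → Φ R x → R x) → ∀ {x} → lfp x → R x
    lfp-least R h = stage-least R h height _

module GreatestFixpoint {X : Set} (_≟_ : DecidableEquality X) (U : List X)
  (Φ : (X → Set) → X → Set)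
  (mono : ∀ {P R : X → Set} → (∀ x → P x → R x) → ∀ x → Φ P x → Φ R x)
  (dec : ∀ {P : X → Set} → (∀ x → Dec (P x)) → ∀ x → Dec (Φ P x)) where

  -- The De Morgan dual of `Φ`. The greatest fixpoint is the complement of its least fixpoint, and
  -- decidability removes the double negations in `gfp-open`.
  Dual : (X → Set) → X → Set
  Dual P x = ¬ Φ (λ y → ¬ P y) x

  dual-mono : ∀ {P R : X → Set} → (∀ x → P x → R x) → ∀ x → Dual P x → Dual R x
  dual-mono f x p q = p (mono (λ y ¬r r → ¬r (f y r)) x q)

  dual-dec : ∀ {P : X → Set} → (∀ x → Dec (P x)) → ∀ x → Dec (Dual P x)
  dual-dec P? x = ¬? (dec (λ y → ¬? (P? y)) x)

  open LeastFixpoint _≟_ U Dual dual-mono dual-dec using (lfp; lfp?; lfp-closed; lfp-least)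

  gfp : X → Set
  gfp x = ¬ lfp x

  gfp? : ∀ x → Dec (gfp x)
  gfp? x = ¬? (lfp? x)

  gfp-open : ∀ {x} → x ∈ U → gfp x → Φ gfp x
  gfp-open {x} m ¬l with dec gfp? x
  ... | yes p = p
  ... | no ¬p = ⊥-elim (¬l (lfp-closed m ¬p))

  -- `Z` may be undecidable and reach outside `U`: only `¬ Z` passes through the least fixpoint.
  -- `Realised` is later used as such a `Z`.
  gfp-greatest : ∀ (Z : X → Set) → (∀ {x} → Z x → Φ Z x) → ∀ {x} → Z x → gfp x
  gfp-greatest Z h z l = lfp-least (λ y → ¬ Z y)
    (λ _ d zy → d (mono (λ _ zy ¬zy → ¬zy zy) _ (h zy))) l z

-- Finite types and words of bounded length

record Finite (X : Set) : Set where
  field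
    elements : List X
    member   : ∀ x → x ∈ elements
    _≟_      : DecidableEquality X

Fin-finite : ∀ k → Finite (Fin k)
Fin-finite k = record { elements = allFin k ; member = ∈-allFin ; _≟_ = _≟ᶠ_ }

⊤-finite : Finite ⊤
⊤-finite = record { elements = tt ∷ [] ; member = λ _ → here refl ; _≟_ = λ _ _ → yes refl }

Bool-finite : Finite Bool
Bool-finite = record
  { elements = true ∷ false ∷ []
  ; member = λ { true → here refl ; false → there (here refl) }
  ; _≟_ = _≟ᵇ_ }

×-finite : ∀ {X Y : Set} → Finite X → Finite Y → Finite (X × Y)
×-finite FX FY = record
  { elements = cartesianProductWith _,_ (elements FX) (elements FY)
  ; member = λ { (x , y) → ∈-cartesianProductWith⁺ _,_ (member FX x) (member FY y) }
  ; _≟_ = ×-≡-dec (_≟_ FX) (_≟_ FY) }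
  where open Finite

vectors : ∀ {X : Set} → List X → (k : ℕ) → List (Vec X k)
vectors xs zero = [] ∷ []
vectors xs (suc k) = cartesianProductWith _∷_ xs (vectors xs k)

Vec-finite : ∀ {X : Set} → Finite X → ∀ k → Finite (Vec X k)
Vec-finite {X} FX k = record
  { elements = vectors (elements FX) k ; member = all-vectors ; _≟_ = Data.Vec.Properties.≡-dec (_≟_ FX) }
  where
  open Finite
  import Data.Vec.Properties
  all-vectors : ∀ {k} (v : Vec X k) → v ∈ vectors (elements FX) k
  all-vectors [] = here refl
  all-vectors (x ∷ v) = ∈-cartesianProductWith⁺ _∷_ (member FX x) (all-vectors v)

∃∈? : ∀ {X : Set} {P : X → Set} → (∀ x → Dec (P x)) → (xs : List X) → Dec (∃ λ x → x ∈ xs × P x)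
∃∈? P? xs = map′ find (λ { (x , m , p) → lose m p }) (any? P? xs)

∀∈? : ∀ {X : Set} {P : X → Set} → (∀ x → Dec (P x)) → (xs : List X) → Dec (∀ x → x ∈ xs → P x)
∀∈? P? xs = map′ (λ a x m → lookupAll a m) (λ h → tabulateAll (λ {x} → h x)) (all? P? xs)

maximum : ∀ {X : Set} (f : X → ℕ) (xs : List X) → Σ ℕ λ m → ∀ {x} → x ∈ xs → f x ≤ m
maximum f [] = 0 , λ ()
maximum f (x ∷ xs) with maximum f xs
... | m , h = f x ⊔ m , λ { (here refl) → m≤m⊔n _ _ ; (there i) → ≤-trans (h i) (m≤n⊔m (f x) m) }

_≟ʷ_ : ∀ {n} → DecidableEquality (Word n)
_≟ʷ_ = ≡-dec _≟ᶠ_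

words≤ : ∀ {n} → ℕ → List (Word n)
words≤ zero = [] ∷ []
words≤ {n} (suc k) = [] ∷ cartesianProductWith _∷_ (allFin n) (words≤ k)

∈-words≤ : ∀ {n} k (w : Word n) → length w ≤ k → w ∈ words≤ k
∈-words≤ zero [] _ = here refl
∈-words≤ (suc k) [] _ = here refl
∈-words≤ (suc k) (b ∷ w) (s≤s h) = there (∈-cartesianProductWith⁺ _∷_ (∈-allFin b) (∈-words≤ k w h))

∈-words≤⁻ : ∀ {n} k {w : Word n} → w ∈ words≤ k → length w ≤ k
∈-words≤⁻ zero (here refl) = z≤n
∈-words≤⁻ (suc k) (here refl) = z≤n
∈-words≤⁻ {n} (suc k) (there m) with ∈-cartesianProductWith⁻ _∷_ (allFin n) (words≤ k) m
... | _ , _ , _ , m′ , refl = s≤s (∈-words≤⁻ k m′)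

-- Tables of functions on a list of words; off the list they return the default value d.

tabulateOn : ∀ {n} {Y : Set} (xs : List (Word n)) → (Word n → Y) → Vec Y (length xs)
tabulateOn [] g = []
tabulateOn (x ∷ xs) g = g x ∷ tabulateOn xs g

apply : ∀ {n} {Y : Set} → Y → (xs : List (Word n)) → Vec Y (length xs) → Word n → Y
apply d [] [] w = d
apply d (x ∷ xs) (y ∷ ys) w = if does (w ≟ʷ x) then y else apply d xs ys w

apply-tabulateOn : ∀ {n} {Y : Set} (d : Y) (xs : List (Word n)) g {w} → w ∈ xs →
  apply d xs (tabulateOn xs g) w ≡ g w
apply-tabulateOn d (x ∷ xs) g {w} m with w ≟ʷ x
apply-tabulateOn d (x ∷ xs) g m | yes refl = refl
apply-tabulateOn d (x ∷ xs) g (here e) | no ¬e = ⊥-elim (¬e e)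
apply-tabulateOn d (x ∷ xs) g (there m) | no _ = apply-tabulateOn d xs g m

∈-vectors : ∀ {n} {Y : Set} {ys : List Y} (xs : List (Word n)) g →
  (∀ {x} → x ∈ xs → g x ∈ ys) → tabulateOn xs g ∈ vectors ys (length xs)
∈-vectors [] g h = here refl
∈-vectors (x ∷ xs) g h = ∈-cartesianProductWith⁺ _∷_ (h (here refl)) (∈-vectors xs g (h ∘ there))

-- Regular predicates on words

record Regular {n : ℕ} (P : Word n → Set) : Set₁ where
  field
    State    : Set
    finite   : Finite State
    δ        : State → Fin n → State
    init     : State
    Final    : State → Set
    final?   : ∀ q → Dec (Final q)
    sound    : ∀ w → Final (foldl δ init w) → P w
    complete : ∀ w → P w → Final (foldl δ init w)

  member? : ∀ w → Dec (P w)
  member? w = map′ (sound w) (complete w) (final? (foldl δ init w))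

module _ {n : ℕ} where
  open Regular

  ¬-regular : ∀ {P : Word n → Set} → Regular P → Regular (λ w → ¬ P w)
  ¬-regular R = record
    { State = State R ; finite = finite R ; δ = δ R ; init = init R
    ; Final = λ q → ¬ Final R q ; final? = λ q → ¬? (final? R q)
    ; sound = λ w ¬f p → ¬f (complete R w p) ; complete = λ w ¬p f → ¬p (sound R w f) }

  foldl-× : ∀ {X Y : Set} (f : X → Fin n → X) (g : Y → Fin n → Y) x y (w : Word n) →
    foldl (λ p b → f (proj₁ p) b , g (proj₂ p) b) (x , y) w ≡ (foldl f x w , foldl g y w)
  foldl-× f g x y [] = refl
  foldl-× f g x y (b ∷ w) = foldl-× f g (f x b) (g y b) w

  ×-regular : ∀ {P Q : Word n → Set} → Regular P → Regular Q → Regular (λ w → P w × Q w)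
  ×-regular R S = record
    { State = State R × State S ; finite = ×-finite (finite R) (finite S)
    ; δ = λ p b → δ R (proj₁ p) b , δ S (proj₂ p) b ; init = init R , init S
    ; Final = λ p → Final R (proj₁ p) × Final S (proj₂ p)
    ; final? = λ p → final? R (proj₁ p) ×-dec final? S (proj₂ p)
    ; sound = λ w f → let a , b = subst FF (foldl-× (δ R) (δ S) _ _ w) f in sound R w a , sound S w b
    ; complete = λ w p → subst FF (sym (foldl-× (δ R) (δ S) _ _ w)) (complete R w (proj₁ p) , complete S w (proj₂ p)) }
    where
    FF : State R × State S → Set
    FF p = Final R (proj₁ p) × Final S (proj₂ p)

  map-regular : ∀ {P Q : Word n → Set} → (∀ w → P w → Q w) → (∀ w → Q w → P w) → Regular P → Regular Q
  map-regular f g R = record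
    { State = State R ; finite = finite R ; δ = δ R ; init = init R ; Final = Final R ; final? = final? R
    ; sound = λ w p → f w (sound R w p) ; complete = λ w q → complete R w (g w q) }

  constant-regular : ∀ {P : Set} → Dec P → Regular {n} (λ _ → P)
  constant-regular {P} P? = record
    { State = ⊤ ; finite = ⊤-finite ; δ = λ _ _ → tt ; init = tt ; Final = λ _ → P ; final? = λ _ → P?
    ; sound = λ _ p → p ; complete = λ _ p → p }

  ⋂-regular : ∀ {X : Set} {P : X → Word n → Set} → (∀ x → Regular (P x)) → (xs : List X) →
    Regular (λ w → ∀ x → x ∈ xs → P x w)
  ⋂-regular R [] = map-regular (λ _ _ _ ()) (λ _ _ → tt) (constant-regular (yes tt))
  ⋂-regular R (x ∷ xs) = map-regular (λ { w (p , ps) _ (here refl) → p ; w (p , ps) y (there m) → ps y m })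
    (λ w ps → ps x (here refl) , λ y m → ps y (there m)) (×-regular (R x) (⋂-regular R xs))

  module _ {P : Word n → Set} (R : Regular P) where

    private
      F = finite R
      A : State R → Word n → Set
      A q w = Final R (foldl (δ R) q w)

    private
      Productiveᶠ : (State R → Set) → State R → Set
      Productiveᶠ C q = Final R q ⊎ ∃ λ b → C (δ R q b)

      productive-mono : ∀ {C D : State R → Set} → (∀ q → C q → D q) → ∀ q → Productiveᶠ C q → Productiveᶠ D q
      productive-mono f q (inj₁ x) = inj₁ x
      productive-mono f q (inj₂ (b , c)) = inj₂ (b , f _ c)

      productive-dec : ∀ {C : State R → Set} → (∀ q → Dec (C q)) → ∀ q → Dec (Productiveᶠ C q)
      productive-dec C? q = final? R q ⊎-dec anyFin? (λ b → C? (δ R q b))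

    module Productive = LeastFixpoint (Finite._≟_ F) (Finite.elements F) Productiveᶠ productive-mono productive-dec

    productive-sound : ∀ {q} → Productive.lfp q → ∃ (A q)
    productive-sound = Productive.lfp-least (λ q → ∃ (A q))
      λ { _ (inj₁ f) → [] , f ; _ (inj₂ (b , w , f)) → b ∷ w , f }

    productive-complete : ∀ q w → A q w → Productive.lfp q
    productive-complete q [] f = Productive.lfp-closed (Finite.member F q) (inj₁ f)
    productive-complete q (b ∷ w) f =
      Productive.lfp-closed (Finite.member F q) (inj₂ (b , productive-complete (δ R q b) w f))

    opaque
      ∃-regular? : Dec (∃ P)
      ∃-regular? = map′ (λ l → let w , f = productive-sound l in w , sound R w f)
        (λ { (w , p) → productive-complete (init R) w (complete R w p) }) (Productive.lfp? (init R))

    private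
      -- Its least fixpoint excludes reachable productive cycles, so it singles out the states from
      -- which only finitely many words are accepted.
      Boundedᶠ : (State R → Set) → State R → Set
      Boundedᶠ C q = ¬ Productive.lfp q ⊎ (∀ b → C (δ R q b))

      bounded-mono : ∀ {C D : State R → Set} → (∀ q → C q → D q) → ∀ q → Boundedᶠ C q → Boundedᶠ D q
      bounded-mono f q (inj₁ x) = inj₁ x
      bounded-mono f q (inj₂ c) = inj₂ λ b → f _ (c b)

      bounded-dec : ∀ {C : State R → Set} → (∀ q → Dec (C q)) → ∀ q → Dec (Boundedᶠ C q)
      bounded-dec C? q = ¬? (Productive.lfp? q) ⊎-dec allFin? (λ b → C? (δ R q b))

    module Bounded = LeastFixpoint (Finite._≟_ F) (Finite.elements F) Boundedᶠ bounded-mono bounded-dec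

    bounded-sound : ∀ {q} → Bounded.lfp q → ∃ λ m → ∀ w → A q w → length w < m
    bounded-sound = Bounded.lfp-least (λ q → ∃ λ m → ∀ w → A q w → length w < m) step
      where
      step : ∀ {q} → q ∈ Finite.elements F →
        ¬ Productive.lfp q ⊎ (∀ b → ∃ λ m → ∀ w → A (δ R q b) w → length w < m) →
        ∃ λ m → ∀ w → A q w → length w < m
      step _ (inj₁ ¬p) = 0 , λ w f → ⊥-elim (¬p (productive-complete _ w f))
      step _ (inj₂ h) with maximum (λ b → proj₁ (h b)) (allFin n)
      ... | m , max = suc m , λ { [] _ → s≤s z≤n
                                ; (b ∷ w) f → s≤s (<-≤-trans (proj₂ (h b) w f) (max (∈-allFin b))) }

    -- An unbounded state is productive and has an unbounded successor, which supplies one letter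
    -- per unit of `m`; productivity then finishes the word.
    unbounded-sound : ∀ m {q} → ¬ Bounded.lfp q → ∃ λ w → A q w × m ≤ length w
    unbounded-sound m {q} ¬b with Productive.lfp? q
    ... | no ¬p = ⊥-elim (¬b (Bounded.lfp-closed (Finite.member F q) (inj₁ ¬p)))
    unbounded-sound zero ¬b | yes p = let w , f = productive-sound p in w , f , z≤n
    unbounded-sound (suc m) {q} ¬b | yes p with anyFin? (λ b → ¬? (Bounded.lfp? (δ R q b)))
    ... | yes (b , ¬b′) = let w , f , h = unbounded-sound m ¬b′ in b ∷ w , f , s≤s h
    ... | no h = ⊥-elim (¬b (Bounded.lfp-closed (Finite.member F q)
                   (inj₂ λ b → decidable-stable (Bounded.lfp? _) λ nb → h (b , nb))))

    opaque
      bounded-or-unbounded : (∃ λ m → ∀ w → P w → length w < m) ⊎ (∀ m → ∃ λ w → P w × m ≤ length w)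
      bounded-or-unbounded with Bounded.lfp? (init R)
      ... | yes b = let m , h = bounded-sound b in inj₁ (m , λ w p → h w (complete R w p))
      ... | no ¬b = inj₂ λ m → let w , f , h = unbounded-sound m ¬b in w , sound R w f , h

-- Suffix rewriting systems

-- edges q lists the rewritings u —l→ v applicable above a prefix leading to the state q.
record System (n : ℕ) (L : Set) : Set₁ where
  field
    State  : Set
    finite : Finite State
    δ      : State → Fin n → State
    edges  : State → List (Word n × L × Word n)

  run : State → Word n → State
  run = foldl δ

  Bound : ℕ → Set
  Bound K = ∀ q {u l v} → (u , l , v) ∈ edges q → length u ≤ K × length v ≤ K

  data Step : State → Word n → L → Word n → Set where
    here  : ∀ {q u l v} → (u , l , v) ∈ edges q → Step q u l v
    there : ∀ {q b x l y} → Step (δ q b) x l y → Step q (b ∷ x) l (b ∷ y)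

  data Path (q : State) : Word n → List L → Word n → Set where
    []  : ∀ {x} → Path q x [] x
    _∷_ : ∀ {x l y u z} → Step q x l y → Path q y u z → Path q x (l ∷ u) z

  Reach : State → Word n → Word n → Set
  Reach q x y = ∃ λ u → Path q x u y

  _++ᵖ_ : ∀ {q x u y v z} → Path q x u y → Path q y v z → Path q x (u ++ v) z
  [] ++ᵖ p = p
  (s ∷ r) ++ᵖ p = s ∷ (r ++ᵖ p)

  split-path : ∀ {q x z} u {v} → Path q x (u ++ v) z → ∃ λ y → Path q x u y × Path q y v z
  split-path [] p = _ , [] , p
  split-path (l ∷ u) (s ∷ p) = let y , p₁ , p₂ = split-path u p in y , s ∷ p₁ , p₂

  reach-trans : ∀ {q x y z} → Reach q x y → Reach q y z → Reach q x z
  reach-trans (u , p) (v , r) = u ++ v , p ++ᵖ r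

  raise : ∀ w {q x l y} → Step (run q w) x l y → Step q (w ++ x) l (w ++ y)
  raise [] s = s
  raise (b ∷ w) s = there (raise w s)

  raise-path : ∀ w {q x u y} → Path (run q w) x u y → Path q (w ++ x) u (w ++ y)
  raise-path w [] = []
  raise-path w (s ∷ p) = raise w s ∷ raise-path w p

  raise-reach : ∀ w {q x y} → Reach (run q w) x y → Reach q (w ++ x) (w ++ y)
  raise-reach w (u , p) = u , raise-path w p

  step-base : ∀ {q s l t} → Step q s l t → ∃₂ λ w u → ∃ λ v →
    (u , l , v) ∈ edges (run q w) × s ≡ w ++ u × t ≡ w ++ v
  step-base (here e) = [] , _ , _ , e , refl , refl
  step-base (there {b = b} s) with step-base s
  ... | w , u , v , e , refl , refl = b ∷ w , u , v , e , refl , refl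

  labels : List L
  labels = concatMap (λ q → map (proj₁ ∘ proj₂) (edges q)) (Finite.elements finite)

  label∈ : ∀ {q s l t} → Step q s l t → l ∈ labels
  label∈ (here {q} e) = ∈-concatMap⁺ (λ q → map (proj₁ ∘ proj₂) (edges q))
    (lose (Finite.member finite q) (∈-map⁺ (proj₁ ∘ proj₂) e))
  label∈ (there s) = label∈ s

  opaque
    bound : ∃ Bound
    bound = proj₁ overall , λ q m →
        ≤-trans (m≤m⊔n _ _) (≤-trans (proj₂ (perState q) m) (proj₂ overall (Finite.member finite q)))
      , ≤-trans (m≤n⊔m _ _) (≤-trans (proj₂ (perState q) m) (proj₂ overall (Finite.member finite q)))
      where
      size : Word n × L × Word n → ℕ
      size (u , _ , v) = length u ⊔ length v
      perState : ∀ q → ∃ λ m → ∀ {e} → e ∈ edges q → size e ≤ m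
      perState q = maximum size (edges q)
      overall : ∃ λ m → ∀ {q} → q ∈ Finite.elements finite → proj₁ (perState q) ≤ m
      overall = maximum (proj₁ ∘ perState) (Finite.elements finite)

  emit : Word n → Word n × L × Word n → List (L × Word n)
  emit s (u , l , v) = if does (u ≟ʷ s) then (l , v) ∷ [] else []

  emit-self : ∀ u {l v} → (l , v) ∈ emit u (u , l , v)
  emit-self u with u ≟ʷ u
  ... | yes _ = here refl
  ... | no ¬e = ⊥-elim (¬e refl)

  emit-sound : ∀ {s l t} e → (l , t) ∈ emit s e → e ≡ (s , l , t)
  emit-sound {s} (u , _) m with u ≟ʷ s
  emit-sound (u , _) (here refl) | yes refl = refl

  successors : State → Word n → List (L × Word n)
  successors q [] = concatMap (emit []) (edges q)
  successors q (b ∷ x) = concatMap (emit (b ∷ x)) (edges q) ++ map (λ (l , t) → l , b ∷ t) (successors (δ q b) x)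

  successors-complete : ∀ {q s l t} → Step q s l t → (l , t) ∈ successors q s
  successors-complete {q} {[]} (here e) = ∈-concatMap⁺ (emit []) (lose e (emit-self []))
  successors-complete {q} {b ∷ x} (here e) = ∈-++⁺ˡ (∈-concatMap⁺ (emit (b ∷ x)) (lose e (emit-self (b ∷ x))))
  successors-complete {q} {b ∷ x} (there s) =
    ∈-++⁺ʳ (concatMap (emit (b ∷ x)) (edges q)) (∈-map⁺ _ (successors-complete s))

  emitted : ∀ {q s l t} → (l , t) ∈ concatMap (emit s) (edges q) → Step q s l t
  emitted {q} {s} m with find (∈-concatMap⁻ (emit s) {xs = edges q} m)
  ... | e , m′ , o with emit-sound e o
  ...   | refl = here m′

  successors-sound : ∀ {q} s {l t} → (l , t) ∈ successors q s → Step q s l t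
  successors-sound [] m = emitted m
  successors-sound {q} (b ∷ x) m with ∈-++⁻ (concatMap (emit (b ∷ x)) (edges q)) m
  ... | inj₁ m₁ = emitted m₁
  ... | inj₂ m₁ with ∈-map⁻ _ m₁
  ...   | (l , t) , m₂ , refl = there (successors-sound x m₂)

module _ {n : ℕ} {L : Set} (S : System n L) where
  open System S

  module Bounds {K : ℕ} (bnd : Bound K) where

    -- A rewriting that touches `w` has in its left side all of `x` and at least one letter of `w`,
    -- hence the strict inequality.
    step-split : ∀ w {q x l t} → Step q (w ++ x) l t →
      (∃ λ y → t ≡ w ++ y × Step (run q w) x l y) ⊎ length x < K
    step-split [] s = inj₁ (_ , refl , s)
    step-split (b ∷ w) {x = x} (here e) =
      inj₂ (≤-trans (s≤s (subst (length x ≤_) (sym (length-++ w)) (m≤n+m _ _))) (proj₁ (bnd _ e)))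
    step-split (b ∷ w) (there s) with step-split w s
    ... | inj₁ (y , refl , s′) = inj₁ (y , refl , s′)
    ... | inj₂ h = inj₂ h

    step-length : ∀ {q x l y} → Step q x l y → length y ≤ K + length x
    step-length (here e) = ≤-trans (proj₂ (bnd _ e)) (m≤m+n _ _)
    step-length (there {x = x} {y = y} s) =
      subst (suc (length y) ≤_) (sym (+-suc K (length x))) (s≤s (step-length s))

    path-length : ∀ {q x u y} → Path q x u y → length y ≤ length x + K * length u
    path-length {x = x} [] = m≤m+n _ _
    path-length {x = x} (_∷_ {y = y} {u = u} s p) = ≤-trans (path-length p)
      (≤-trans (+-monoˡ-≤ (K * length u) (step-length s))
        (≤-reflexive (trans (cong (_+ K * length u) (+-comm K (length x)))
          (trans (+-assoc (length x) K _) (cong (length x +_) (sym (*-suc K (length u))))))))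

    -- The path leaves the cone above `w` at the short word `y`: a cone communicates with the rest
    -- of the graph only through finitely many words.
    path-split : ∀ w {q x u t} → Path q (w ++ x) u t →
      (∃ λ y → t ≡ w ++ y × Path (run q w) x u y) ⊎
      (∃ λ y → Reach (run q w) x y × length y < K × Reach q (w ++ y) t)
    path-split w [] = inj₁ (_ , refl , [])
    path-split w {x = x} (s ∷ p) with step-split w s
    ... | inj₂ h = inj₂ (x , (_ , []) , h , _ , s ∷ p)
    ... | inj₁ (y , refl , s′) with path-split w p
    ...   | inj₁ (z , e , p′) = inj₁ (z , e , s′ ∷ p′)
    ...   | inj₂ (z , (_ , r) , h) = inj₂ (z , (_ , s′ ∷ r) , h)

    -- The cut is at the first step that rewrites the letter `b`; the part before it is a path of
    -- the cone above `b`. The length bounds drive the induction in `extend`.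
    cut : ∀ {q b x u z} → Path q (b ∷ x) u z → ∃₂ λ y u₁ → Path (δ q b) x u₁ y × length u₁ ≤ length u ×
      (z ≡ b ∷ y ⊎ (∃₂ λ l v → ∃ λ u₂ → (b ∷ y , l , v) ∈ edges q × Path q v u₂ z × length u₂ < length u))
    cut [] = _ , [] , [] , z≤n , inj₁ refl
    cut (here e ∷ p) = _ , [] , [] , z≤n , inj₂ (_ , _ , _ , e , p , ≤-refl)
    cut (there s ∷ p) with cut p
    ... | y , u₁ , p₁ , h₁ , inj₁ e = y , _ , s ∷ p₁ , s≤s h₁ , inj₁ e
    ... | y , u₁ , p₁ , h₁ , inj₂ (l , v , u₂ , e , p₂ , h₂) =
      y , _ , s ∷ p₁ , s≤s h₁ , inj₂ (l , v , u₂ , e , p₂ , ≤-trans h₂ (n≤1+n _))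

  weaken-bound : ∀ {K K′} → K ≤ K′ → Bound K → Bound K′
  weaken-bound h bnd q m = ≤-trans (proj₁ (bnd q m)) h , ≤-trans (proj₂ (bnd q m)) h

  -- The words w x with x ∈ marks (run q w).
  module Marks (marks : State → List (Word n)) where

    data Marked : State → Word n → Set where
      here  : ∀ {q x} → x ∈ marks q → Marked q x
      there : ∀ {q b x} → Marked (δ q b) x → Marked q (b ∷ x)

    raise-mark : ∀ w {q x} → Marked (run q w) x → Marked q (w ++ x)
    raise-mark [] m = m
    raise-mark (b ∷ w) m = there (raise-mark w m)

    mark-base : ∀ {q s} → Marked q s → ∃₂ λ w x → s ≡ w ++ x × x ∈ marks (run q w)
    mark-base (here m) = [] , _ , refl , m
    mark-base (there {b = b} m) with mark-base m
    ... | w , x , refl , m′ = b ∷ w , x , refl , m′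

    MarkBound : ℕ → Set
    MarkBound K = ∀ {q x} → x ∈ marks q → length x ≤ K

    markBound : ∃ MarkBound
    markBound = proj₁ overall , λ {q} m → ≤-trans (proj₂ (perState q) m) (proj₂ overall (Finite.member finite q))
      where
      perState : ∀ q → ∃ λ m → ∀ {x} → x ∈ marks q → length x ≤ m
      perState q = maximum length (marks q)
      overall : ∃ λ m → ∀ {q} → q ∈ Finite.elements finite → proj₁ (perState q) ≤ m
      overall = maximum (proj₁ ∘ perState) (Finite.elements finite)

    -- A goal is to reach a given word or, for nothing, some marked word.
    Goal : Maybe (Word n) → State → Word n → Set
    Goal (just z) q t = t ≡ z
    Goal nothing q t = Marked q t

    Attains : State → Word n → Maybe (Word n) → Set
    Attains q x g = ∃ λ t → Reach q x t × Goal g q t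

    module Saturation {K : ℕ} (bnd : Bound K) (mark≤ : MarkBound K) where
      open Bounds bnd using (cut)
      open import Data.List.Membership.DecPropositional (_≟ʷ_ {n}) using (_∈?_)

      Atom : Set
      Atom = State × Word n × Maybe (Word n)

      _≟ᵃ_ : DecidableEquality Atom
      _≟ᵃ_ = ×-≡-dec (Finite._≟_ finite) (×-≡-dec _≟ʷ_ (≡-decᵐ _≟ʷ_))
        where open import Data.Maybe.Properties using () renaming (≡-dec to ≡-decᵐ)

      -- One letter more than `K`: both sides of an edge have length at most `K`, but an excursion
      -- above `b` returns to `b ∷ y` with `y` of length up to `K`.
      Short : Maybe (Word n) → Set
      Short (just z) = length z ≤ suc K
      Short nothing = ⊤

      atoms : List Atom
      atoms = cartesianProductWith _,_ (Finite.elements finite)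
        (cartesianProductWith _,_ (words≤ (suc K)) (nothing ∷ map just (words≤ (suc K))))

      atom∈ : ∀ {q x} g → length x ≤ suc K → Short g → (q , x , g) ∈ atoms
      atom∈ {q} {x} g hx hg = ∈-cartesianProductWith⁺ _,_ (Finite.member finite q)
        (∈-cartesianProductWith⁺ _,_ (∈-words≤ _ x hx) (goal∈ g hg))
        where
        goal∈ : ∀ g → Short g → g ∈ nothing ∷ map just (words≤ (suc K))
        goal∈ nothing _ = here refl
        goal∈ (just z) h = there (∈-map⁺ just (∈-words≤ _ z h))

      Done : State → Word n → Maybe (Word n) → Set
      Done q x (just z) = x ≡ z
      Done q x nothing = x ∈ marks q

      done? : ∀ q x g → Dec (Done q x g)
      done? q x (just z) = x ≟ʷ z
      done? q x nothing = x ∈? marks q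

      -- A fixed short word above `b` is reached by an excursion ending there, so it needs no rule
      -- of its own. A marked word may be arbitrarily long, and a path to it need never come back to
      -- a short word.
      Inside : (Atom → Set) → State → Word n → Maybe (Word n) → Set
      Inside P q x (just z) = ⊥
      Inside P q x nothing = P (q , x , nothing)

      inside? : ∀ {P : Atom → Set} → (∀ a → Dec (P a)) → ∀ q x g → Dec (Inside P q x g)
      inside? P? q x (just z) = no λ ()
      inside? P? q x nothing = P? _

      Excursion : (Atom → Set) → Atom → Set
      Excursion P (q , [] , g) = ⊥
      Excursion P (q , b ∷ x , g) = Inside P (δ q b) x g ⊎ (∃ λ y → y ∈ words≤ K × P (δ q b , x , just y) × P (q , b ∷ y , g))

      Derives : (Atom → Set) → Atom → Set
      Derives P (q , x , g) =
        Done q x g ⊎ (∃ λ e → e ∈ edges q × x ≡ proj₁ e × P (q , proj₂ (proj₂ e) , g)) ⊎ Excursion P (q , x , g)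

      derives-mono : ∀ {P R : Atom → Set} → (∀ a → P a → R a) → ∀ a → Derives P a → Derives R a
      derives-mono f a (inj₁ d) = inj₁ d
      derives-mono f a (inj₂ (inj₁ (e , m , p , r))) = inj₂ (inj₁ (e , m , p , f _ r))
      derives-mono f (q , b ∷ x , nothing) (inj₂ (inj₂ (inj₁ p))) = inj₂ (inj₂ (inj₁ (f _ p)))
      derives-mono f (q , b ∷ x , g) (inj₂ (inj₂ (inj₂ (y , m , p , r)))) = inj₂ (inj₂ (inj₂ (y , m , f _ p , f _ r)))

      derives-dec : ∀ {P : Atom → Set} → (∀ a → Dec (P a)) → ∀ a → Dec (Derives P a)
      derives-dec {P} P? (q , x , g) =
        done? q x g ⊎-dec (∃∈? (λ e → (x ≟ʷ proj₁ e) ×-dec P? _) (edges q) ⊎-dec excursion-dec x)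
        where
        excursion-dec : ∀ x → Dec (Excursion P (q , x , g))
        excursion-dec [] = no λ ()
        excursion-dec (b ∷ x) = inside? P? (δ q b) x g ⊎-dec ∃∈? (λ y → P? _ ×-dec P? _) (words≤ K)

      open LeastFixpoint _≟ᵃ_ atoms Derives derives-mono derives-dec using (lfp; lfp?; lfp-closed; lfp-least)

      sound : ∀ {q x g} → lfp (q , x , g) → Attains q x g
      sound = lfp-least (λ (q , x , g) → Attains q x g) (λ {a} → step a)
        where
        step : ∀ a → a ∈ atoms → Derives (λ (q , x , g) → Attains q x g) a → Attains (proj₁ a) (proj₁ (proj₂ a)) (proj₂ (proj₂ a))
        step (_ , _ , just z) _ (inj₁ e) = _ , (_ , []) , e
        step (_ , _ , nothing) _ (inj₁ m) = _ , (_ , []) , here m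
        step _ _ (inj₂ (inj₁ (_ , m , refl , t , (_ , p) , d))) = t , (_ , here m ∷ p) , d
        step (q , b ∷ x , nothing) _ (inj₂ (inj₂ (inj₁ (t , r , m)))) = b ∷ t , raise-reach [ b ] r , there m
        step (q , b ∷ x , g) _ (inj₂ (inj₂ (inj₂ (y , _ , (_ , r , refl) , t , r′ , d)))) =
          t , reach-trans (raise-reach [ b ] r) r′ , d

      Complete : ℕ → Set
      Complete m = ∀ {q} x g {u t} → length u < m → length x ≤ suc K → Short g → Path q x u t → Goal g q t → lfp (q , x , g)

      at-end : ∀ {q x} g → length x ≤ suc K → Short g → Done q x g → lfp (q , x , g)
      at-end g hx hg d = lfp-closed (atom∈ g hx hg) (inj₁ d)

      by-edge : ∀ {q u l v} g → Short g → (u , l , v) ∈ edges q → lfp (q , v , g) → lfp (q , u , g)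
      by-edge g hg e p = lfp-closed (atom∈ g (≤-trans (proj₁ (bnd _ e)) (n≤1+n _)) hg) (inj₂ (inj₁ (_ , e , refl , p)))

      edge-end : ∀ {q u l v} → (u , l , v) ∈ edges q → length v ≤ suc K
      edge-end e = ≤-trans (proj₂ (bnd _ e)) (n≤1+n _)

      -- Induction on the number of steps, and for a path that stays above the first letter on the length of x.
      extend : ∀ {m} → Complete m → Complete (suc m)
      extend IH [] (just z) h hx hg [] e = at-end (just z) hx hg e
      extend IH [] nothing h hx hg [] (here m) = at-end nothing hx hg m
      extend IH [] g (s≤s h) hx hg (here e ∷ p) d = by-edge g hg e (IH _ g h (edge-end e) hg p d)
      extend IH {q} (b ∷ x) g {u} (s≤s h) (s≤s hx) hg p d with cut p
      ... | y , u₁ , p₁ , h₁ , rest = finish rest g hg d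
        where
        via : ∀ g → Short g → length y ≤ K → lfp (q , b ∷ y , g) → lfp (q , b ∷ x , g)
        via g hg hy l = lfp-closed (atom∈ g (s≤s hx) hg) (inj₂ (inj₂ (inj₂ (y , ∈-words≤ K y hy
          , extend IH x (just y) (s≤s (≤-trans h₁ h)) (≤-trans hx (n≤1+n _)) (≤-trans hy (n≤1+n _)) p₁ refl , l))))
        finish : ∀ {t} → t ≡ b ∷ y ⊎ (∃₂ λ l v → ∃ λ u₂ → (b ∷ y , l , v) ∈ edges q × Path q v u₂ t × length u₂ < length u) →
          ∀ g → Short g → Goal g q t → lfp (q , b ∷ x , g)
        finish (inj₁ refl) (just _) hg refl = via _ hg (≤-pred hg) (at-end _ hg hg refl)
        finish (inj₁ refl) nothing hg (here m) = via nothing hg (≤-trans (n≤1+n _) (mark≤ m)) (at-end nothing (≤-trans (mark≤ m) (n≤1+n _)) hg m)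
        finish (inj₁ refl) nothing hg (there m) = lfp-closed (atom∈ nothing (s≤s hx) hg)
          (inj₂ (inj₂ (inj₁ (extend IH x nothing (s≤s (≤-trans h₁ h)) (≤-trans hx (n≤1+n _)) hg p₁ m))))
        finish (inj₂ (l , v , u₂ , e , p₂ , h₂)) g hg d = via g hg (≤-trans (n≤1+n _) (proj₁ (bnd _ e)))
          (by-edge g hg e (IH v g (<-≤-trans h₂ h) (edge-end e) hg p₂ d))

      complete : ∀ m → Complete m
      complete zero x g ()
      complete (suc m) = extend (complete m)

      attains-short? : ∀ q x g → length x ≤ suc K → Short g → Dec (Attains q x g)
      attains-short? q x g hx hg = map′ sound (λ (t , (u , p) , d) → complete (suc (length u)) x g ≤-refl hx hg p d) (lfp? (q , x , g))

    opaque
      attains? : ∀ q x g → Dec (Attains q x g)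
      attains? q x g = attains-short? q x g
        (≤-trans (≤-trans (m≤m⊔n (length x) (size g)) (m≤n⊔m (k₁ ⊔ k₂) _)) (n≤1+n K)) (short g (m≤n⊔m (length x) _))
        where
        size : Maybe (Word n) → ℕ
        size (just z) = length z
        size nothing = 0
        k₁ k₂ K : ℕ
        k₁ = proj₁ bound
        k₂ = proj₁ markBound
        -- `K` need only be an upper bound, so it is raised until the given `x` and `g` count as
        -- short.
        K = (k₁ ⊔ k₂) ⊔ (length x ⊔ size g)
        bnd : Bound K
        bnd = weaken-bound (≤-trans (m≤m⊔n k₁ k₂) (m≤m⊔n _ _)) (proj₂ bound)
        mark≤ : MarkBound K
        mark≤ m = ≤-trans (proj₂ markBound m) (≤-trans (m≤n⊔m k₁ k₂) (m≤m⊔n _ _))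
        open Saturation bnd mark≤
        short : ∀ g′ → size g′ ≤ length x ⊔ size g → Short g′
        short (just z) h = ≤-trans (≤-trans h (m≤n⊔m (k₁ ⊔ k₂) _)) (n≤1+n K)
        short nothing h = tt

  opaque
    reach? : ∀ q x y → Dec (Reach q x y)
    reach? q x y = map′ (λ { (_ , r , refl) → r }) (λ r → y , r , refl) (Marks.attains? (λ _ → []) q x (just y))

  step? : DecidableEquality L → ∀ q x l y → Dec (Step q x l y)
  step? _≟_ q x l y = map′ (successors-sound x) successors-complete ((l , y) ∈? successors q x)
    where open import Data.List.Membership.DecPropositional (×-≡-dec _≟_ _≟ʷ_) using (_∈?_)

  rev : System n L
  rev = record { State = State ; finite = finite ; δ = δ
               ; edges = λ q → map (λ (u , l , v) → v , l , u) (edges q) }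

  rev-step : ∀ {q x l y} → Step q x l y → System.Step rev q y l x
  rev-step (here e) = System.here (∈-map⁺ _ e)
  rev-step (there s) = System.there (rev-step s)

  rev-step⁻ : ∀ {q x l y} → System.Step rev q y l x → Step q x l y
  rev-step⁻ (System.here e) with ∈-map⁻ _ e
  ... | _ , m , refl = here m
  rev-step⁻ (System.there s) = there (rev-step⁻ s)

  rev-reach : ∀ {q x y} → Reach q x y → System.Reach rev q y x
  rev-reach (_ , []) = _ , System.[]
  rev-reach (_ , s ∷ p) = System.reach-trans rev (rev-reach (_ , p)) (_ , System._∷_ (rev-step s) System.[])

  rev-reach⁻ : ∀ {q x y} → System.Reach rev q x y → Reach q y x
  rev-reach⁻ (_ , System.[]) = _ , []
  rev-reach⁻ (_ , s System.∷ p) = reach-trans (rev-reach⁻ (_ , p)) (_ , rev-step⁻ s ∷ [])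

apply-true : ∀ {n} (xs : List (Word n)) ys {w} → apply false xs ys w ≡ true → w ∈ xs
apply-true [] [] ()
apply-true (x ∷ xs) (y ∷ ys) {w} e with w ≟ʷ x
... | yes p = here p
... | no _ = there (apply-true xs ys e)

does-true : ∀ {P : Set} (P? : Dec P) → does P? ≡ true → P
does-true (yes p) _ = p

true-does : ∀ {P : Set} (P? : Dec P) → P → does P? ≡ true
true-does (yes _) _ = refl
true-does (no ¬p) p = ⊥-elim (¬p p)

foldl-∷ʳ : ∀ {X Y : Set} (f : X → Y → X) x ys y → foldl f x (ys ∷ʳ y) ≡ f (foldl f x ys) y
foldl-∷ʳ f x [] y = refl
foldl-∷ʳ f x (z ∷ ys) y = foldl-∷ʳ f (f x z) ys y

-- The predecessors of a regular set of words form a regular set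

module Predecessors {n : ℕ} {L : Set} (S : System n L)
  (marks : System.State S → List (Word n)) (extra : List (Word n)) (q₀ : System.State S) where
  open System S
  open Marks S marks public

  IsTarget : Word n → Set
  IsTarget t = Marked q₀ t ⊎ t ∈ extra

  Pre : Word n → Set
  Pre s = ∃ λ t → Reach q₀ s t × IsTarget t

  ReachesMark : State → Word n → Set
  ReachesMark q x = Attains q x nothing

  module WithBound {K : ℕ} (bnd : Bound K) (mark≤ : MarkBound K) (extra≤ : ∀ {x} → x ∈ extra → length x ≤ K) where

    open Bounds S bnd using (path-split)

    mark-split : ∀ w {q x} → Marked q (w ++ x) → Marked (run q w) x ⊎ length x < K
    mark-split [] m = inj₁ m
    mark-split (b ∷ w) {x = x} (here m) = inj₂ (≤-trans (s≤s (subst (length x ≤_) (sym (length-++ w)) (m≤n+m _ _))) (mark≤ m))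
    mark-split (b ∷ w) (there m) = mark-split w m

    ports : List (Word n)
    ports = words≤ K

    -- After the prefix `w` the automaton remembers which short words `x` have `w x` in `Pre`; this
    -- is the content of `Inv`.
    Table : Set
    Table = Vec Bool (length ports)

    _∋_ : Table → Word n → Set
    A ∋ x = apply false ports A x ≡ true

    table : (Word n → Bool) → Table
    table = tabulateOn ports

    Start : Word n → Set
    Start x = ReachesMark q₀ x ⊎ (∃ λ r → r ∈ extra × Reach q₀ x r)

    start? : ∀ x → Dec (Start x)
    start? x = attains? q₀ x nothing ⊎-dec ∃∈? (λ r → reach? S q₀ x r) extra

    -- Either a mark based above `w b` is reached without touching that prefix, or the path comes to
    -- a short `y` over `w b`; then `b y` is a word over `w` whose status the previous table `A`
    -- contains.
    Next : State → Fin n → Table → Word n → Set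
    Next q b A x = ReachesMark (δ q b) x ⊎ (∃ λ y → y ∈ words≤ K × Reach (δ q b) x y × A ∋ (b ∷ y))

    next? : ∀ q b A x → Dec (Next q b A x)
    next? q b A x = attains? (δ q b) x nothing ⊎-dec ∃∈? (λ y → reach? S _ x y ×-dec (apply false ports A (b ∷ y) ≟ᵇ true)) (words≤ K)

    D : State × Table → Fin n → State × Table
    D (q , A) b = δ q b , table (λ x → does (next? q b A x))

    record Inv (w : Word n) (s : State × Table) : Set where
      field
        state : proj₁ s ≡ run q₀ w
        to    : ∀ x → proj₂ s ∋ x → Pre (w ++ x)
        from  : ∀ x → length x ≤ K → Pre (w ++ x) → proj₂ s ∋ x

    open Inv

    tabulated : ∀ {P : Word n → Set} (P? : ∀ x → Dec (P x)) x → table (does ∘ P?) ∋ x → P x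
    tabulated P? x e = does-true (P? x) (trans (sym (apply-tabulateOn false ports (does ∘ P?) (apply-true ports _ e))) e)

    tabulated⁻ : ∀ {P : Word n → Set} (P? : ∀ x → Dec (P x)) x → length x ≤ K → P x → table (does ∘ P?) ∋ x
    tabulated⁻ P? x h p = trans (apply-tabulateOn false ports (does ∘ P?) (∈-words≤ K x h)) (true-does (P? x) p)

    inv-start : Inv [] (q₀ , table (λ x → does (start? x)))
    state inv-start = refl
    to inv-start x e with tabulated start? x e
    ... | inj₁ (t , r , g) = t , r , inj₁ g
    ... | inj₂ (r , m , p) = r , p , inj₂ m
    from inv-start x h (t , r , inj₁ g) = tabulated⁻ start? x h (inj₁ (t , r , g))
    from inv-start x h (t , r , inj₂ m) = tabulated⁻ start? x h (inj₂ (t , m , r))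

    inv-step : ∀ {w s} b → Inv w s → Inv (w ∷ʳ b) (D s b)
    state (inv-step {w} b I) = trans (cong (λ q → δ q b) (state I)) (sym (foldl-∷ʳ δ q₀ w b))
    to (inv-step {w} {q , A} b I) x e
      rewrite ++-assoc w [ b ] x | state I with tabulated (next? (run q₀ w) b A) x e
    ... | inj₁ (t , r , g) =
      w ++ b ∷ t , raise-reach w (raise-reach (b ∷ []) r) , inj₁ (raise-mark w (there g))
    ... | inj₂ (y , _ , r , a) = let t , r′ , g = to I (b ∷ y) a in
      t , reach-trans (raise-reach w (raise-reach (b ∷ []) r)) r′ , g
    from (inv-step {w} {q , A} b I) x h (t , (u , p) , g) = tabulated⁻ (next? q b A) x h (next (path-split (w ∷ʳ b) p) g)
      where
      low : ∀ y → Reach (run q₀ (w ∷ʳ b)) x y → length y < K → Pre ((w ∷ʳ b) ++ y) → Next q b A x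
      low y r h′ P = inj₂ (y , ∈-words≤ K y (<⇒≤ h′) , subst (λ q′ → Reach q′ x y) (sym (state (inv-step b I))) r
        , from I (b ∷ y) h′ (subst Pre (++-assoc w [ b ] y) P))
      next : (∃ λ y → t ≡ (w ∷ʳ b) ++ y × Path (run q₀ (w ∷ʳ b)) x u y) ⊎
             (∃ λ y → Reach (run q₀ (w ∷ʳ b)) x y × length y < K × Reach q₀ ((w ∷ʳ b) ++ y) t) →
             IsTarget t → Next q b A x
      next (inj₂ (y , r , h′ , r′)) g = low y r h′ (t , r′ , g)
      -- A target in `extra` is at most `K` long, so its part beyond `w b` is shorter than `K`: only
      -- the initial table has to mention `extra`.
      next (inj₁ (y , refl , p′)) (inj₂ m) = low y (u , p′) (≤-trans (shorter w) (extra≤ m)) (_ , (_ , []) , inj₂ m)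
        where
        shorter : ∀ w → length y < length ((w ∷ʳ b) ++ y)
        shorter [] = ≤-refl
        shorter (c ∷ w) = ≤-trans (shorter w) (n≤1+n _)
      next (inj₁ (y , refl , p′)) (inj₁ g) with mark-split (w ∷ʳ b) g
      ... | inj₁ g′ = inj₁ (subst (λ q′ → ReachesMark q′ x) (sym (state (inv-step b I))) (y , (u , p′) , g′))
      ... | inj₂ h′ = low y (u , p′) h′ (_ , (_ , []) , inj₁ g)

    inv : ∀ w s {st} → Inv w st → Inv (w ++ s) (foldl D st s)
    inv w [] I = subst (λ v → Inv v _) (sym (++-identityʳ w)) I
    inv w (b ∷ s) I = subst (λ v → Inv v _) (++-assoc w [ b ] s) (inv (w ∷ʳ b) s (inv-step b I))

    pre-regular : Regular Pre
    pre-regular = record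
      { State = State × Table ; finite = ×-finite finite (Vec-finite Bool-finite _)
      ; δ = D ; init = q₀ , table (λ x → does (start? x))
      ; Final = λ s → proj₂ s ∋ [] ; final? = λ s → apply false ports (proj₂ s) [] ≟ᵇ true
      ; sound = λ w e → subst Pre (++-identityʳ w) (to (inv [] w inv-start) [] e)
      ; complete = λ w p → from (inv [] w inv-start) [] z≤n (subst Pre (sym (++-identityʳ w)) p) }

  private
    k₁ k₂ k₃ : ℕ
    k₁ = proj₁ bound
    k₂ = proj₁ markBound
    k₃ = proj₁ (maximum length extra)

  opaque
    pre-regular : Regular Pre
    pre-regular = WithBound.pre-regular {k₁ ⊔ (k₂ ⊔ k₃)} (weaken-bound S (m≤m⊔n _ _) (proj₂ bound))
      (λ m → ≤-trans (proj₂ markBound m) (≤-trans (m≤m⊔n k₂ k₃) (m≤n⊔m k₁ _)))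
      (λ m → ≤-trans (proj₂ (maximum length extra) m) (≤-trans (m≤n⊔m k₂ k₃) (m≤n⊔m k₁ _)))

module _ {n : ℕ} {L : Set} (S : System n L) where
  open System S

  opaque
    post-regular : ∀ q r → Regular (Reach q r)
    post-regular q r = map-regular
      (λ { w (t , p , inj₂ (here refl)) → rev-reach⁻ S p
         ; w (t , p , inj₁ m) → ⊥-elim (unmarked m) })
      (λ w p → r , rev-reach S p , inj₂ (here refl))
      pre-regular
      where
      open Predecessors (rev S) (λ _ → []) [ r ] q
      unmarked : ∀ {q w} → ¬ Marked q w
      unmarked (there m) = unmarked m

  module Marking (marks : State → List (Word n)) where
    private
      -- Without edges reachability is equality, so the predecessors of the marked words are the
      -- marked words themselves.
      still : System n L
      still = record { State = State ; finite = finite ; δ = δ ; edges = λ _ → [] }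
      module MK = Marks still marks
      no-path : ∀ {q x u y} → System.Path still q x u y → x ≡ y
      no-path System.[] = refl
      no-path (s System.∷ _) = ⊥-elim (no-step s)
        where
        no-step : ∀ {q x l y} → ¬ System.Step still q x l y
        no-step (System.there s) = no-step s

    MarkedAt : State → Word n → Set
    MarkedAt q s = ∃₂ λ w x → s ≡ w ++ x × x ∈ marks (run q w)

    opaque
      marked-regular : ∀ q → Regular (MarkedAt q)
      marked-regular q = map-regular
        (λ { s (t , (_ , p) , inj₁ m) → subst (MarkedAt q) (sym (no-path p)) (MK.mark-base m) })
        (λ { s (w , x , refl , m) → s , (_ , System.[]) , inj₁ (MK.raise-mark w (MK.here m)) })
        (Predecessors.pre-regular still marks [] q)

-- Isomorphism of rooted deterministic suffix graphs

∈-lookup-vector : ∀ {n} {Y : Set} {d : Y} {ys : List Y} (xs : List (Word n)) {f x} →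
  f ∈ vectors ys (length xs) → x ∈ xs → apply d xs f x ∈ ys
∈-lookup-vector {ys = ys} (z ∷ xs) {x = x} m i with ∈-cartesianProductWith⁻ _∷_ ys (vectors ys (length xs)) m
... | _ , _ , m₁ , m₂ , refl with x ≟ʷ z
...   | yes _ = m₁
∈-lookup-vector (z ∷ xs) m (here e) | _ , _ , m₁ , m₂ , refl | no ¬e = ⊥-elim (¬e e)
∈-lookup-vector (z ∷ xs) m (there i) | _ , _ , m₁ , m₂ , refl | no ¬e = ∈-lookup-vector xs m₂ i

++-compare : ∀ {X : Set} (a b c d : List X) → a ++ b ≡ c ++ d →
  (∃ λ v → c ≡ a ++ v × b ≡ v ++ d) ⊎ (∃ λ v → a ≡ c ++ v × d ≡ v ++ b)
++-compare [] b c d e = inj₁ (c , refl , e)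
++-compare (x ∷ a) b [] d e = inj₂ (x ∷ a , refl , sym e)
++-compare (x ∷ a) b (y ∷ c) d e with ∷-injective e
... | refl , e′ with ++-compare a b c d e′
...   | inj₁ (v , refl , e″) = inj₁ (v , refl , e″)
...   | inj₂ (v , refl , e″) = inj₂ (v , refl , e″)

strip? : ∀ {n} (w t : Word n) → Dec (∃ λ z → t ≡ w ++ z)
strip? [] t = yes (t , refl)
strip? (b ∷ w) [] = no λ { (_ , ()) }
strip? (b ∷ w) (c ∷ t) with b ≟ᶠ c | strip? w t
... | yes refl | yes (z , refl) = yes (z , refl)
... | no ¬e | _ = no λ { (_ , refl) → ¬e refl }
... | yes _ | no ¬p = no λ { (z , refl) → ¬p (z , refl) }

module _ {n : ℕ} {L : Set} (S : System n L) where
  open System S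

  Symmetric : Set
  Symmetric = ∀ q {u l v} → (u , l , v) ∈ edges q → ∃ λ l′ → (v , l′ , u) ∈ edges q

  module Symmetry (symm : Symmetric) where

    step-sym : ∀ {q x l y} → Step q x l y → ∃ λ l′ → Step q y l′ x
    step-sym (here e) = let l , e′ = symm _ e in l , here e′
    step-sym (there s) = let l , s′ = step-sym s in l , there s′

    reach-sym : ∀ {q x y} → Reach q x y → Reach q y x
    reach-sym (_ , []) = _ , []
    reach-sym (_ , s ∷ p) = let l , s′ = step-sym s in reach-trans (reach-sym (_ , p)) (_ , s′ ∷ [])

  opaque
    -- There are finitely many triples of a state and two short words; `B` is the greatest length of
    -- the paths that `reach?` returns for them. It does not depend on the prefix below, and all
    -- later uniform bounds rest on this.
    diameter : ∀ m → ∃ λ B → ∀ {q x y} → length x ≤ m → length y ≤ m → Reach q x y →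
      ∃ λ u → Path q x u y × length u ≤ B
    diameter m = B , λ {q} {x} {y} hx hy r → short-path (q , x , y)
      (∈-cartesianProductWith⁺ _,_ (Finite.member finite q) (∈-cartesianProductWith⁺ _,_ (∈-words≤ m x hx) (∈-words≤ m y hy))) r
      where
      triples : List (State × Word n × Word n)
      triples = cartesianProductWith _,_ (Finite.elements finite) (cartesianProductWith _,_ (words≤ m) (words≤ m))
      distance : State × Word n × Word n → ℕ
      distance (q , x , y) with reach? S q x y
      ... | yes (u , _) = length u
      ... | no _ = 0
      B : ℕ
      B = proj₁ (maximum distance triples)
      short-path : ∀ t → t ∈ triples → Reach (proj₁ t) (proj₁ (proj₂ t)) (proj₂ (proj₂ t)) →
        ∃ λ u → Path (proj₁ t) (proj₁ (proj₂ t)) u (proj₂ (proj₂ t)) × length u ≤ B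
      short-path (q , x , y) m r with reach? S q x y | proj₂ (maximum distance triples) m
      ... | yes (u , p) | h = u , p , h
      ... | no ¬r | _ = ⊥-elim (¬r r)

module Morphism {n : ℕ} {L : Set} (_≟ˡ_ : DecidableEquality L) (S T : System n L)
  (symS : Symmetric S) (symT : Symmetric T)
  (q₀ : System.State S) (p₀ : System.State T) (r s : Word n)
  {K : ℕ} (bndS : System.Bound S K) (bndT : System.Bound T K) (r≤ : length r ≤ K) (s≤ : length s ≤ K) where

  private
    module S = System S
    module T = System T
    module SB = Bounds S bndS
    module TB = Bounds T bndT
  open Symmetry S symS using (step-sym; reach-sym)

  private
    -- A step lengthens or shortens a word by at most `K`. Connected ports are at most `B₁` steps
    -- apart in `S`, connected words of length at most `K` at most `B₂` steps in `T`. `D₁` is the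
    -- height above `w°` given to the image of the anchor, one more than the estimates in `no-low`
    -- permit. An image longer than `D₀` leaves, below these `D₁` letters, a `w°` longer than `s`,
    -- and it keeps the root out of the component. Adding `K * B₁` for the other ports gives the
    -- bound `D` on all table entries.
    B₁ B₂ D₁ D₀ : ℕ
    B₁ = proj₁ (diameter S (suc K))
    B₂ = proj₁ (diameter T K)
    D₁ = suc (K + K * B₂ + K * B₁)
    D₀ = D₁ + (K + K * B₁)

    opaque
      D : ℕ
      D = D₀ + K * B₁

      D≡ : D ≡ D₀ + K * B₁
      D≡ = refl

      ports : List (Word n)
      ports = words≤ (suc K)

      port∈ : ∀ x → length x ≤ suc K → x ∈ ports
      port∈ = ∈-words≤ (suc K)

      port∈⁻ : ∀ {x} → x ∈ ports → length x ≤ suc K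
      port∈⁻ = ∈-words≤⁻ (suc K)

    Map : Set
    Map = Vec (Word n) (length ports)

    _⟦_⟧ : Map → Word n → Word n
    f ⟦ x ⟧ = apply [] ports f x

    maps : List Map
    maps = vectors (words≤ D) (length ports)

  -- (q , x₀ , p , f) describes a morphism on the component of x₀ in the cone above a word w with run q₀ w ≡ q:
  -- for a word w′ with run p₀ w′ ≡ p it sends w x to w′ f(x) for every short x in that component.
  Window : Set
  Window = S.State × Word n × T.State × Map

  private
    _≟ᵂ_ : DecidableEquality Window
    _≟ᵂ_ = ×-≡-dec (Finite._≟_ S.finite) (×-≡-dec _≟ʷ_ (×-≡-dec (Finite._≟_ T.finite) (≡-decᵛ _≟ʷ_)))
      where open import Data.Vec.Properties using () renaming (≡-dec to ≡-decᵛ)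

    windows : List Window
    windows = cartesianProductWith _,_ (Finite.elements S.finite) (cartesianProductWith _,_ ports
      (cartesianProductWith _,_ (Finite.elements T.finite) maps))

    window∈ : ∀ {q x p f} → length x ≤ suc K → f ∈ maps → (q , x , p , f) ∈ windows
    window∈ {q} {x} {p} h m = ∈-cartesianProductWith⁺ _,_ (Finite.member S.finite q) (∈-cartesianProductWith⁺ _,_
      (port∈ x h) (∈-cartesianProductWith⁺ _,_ (Finite.member T.finite p) m))

    window∈⁻ : ∀ {q x p f} → (q , x , p , f) ∈ windows → length x ≤ suc K
    window∈⁻ m with ∈-cartesianProductWith⁻ _,_ (Finite.elements S.finite) _ m
    ... | _ , _ , _ , m₁ , refl with ∈-cartesianProductWith⁻ _,_ ports _ m₁
    ...   | _ , _ , m₂ , _ , refl = port∈⁻ m₂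

  Preserves : Window → Set
  Preserves (q , x₀ , p , f) = ∀ e → e ∈ S.edges q → S.Reach q x₀ (proj₁ e) →
    T.Step p (f ⟦ proj₁ e ⟧) (proj₁ (proj₂ e)) (f ⟦ proj₂ (proj₂ e) ⟧)

  -- `v` is what a top-down transducer outputs on reading `b`: the component of `x` above `w b` is
  -- sent into the cone above `w′ v`, and the two tables must agree on the ports they share.
  Child : (Window → Set) → Window → Fin n → Word n → Set
  Child P (q , x₀ , p , f) b x = ∃ λ v → v ∈ words≤ D × ∃ λ g → g ∈ maps ×
    P (S.δ q b , x , T.run p v , g) ×
    (∀ y → y ∈ words≤ K → S.Reach (S.δ q b) x y → f ⟦ b ∷ y ⟧ ≡ v ++ g ⟦ y ⟧)

  Valid : (Window → Set) → Window → Set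
  Valid P θ@(q , x₀ , p , f) = Preserves θ ×
    (∀ b x → x ∈ words≤ K → S.Reach q x₀ (b ∷ x) → Child P θ b x)

  private
    valid-mono : ∀ {P R : Window → Set} → (∀ θ → P θ → R θ) → ∀ θ → Valid P θ → Valid R θ
    valid-mono h θ (pr , ch) = pr , λ b x m c → let v , mv , g , mg , p , a = ch b x m c in v , mv , g , mg , h _ p , a

    valid-dec : ∀ {P : Window → Set} → (∀ θ → Dec (P θ)) → ∀ θ → Dec (Valid P θ)
    valid-dec P? (q , x₀ , p , f) =
      ∀∈? (λ e → reach? S q x₀ (proj₁ e) →-dec step? T _≟ˡ_ p _ _ _) (S.edges q) ×-dec
      allFin? (λ b → ∀∈? (λ x → reach? S q x₀ (b ∷ x) →-dec
        ∃∈? (λ v → ∃∈? (λ g → P? _ ×-dec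
          ∀∈? (λ y → reach? S (S.δ q b) x y →-dec ((f ⟦ b ∷ y ⟧) ≟ʷ (v ++ g ⟦ y ⟧))) (words≤ K)) maps) (words≤ D)) (words≤ K))

    module Gfp = GreatestFixpoint _≟ᵂ_ windows Valid valid-mono valid-dec

    opaque
      Consistent : Window → Set
      Consistent = Gfp.gfp

      consistent? : ∀ θ → Dec (Consistent θ)
      consistent? = Gfp.gfp?

      consistent-valid : ∀ {θ} → θ ∈ windows → Consistent θ → Valid Consistent θ
      consistent-valid = Gfp.gfp-open

      consistent-greatest : ∀ (Z : Window → Set) → (∀ {θ} → Z θ → Valid Z θ) → ∀ {θ} → Z θ → Consistent θ
      consistent-greatest = Gfp.gfp-greatest

  Certificate : Set
  Certificate = ∃ λ f → f ∈ maps × f ⟦ r ⟧ ≡ s × Consistent (q₀ , r , p₀ , f)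

  opaque
    certificate? : Dec Certificate
    certificate? = ∃∈? (λ f → ((f ⟦ r ⟧) ≟ʷ s) ×-dec consistent? _) maps

  private
    -- A canonical anchor for each component. The branch taken depends on the anchor, and the two
    -- ends of an edge have to take the same one; `first-cong` secures this through the symmetry of
    -- `Reach`.
    first : List (Word n) → S.State → Word n → Maybe (Word n)
    first [] q t = nothing
    first (x ∷ xs) q t with reach? S q x t
    ... | yes _ = just x
    ... | no _ = first xs q t

    first-cong : ∀ xs {q t t′} → S.Reach q t t′ → first xs q t ≡ first xs q t′
    first-cong [] r = refl
    first-cong (x ∷ xs) {q} {t} {t′} r with reach? S q x t | reach? S q x t′
    ... | yes _ | yes _ = refl
    ... | no _ | no _ = first-cong xs r
    ... | yes a | no ¬b = ⊥-elim (¬b (S.reach-trans a r))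
    ... | no ¬a | yes b = ⊥-elim (¬a (S.reach-trans b (reach-sym r)))

    first-just : ∀ xs {q t x} → x ∈ xs → S.Reach q x t → ∃ λ x′ → first xs q t ≡ just x′ × x′ ∈ xs × S.Reach q x′ t
    first-just (x ∷ xs) {q} {t} m c with reach? S q x t
    ... | yes c′ = x , refl , here refl , c′
    first-just (x ∷ xs) (here refl) c | no ¬c = ⊥-elim (¬c c)
    first-just (x ∷ xs) (there m) c | no ¬c = let x′ , e , m′ , c′ = first-just xs m c in x′ , e , there m′ , c′

    Live : Window → Set
    Live θ = θ ∈ windows × Consistent θ

    record Branch (θ : Window) (b : Fin n) (x : Word n) : Set where
      field
        v     : Word n
        g     : Map
        live  : Live (S.δ (proj₁ θ) b , x , T.run (proj₁ (proj₂ (proj₂ θ))) v , g)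
        agree : ∀ y → y ∈ words≤ K → S.Reach (S.δ (proj₁ θ) b) x y → proj₂ (proj₂ (proj₂ θ)) ⟦ b ∷ y ⟧ ≡ v ++ g ⟦ y ⟧

    open Branch

    opaque
      branch : ∀ {θ} → Live θ → ∀ b x → Maybe (Branch θ b x)
      branch {q , x₀ , p , f} (m , ok) b x with length x ≤? K | reach? S q x₀ (b ∷ x)
      ... | no _ | _ = nothing
      ... | yes _ | no _ = nothing
      ... | yes h | yes c with proj₂ (consistent-valid m ok) b x (∈-words≤ K x h) c
      ...   | v′ , _ , g′ , mg , ok′ , a = just record
        { v = v′ ; g = g′ ; live = window∈ (≤-trans h (n≤1+n K)) mg , ok′ ; agree = a }

      branch-just : ∀ {θ} (ok : Live θ) b x → length x ≤ K → S.Reach (proj₁ θ) (proj₁ (proj₂ θ)) (b ∷ x) →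
        ∃ λ c → branch ok b x ≡ just c
      branch-just {q , x₀ , p , f} (m , ok) b x h c with length x ≤? K | reach? S q x₀ (b ∷ x)
      ... | no ¬h | _ = ⊥-elim (¬h h)
      ... | yes _ | no ¬c = ⊥-elim (¬c c)
      ... | yes h′ | yes c′ = _ , refl

    mutual
      image : ∀ {θ} → Live θ → Word n → Word n
      image {q , x₀ , p , f} ok [] = f ⟦ [] ⟧
      image {q , x₀ , p , f} ok (b ∷ t) with length (b ∷ t) ≤? suc K
      ... | yes _ = f ⟦ b ∷ t ⟧
      ... | no _ = imageᶠ ok b (first (words≤ K) (S.δ q b) t) t

      imageᶠ : ∀ {θ} → Live θ → Fin n → Maybe (Word n) → Word n → Word n
      -- This default and the one in `imageᵇ` are never met on the component of `x₀`, where
      -- `descend` provides an anchor and a branch.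
      imageᶠ ok b nothing t = []
      imageᶠ ok b (just x) t = imageᵇ (branch ok b x) t

      imageᵇ : ∀ {θ b x} → Maybe (Branch θ b x) → Word n → Word n
      imageᵇ nothing t = []
      imageᵇ (just c) t = v c ++ image (live c) t

    image-short : ∀ {θ} (ok : Live θ) t → length t ≤ suc K → image ok t ≡ proj₂ (proj₂ (proj₂ θ)) ⟦ t ⟧
    image-short ok [] h = refl
    image-short ok (b ∷ t) h with length (b ∷ t) ≤? suc K
    ... | yes _ = refl
    ... | no ¬h = ⊥-elim (¬h h)

    record Descent {θ} (ok : Live θ) (b : Fin n) (t : Word n) : Set where
      field
        anchor : Word n
        found  : first (words≤ K) (S.δ (proj₁ θ) b) t ≡ just anchor
        inside : S.Reach (S.δ (proj₁ θ) b) anchor t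
        choice : Branch θ b anchor
        chosen : branch ok b anchor ≡ just choice
        image-eq : image ok (b ∷ t) ≡ v choice ++ image (live choice) t

    -- Followed backwards, the path from `x₀` either stays above `b`, and then `x₀` itself lies
    -- there, or leaves at a short word; both cases give a short word connected to `t` in the cone
    -- above `b`.
    descend : ∀ {θ} (ok : Live θ) b t → S.Reach (proj₁ θ) (proj₁ (proj₂ θ)) (b ∷ t) → Descent ok b t
    descend {q , x₀ , p , f} ok b t c = record
      { anchor = x ; found = e ; inside = cx ; choice = proj₁ br ; chosen = proj₂ br ; image-eq = eq }
      where
      anchored : ∃ λ y → y ∈ words≤ K × S.Reach (S.δ q b) y t
      anchored with SB.path-split (b ∷ []) (proj₂ (reach-sym c))
      ... | inj₁ (y , refl , p) = y , ∈-words≤ K y (≤-pred (window∈⁻ (proj₁ ok))) , reach-sym (_ , p)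
      ... | inj₂ (y , p , h , _) = y , ∈-words≤ K y (<⇒≤ h) , reach-sym p
      fj : ∃ λ x → first (words≤ K) (S.δ q b) t ≡ just x × x ∈ words≤ K × S.Reach (S.δ q b) x t
      fj = first-just (words≤ K) (proj₁ (proj₂ anchored)) (proj₂ (proj₂ anchored))
      x : Word n
      x = proj₁ fj
      e : first (words≤ K) (S.δ q b) t ≡ just x
      e = proj₁ (proj₂ fj)
      cx : S.Reach (S.δ q b) x t
      cx = proj₂ (proj₂ (proj₂ fj))
      br : ∃ λ c → branch ok b x ≡ just c
      br = branch-just ok b x (∈-words≤⁻ K (proj₁ (proj₂ (proj₂ fj))))
        (S.reach-trans c (S.raise-reach (b ∷ []) (reach-sym cx)))
      eq : image ok (b ∷ t) ≡ v (proj₁ br) ++ image (live (proj₁ br)) t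
      eq with length (b ∷ t) ≤? suc K
      ... | yes h = trans (agree (proj₁ br) t (∈-words≤ K t (≤-pred h)) cx)
        (cong (v (proj₁ br) ++_) (sym (image-short (live (proj₁ br)) t (≤-trans (≤-pred h) (n≤1+n K)))))
      ... | no _ = trans (cong (λ m → imageᶠ ok b m t) e) (cong (λ m → imageᵇ m t) (proj₂ br))

    image-step : ∀ {θ} (ok : Live θ) {t l t′} → S.Reach (proj₁ θ) (proj₁ (proj₂ θ)) t → S.Step (proj₁ θ) t l t′ →
      T.Step (proj₁ (proj₂ (proj₂ θ))) (image ok t) l (image ok t′)
    image-step {q , x₀ , p , f} ok {t} {l} {t′} c (S.here e) =
      subst₂ (λ a b → T.Step p a l b) (sym (image-short ok t (≤-trans (proj₁ (bndS q e)) (n≤1+n K))))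
        (sym (image-short ok t′ (≤-trans (proj₂ (bndS q e)) (n≤1+n K))))
        (proj₁ (consistent-valid (proj₁ ok) (proj₂ ok)) _ e c)
    image-step {q , x₀ , p , f} ok {l = l} c st@(S.there {b = b} {x} {y = y} s) =
      go (descend ok b x c) (descend ok b y (S.reach-trans c (_ , S._∷_ st S.[])))
      where
      go : Descent ok b x → Descent ok b y → T.Step p (image ok (b ∷ x)) l (image ok (b ∷ y))
      go d d′ with trans (sym (Descent.found d)) (trans (first-cong (words≤ K) (_ , S._∷_ s S.[])) (Descent.found d′))
      ... | refl with trans (sym (Descent.chosen d)) (Descent.chosen d′)
      ...   | refl = subst₂ (λ a b → T.Step p a l b) (sym (Descent.image-eq d)) (sym (Descent.image-eq d′))
        (T.raise (v (Descent.choice d)) (image-step (live (Descent.choice d)) (Descent.inside d) s))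

  certificate-sound : Certificate → ∃ λ φ → φ r ≡ s ×
    (∀ {t l t′} → S.Reach q₀ r t → S.Step q₀ t l t′ → T.Step p₀ (φ t) l (φ t′))
  certificate-sound (f , m , e , ok) = image live₀ , trans (image-short live₀ r (≤-trans r≤ (n≤1+n K))) e , image-step live₀
    where
    live₀ : Live (q₀ , r , p₀ , f)
    live₀ = window∈ (≤-trans r≤ (n≤1+n K)) m , ok

  module Completeness (Rel : Word n → Word n → Set) (base : Rel r s)
    (functional : ∀ {t a b} → Rel t a → Rel t b → a ≡ b)
    (injective : ∀ {t u a} → Rel t a → Rel u a → t ≡ u)
    (forth : ∀ {t a l t′} → Rel t a → S.Step q₀ t l t′ → ∃ λ a′ → T.Step p₀ a l a′ × Rel t′ a′)
    (back : ∀ {t a l a′} → Rel t a → T.Step p₀ a l a′ → ∃ λ t′ → S.Step q₀ t l t′ × Rel t′ a′)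
    (rooted : ∀ {t a} → Rel t a → S.Reach q₀ r t) where

    forth-path : ∀ {t a u t′} → Rel t a → S.Path q₀ t u t′ → ∃ λ a′ → T.Path p₀ a u a′ × Rel t′ a′
    forth-path ρ S.[] = _ , T.[] , ρ
    forth-path ρ (s S.∷ p) with forth ρ s
    ... | a₁ , s′ , ρ₁ with forth-path ρ₁ p
    ...   | a₂ , p′ , ρ₂ = a₂ , s′ T.∷ p′ , ρ₂

    InCone : Word n → Word n → Word n → Set
    InCone w x t = ∃ λ z → t ≡ w ++ z × S.Reach (S.run q₀ w) x z

    inCone? : ∀ w x t → Dec (InCone w x t)
    inCone? w x t with strip? w t
    ... | no ¬p = no λ { (z , e , _) → ¬p (z , e) }
    ... | yes (z , refl) = map′ (λ c → z , refl , c)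
      (λ { (z′ , e , c) → subst (S.Reach _ x) (sym (++-cancelˡ w z z′ e)) c }) (reach? S _ x z)

    -- This makes it possible to store the isomorphism on the component of `w x` relative to `w°`,
    -- of which only the state is then kept.
    Confined : Word n → Word n → Word n → Set
    Confined w x w° = ∀ {z z′ l y} → S.Reach (S.run q₀ w) x z → Rel (w ++ z) (w° ++ y) →
      S.Step (S.run q₀ w) z l z′ → ∃ λ y′ → T.Step (T.run p₀ w°) y l y′ × Rel (w ++ z′) (w° ++ y′)

    follow : ∀ {w x w° z y u z′} → Confined w x w° → S.Reach (S.run q₀ w) x z → Rel (w ++ z) (w° ++ y) →
      S.Path (S.run q₀ w) z u z′ → ∃ λ y′ → T.Path (T.run p₀ w°) y u y′ × Rel (w ++ z′) (w° ++ y′)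
    follow C c ρ S.[] = _ , T.[] , ρ
    follow {w} {x} {w°} C c ρ (s S.∷ p) with C c ρ s
    ... | y₁ , s′ , ρ₁ with follow {w} {x} {w°} C (S.reach-trans c (_ , s S.∷ S.[])) ρ₁ p
    ...   | y₂ , p′ , ρ₂ = y₂ , s′ T.∷ p′ , ρ₂

    T-length⁻ : ∀ {q x l y} → T.Step q x l y → length x ≤ K + length y
    T-length⁻ s = TB.step-length (proj₂ (Symmetry.step-sym T symT s))

    -- Symmetry turns the bound on growth into one on shrinking: a step shortens a word by at most
    -- `K`, so `length u` steps from the height `K + K * length u` above `w` cannot touch `w`.
    deep-path : ∀ w {y u t} → K + K * length u ≤ length y → T.Path p₀ (w ++ y) u t →
      ∃ λ y′ → t ≡ w ++ y′ × T.Path (T.run p₀ w) y u y′ × length y ≤ length y′ + K * length u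
    deep-path w h T.[] = _ , refl , T.[] , m≤m+n _ _
    deep-path w {y} {l ∷ u} h (s T.∷ p) with TB.step-split w s
    ... | inj₂ h′ = ⊥-elim (<-irrefl refl (<-≤-trans h′ (≤-trans (m≤m+n K _) h)))
    ... | inj₁ (y₁ , refl , s′) with deep-path w {y₁} {u} (+-cancelˡ-≤ K _ _ (≤-trans (≤-trans (≤-reflexive
                (cong (K +_) (sym (*-suc K (length u))))) h) (T-length⁻ s′))) p
    ...   | y₂ , e , p′ , h₂ = y₂ , e , s′ T.∷ p′ , ≤-trans (T-length⁻ s′) (≤-trans (+-monoʳ-≤ K h₂) (≤-reflexive
                (trans (sym (+-assoc K (length y₂) _)) (trans (cong (_+ K * length u) (+-comm K (length y₂)))
                  (trans (+-assoc (length y₂) K _) (cong (length y₂ +_) (sym (*-suc K (length u)))))))))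

    -- The component C of w x in the cone above w is separated from the rest by short words over w. If its image
    -- left the cone above w°, where the image f₀ of w x lies deep above w°, then w° would carry short words both
    -- inside and outside the image of C, joined by a path bounded independently of w; that path crosses the
    -- image of the frontier of C, which lies close to f₀ and hence too far from w°.
    module Separation (w x : Word n) (x≤ : length x ≤ suc K) {w° y₀ : Word n} (ρ : Rel (w ++ x) (w° ++ y₀))
      (y₀≡ : length y₀ ≡ D₁) (s<w° : length s < length w°) (far : D₀ < length (w° ++ y₀)) where

      private
        q : S.State
        q = S.run q₀ w
        p : T.State
        p = T.run p₀ w°

      -- A short word of the component is at most `B₁` steps from `x`, and so are their images from
      -- each other; hence the image of the frontier cannot be much shorter than `w° ++ y₀`.
      near : ∀ {z c} → S.Reach q x z → length z ≤ suc K → Rel (w ++ z) c → length (w° ++ y₀) ≤ length c + K * B₁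
      near cz hz ρz with proj₂ (diameter S (suc K)) hz x≤ (reach-sym cz)
      ... | u , pu , hu with forth-path ρz (S.raise-path w pu)
      ...   | a , pa , ρa with functional ρa ρ
      ...     | refl = ≤-trans (TB.path-length pa) (+-monoʳ-≤ _ (*-monoʳ-≤ K hu))

      root-outside : ¬ InCone w x r
      root-outside (z , e , c) = <-irrefl refl (<-≤-trans far
        (≤-trans (near c (≤-trans (subst (length z ≤_) (trans (sym (length-++ w)) (cong length (sym e))) (m≤n+m _ _))
                    (≤-trans r≤ (n≤1+n K))) (subst (λ t → Rel t s) e base))
          (≤-trans (+-monoˡ-≤ _ s≤) (m≤n+m _ D₁))))

      data Avoiding : Word n → Set where
        end  : Avoiding r
        step : ∀ {t l t′} → ¬ InCone w x t → S.Step q₀ t l t′ → Avoiding t′ → Avoiding t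

      last-visit : ∀ {t u} → S.Path q₀ t u r →
        (¬ InCone w x t × Avoiding t) ⊎
        (∃₂ λ t₁ l → ∃ λ t₂ → InCone w x t₁ × S.Step q₀ t₁ l t₂ × ¬ InCone w x t₂ × Avoiding t₂)
      last-visit S.[] = inj₁ (root-outside , end)
      last-visit {t} (s S.∷ p) with last-visit p
      ... | inj₂ v = inj₂ v
      ... | inj₁ (¬c , a) with inCone? w x t
      ...   | yes c = inj₂ (t , _ , _ , c , s , ¬c , a)
      ...   | no ¬c′ = inj₁ (¬c′ , step ¬c′ s a)

      exit-low : ∀ {z l t} → S.Reach q x z → S.Step q₀ (w ++ z) l t → ¬ InCone w x t → length z < K
      exit-low c s ¬c with SB.step-split w s
      ... | inj₂ h = h
      ... | inj₁ (y , refl , s′) = ⊥-elim (¬c (y , refl , S.reach-trans c (_ , s′ S.∷ S.[])))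

      Outside : Set
      Outside = ∃₂ λ t y → ¬ InCone w x t × Rel t (w° ++ y) × T.Reach p y₀ y × length y < K

      -- The image of the remaining path to the root begins above `w°` and ends at `s`, which is
      -- shorter than `w°`; the step with which it leaves the cone starts at a short word.
      outside-from : ∀ {t y} → ¬ InCone w x t → Avoiding t → Rel t (w° ++ y) → T.Reach p y₀ y → Outside
      outside-from {y = y} _ end ρt c with functional base ρt
      ... | refl = ⊥-elim (<-irrefl refl (<-≤-trans s<w° (subst (length w° ≤_) (sym (length-++ w°)) (m≤m+n _ _))))
      outside-from {t} {y} ¬c (step _ s a) ρt c with forth ρt s
      ... | a₁ , s′ , ρ₁ with TB.step-split w° s′
      ...   | inj₂ h = t , y , ¬c , ρt , c , h
      ...   | inj₁ (y₁ , refl , s″) = outside-from (avoids a) a ρ₁ (T.reach-trans c (_ , s″ T.∷ T.[]))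
        where
        avoids : ∀ {t} → Avoiding t → ¬ InCone w x t
        avoids end = root-outside
        avoids (step ¬c _ _) = ¬c

      -- The vertex from which the path last leaves the component is short, so its image is at most
      -- `B₁` steps from `w° ++ y₀`. By `deep-path` this image is still above `w°`, and the margin
      -- in `D₁` keeps the next one there too.
      outside : Outside
      outside with last-visit (proj₂ (reach-sym (rooted ρ)))
      ... | inj₁ (¬c , _) = ⊥-elim (¬c (x , refl , _ , S.[]))
      ... | inj₂ (_ , l , t₂ , (z , refl , c) , st , ¬c₂ , a) with exit-low c st ¬c₂
      ...   | hz with proj₂ (diameter S (suc K)) x≤ (≤-trans (<⇒≤ hz) (n≤1+n K)) c
      ...     | u , pu , hu with forth-path ρ (S.raise-path w pu)
      ...       | f₁ , pf , ρ₁ with deep-path w° room pf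
        where
        room : K + K * length u ≤ length y₀
        room = subst (K + K * length u ≤_) (sym y₀≡)
          (≤-trans (+-mono-≤ (m≤m+n K (K * B₂)) (*-monoʳ-≤ K hu)) (n≤1+n _))
      ...         | y₁ , refl , py , h₁ with forth ρ₁ st
      ...           | a₂ , st′ , ρ₂ with TB.step-split w° st′
      ...             | inj₁ (y₂ , refl , st″) = outside-from ¬c₂ a ρ₂ (T.reach-trans (_ , py) (_ , st″ T.∷ T.[]))
      ...             | inj₂ h = ⊥-elim (<-irrefl refl (≤-trans (s≤s (+-mono-≤ (≤-trans (<⇒≤ h) (m≤m+n K (K * B₂))) (*-monoʳ-≤ K hu)))
                          (subst (_≤ length y₁ + K * length u) y₀≡ h₁)))

      -- Pulled back through the isomorphism, the path has to leave the component, and does so at a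
      -- short word; `c₁` is the corresponding vertex on the given path.
      pull : ∀ {t c v c′ t′} → InCone w x t → Rel t c → T.Path p₀ c v c′ → Rel t′ c′ → ¬ InCone w x t′ →
        ∃₂ λ z c₁ → length z < K × S.Reach q x z × Rel (w ++ z) c₁ × length c₁ ≤ length c + K * length v
      pull cn ρt T.[] ρt′ ¬c with injective ρt ρt′
      ... | refl = ⊥-elim (¬c cn)
      pull {c = c} (z , refl , cz) ρt (T._∷_ {u = v} st p) ρt′ ¬c with back ρt st
      ... | t₁ , st′ , ρ₁ with inCone? w x t₁
      ...   | no ¬c₁ = z , c , exit-low cz st′ ¬c₁ , cz , ρt , m≤m+n _ _
      ...   | yes c₁ with pull c₁ ρ₁ p ρt′ ¬c
      ...     | z₂ , c₂ , h , cz₂ , ρ₂ , h₂ = z₂ , c₂ , h , cz₂ , ρ₂ , ≤-trans h₂ (≤-trans (+-monoˡ-≤ (K * length v) (TB.step-length st))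
                (≤-reflexive (trans (cong (_+ K * length v) (+-comm K (length c)))
                  (trans (+-assoc (length c) K _) (cong (length c +_) (sym (*-suc K (length v))))))))

      -- If an image of the component came this low, a path of at most `B₂` steps to `outside` would
      -- cross the image of the frontier at length at most `length w° + K + K * B₂`, whereas `near`
      -- demands at least `length w° + D₁` minus `K * B₁`.
      no-low : ∀ {z y} → S.Reach q x z → T.Reach p y₀ y → Rel (w ++ z) (w° ++ y) → ¬ length y < K
      no-low {z} {y} cz cy ρz hy with outside
      ... | t , y′ , ¬c , ρt , cy′ , hy′
        with proj₂ (diameter T K) (<⇒≤ hy) (<⇒≤ hy′) (T.reach-trans (Symmetry.reach-sym T symT cy) cy′)
      ...   | v , pv , hv with pull (z , refl , cz) ρz (T.raise-path w° pv) ρt ¬c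
      ...     | z₂ , c , hz₂ , cz₂ , ρ₂ , h = <-irrefl refl (+-cancelˡ-≤ (length w°) _ _ (subst (_≤ length w° + (K + K * B₂ + K * B₁))
                  (trans (length-++ w°) (cong (length w° +_) y₀≡))
                  (≤-trans (near cz₂ (≤-trans (<⇒≤ hz₂) (n≤1+n K)) ρ₂)
                    (≤-trans (+-monoˡ-≤ (K * B₁) (≤-trans h (+-mono-≤ (≤-trans (≤-reflexive (length-++ w°)) (+-monoʳ-≤ (length w°) (<⇒≤ hy))) (*-monoʳ-≤ K hv))))
                      (≤-reflexive (trans (cong (_+ K * B₁) (+-assoc (length w°) K _)) (+-assoc (length w°) _ _)))))))

      walk : ∀ {z y u z′} → S.Reach q x z → T.Reach p y₀ y → Rel (w ++ z) (w° ++ y) → S.Path q z u z′ →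
        ∃ λ y′ → T.Reach p y₀ y′ × Rel (w ++ z′) (w° ++ y′)
      walk cz cy ρz S.[] = _ , cy , ρz
      walk cz cy ρz (st S.∷ p) with forth ρz (S.raise w st)
      ... | a₁ , st′ , ρ₁ with TB.step-split w° st′
      ...   | inj₂ h = ⊥-elim (no-low cz cy ρz h)
      ...   | inj₁ (y₁ , refl , st″) =
        walk (S.reach-trans cz (_ , st S.∷ S.[])) (T.reach-trans cy (_ , st″ T.∷ T.[])) ρ₁ p

      confined : Confined w x w°
      confined {z} {y = y} cz ρz st with walk (_ , S.[]) (_ , T.[]) ρ (proj₂ cz)
      ... | y₁ , cy , ρ₁ with ++-cancelˡ w° y₁ y (functional ρ₁ ρz)
      ...   | refl with forth ρz (S.raise w st)
      ...     | a₁ , st′ , ρ₂ with TB.step-split w° st′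
      ...       | inj₁ (y₂ , refl , st″) = y₂ , st″ , ρ₂
      ...       | inj₂ h = ⊥-elim (no-low cz cy ρz h)

    confinement : ∀ w x {f₀} → length x ≤ suc K → Rel (w ++ x) f₀ →
      ∃₂ λ w° y₀ → f₀ ≡ w° ++ y₀ × length y₀ ≤ D₀ × Confined w x w°
    confinement w x {f₀} hx ρ with length f₀ ≤? D₀
    -- A short image needs no separation: the cone above the empty word is the whole graph.
    ... | yes h = [] , f₀ , refl , h , λ cz ρz st → forth ρz (S.raise w st)
    ... | no h = take m f₀ , drop m f₀ , sym (take++drop≡id m f₀) , ≤-trans (≤-reflexive dropped) (m≤m+n D₁ _)
        , Separation.confined w x hx (subst (Rel (w ++ x)) (sym (take++drop≡id m f₀)) ρ) dropped deep
            (subst (λ f → D₀ < length f) (sym (take++drop≡id m f₀)) far)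
      where
      far : D₀ < length f₀
      far = ≰⇒> h
      m : ℕ
      m = length f₀ ∸ D₁
      D₁≤ : D₁ ≤ length f₀
      D₁≤ = ≤-trans (m≤m+n D₁ _) (<⇒≤ far)
      dropped : length (drop m f₀) ≡ D₁
      dropped = trans (length-drop m f₀) (m∸[m∸n]≡n D₁≤)
      deep : length s < length (take m f₀)
      deep = subst (length s <_) (sym (trans (length-take m f₀) (m≤n⇒m⊓n≡m (m∸n≤m (length f₀) D₁))))
        (+-cancelˡ-≤ D₁ _ _ (subst (D₁ + suc (length s) ≤_) (sym (m+[n∸m]≡n D₁≤))
          (≤-trans (subst (_≤ suc D₀) (sym (+-suc D₁ (length s))) (s≤s (+-monoʳ-≤ D₁ (≤-trans s≤ (m≤m+n K _))))) far)))

    record Realised (θ : Window) : Set where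
      field
        w w′     : Word n
        state₁   : S.run q₀ w ≡ proj₁ θ
        state₂   : T.run p₀ w′ ≡ proj₁ (proj₂ (proj₂ θ))
        short    : length (proj₁ (proj₂ θ)) ≤ suc K
        table∈   : proj₂ (proj₂ (proj₂ θ)) ∈ maps
        confined : Confined w (proj₁ (proj₂ θ)) w′
        values   : ∀ y → length y ≤ suc K → S.Reach (S.run q₀ w) (proj₁ (proj₂ θ)) y →
                   Rel (w ++ y) (w′ ++ proj₂ (proj₂ (proj₂ θ)) ⟦ y ⟧)

    realise : ∀ w x {w′ y₀} → length x ≤ suc K → Rel (w ++ x) (w′ ++ y₀) → length y₀ ≤ D₀ → Confined w x w′ →
      ∃ λ g → g ∈ maps × Realised (S.run q₀ w , x , T.run p₀ w′ , g) ×
        (∀ y → length y ≤ suc K → S.Reach (S.run q₀ w) x y → Rel (w ++ y) (w′ ++ g ⟦ y ⟧))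
    realise w x {w′} {y₀} hx ρ h₀ C = tabulateOn ports value , table∈ , record
        { w = w ; w′ = w′ ; state₁ = refl ; state₂ = refl ; short = hx ; table∈ = table∈ ; confined = C ; values = values }
      , values
      where
      at : ∀ y → length y ≤ suc K → S.Reach (S.run q₀ w) x y → ∃ λ z → length z ≤ D × Rel (w ++ y) (w′ ++ z)
      at y h c with proj₂ (diameter S (suc K)) hx h c
      ... | u , pu , hu with follow {w} {x} {w′} C (_ , S.[]) ρ pu
      ...   | z , pz , ρz = z , ≤-trans (TB.path-length pz) (subst (length y₀ + K * length u ≤_) (sym D≡)
                (+-mono-≤ h₀ (*-monoʳ-≤ K hu))) , ρz
      choose : ∀ y → Dec (length y ≤ suc K) → Dec (S.Reach (S.run q₀ w) x y) → Word n
      choose y (yes h) (yes c) = proj₁ (at y h c)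
      -- Words outside the component receive the dummy value `[]`, which keeps the table among the
      -- finitely many `maps`.
      choose y _ _ = []
      value : Word n → Word n
      value y = choose y (length y ≤? suc K) (reach? S _ x y)
      choose≤ : ∀ y d e → length (choose y d e) ≤ D
      choose≤ y (yes h) (yes c) = proj₁ (proj₂ (at y h c))
      choose≤ y (yes _) (no _) = z≤n
      choose≤ y (no _) _ = z≤n
      table∈ : tabulateOn ports value ∈ maps
      table∈ = ∈-vectors ports value (λ {y} _ → ∈-words≤ D _ (choose≤ y (length y ≤? suc K) (reach? S _ x y)))
      choose-rel : ∀ y d e → length y ≤ suc K → S.Reach (S.run q₀ w) x y → Rel (w ++ y) (w′ ++ choose y d e)
      choose-rel y (yes h) (yes c) _ _ = proj₂ (proj₂ (at y h c))
      choose-rel y (no ¬h) _ h _ = ⊥-elim (¬h h)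
      choose-rel y (yes _) (no ¬c) _ c = ⊥-elim (¬c c)
      values : ∀ y → length y ≤ suc K → S.Reach (S.run q₀ w) x y → Rel (w ++ y) (w′ ++ tabulateOn ports value ⟦ y ⟧)
      values y h c = subst (λ z → Rel (w ++ y) (w′ ++ z)) (sym (apply-tabulateOn [] ports value (port∈ y h)))
        (choose-rel y (length y ≤? suc K) (reach? S _ x y) h c)

    realised-valid : ∀ {θ} → Realised θ → Valid Realised θ
    realised-valid {_ , x₀ , _ , f} R@record { w = w ; w′ = w′ ; state₁ = refl ; state₂ = refl } = preserves , child
      where
      open Realised R using (short; table∈; confined; values)
      preserves : Preserves (S.run q₀ w , x₀ , T.run p₀ w′ , f)
      preserves (x , l , x′) e c with confined c (values x (≤-trans (proj₁ (bndS _ e)) (n≤1+n K)) c) (S.here e)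
      ... | y , st , ρ with ++-cancelˡ w′ y _ (functional ρ
              (values x′ (≤-trans (proj₂ (bndS _ e)) (n≤1+n K)) (S.reach-trans c (_ , S.here e S.∷ S.[]))))
      ...   | refl = st
      child : ∀ b x → x ∈ words≤ K → S.Reach (S.run q₀ w) x₀ (b ∷ x) → Child Realised (S.run q₀ w , x₀ , T.run p₀ w′ , f) b x
      child b x mx c = build (confinement (w ∷ʳ b) x hx ρ)
        where
        state≡ : S.run q₀ (w ∷ʳ b) ≡ S.δ (S.run q₀ w) b
        state≡ = foldl-∷ʳ S.δ q₀ w b
        hx : length x ≤ suc K
        hx = ≤-trans (∈-words≤⁻ K mx) (n≤1+n K)
        ρ : Rel ((w ∷ʳ b) ++ x) (w′ ++ f ⟦ b ∷ x ⟧)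
        ρ = subst (λ t → Rel t (w′ ++ f ⟦ b ∷ x ⟧)) (sym (++-assoc w [ b ] x)) (values (b ∷ x) (s≤s (∈-words≤⁻ K mx)) c)
        up : ∀ {y} → S.Reach (S.run q₀ (w ∷ʳ b)) x y → S.Reach (S.run q₀ w) x₀ (b ∷ y)
        up {y} c′ = S.reach-trans c (S.raise-reach [ b ] (subst (λ q → S.Reach q x y) state≡ c′))
        value≤ : length (f ⟦ b ∷ x ⟧) ≤ D
        value≤ = ∈-words≤⁻ D (∈-lookup-vector ports table∈ (port∈ (b ∷ x) (s≤s (∈-words≤⁻ K mx))))
        finish : ∀ v {y₀} → length v ≤ D → w′ ++ f ⟦ b ∷ x ⟧ ≡ (w′ ++ v) ++ y₀ → length y₀ ≤ D₀ →
          Confined (w ∷ʳ b) x (w′ ++ v) → Child Realised (S.run q₀ w , x₀ , T.run p₀ w′ , f) b x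
        finish v hv e h₀ C with realise (w ∷ʳ b) x hx (subst (Rel _) e ρ) h₀ C
        ... | g , mg , Rg , vals = v , ∈-words≤ D v hv , g , mg
            , subst₂ (λ q p → Realised (q , x , p , g)) state≡ (foldl-++ T.δ p₀ w′ v) Rg
            , λ y my c′ → ++-cancelˡ w′ _ _ (trans (functional (values (b ∷ y) (s≤s (∈-words≤⁻ K my)) (S.reach-trans c (S.raise-reach [ b ] c′)))
                (subst (λ t → Rel t _) (++-assoc w [ b ] y)
                  (vals y (≤-trans (∈-words≤⁻ K my) (n≤1+n K)) (subst (λ q → S.Reach q x y) (sym state≡) c′)))) (++-assoc w′ v _))
        build : (∃₂ λ w° y₀ → w′ ++ f ⟦ b ∷ x ⟧ ≡ w° ++ y₀ × length y₀ ≤ D₀ × Confined (w ∷ʳ b) x w°) →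
          Child Realised (S.run q₀ w , x₀ , T.run p₀ w′ , f) b x
        build (w° , y₀ , e , h₀ , C) with ++-compare w′ (f ⟦ b ∷ x ⟧) w° y₀ e
        ... | inj₁ (v , refl , e′) = finish v
              (≤-trans (≤-trans (m≤m+n (length v) (length y₀)) (≤-reflexive (trans (sym (length-++ v)) (cong length (sym e′))))) value≤) e h₀ C
        -- If `w°` is a prefix of `w′`, then `w′` itself serves: the component above `w b` is part
        -- of the one above `w`, whose confinement above `w′` is inherited.
        ... | inj₂ (v , refl , refl) = finish [] z≤n (sym (trans (++-assoc w′ [] _) refl))
              (≤-trans (≤-trans (m≤n+m _ (length v)) (≤-reflexive (sym (length-++ v)))) h₀) inherited
          where
          inherited : Confined (w ∷ʳ b) x (w′ ++ [])
          inherited {z} {z′} {l} {y} cz ρz st with confined (up cz)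
            (subst₂ Rel (++-assoc w [ b ] z) (++-assoc w′ [] y) ρz) (S.there (subst (λ q → S.Step q z l z′) state≡ st))
          ... | y′ , st′ , ρ′ = y′ , subst (λ p → T.Step p y l y′) (cong (T.run p₀) (sym (++-identityʳ w′))) st′
              , subst₂ Rel (sym (++-assoc w [ b ] z′)) (sym (++-assoc w′ [] y′)) ρ′

    certificate-complete : Certificate
    certificate-complete with realise [] r {[]} (≤-trans r≤ (n≤1+n K)) base (≤-trans s≤ (≤-trans (m≤m+n K _) (m≤n+m _ D₁)))
      (λ cz ρz st → forth ρz st)
    ... | f , mf , R , vals = f , mf , functional (vals r (≤-trans r≤ (n≤1+n K)) (_ , S.[])) base
        , consistent-greatest Realised realised-valid R

-- Equality of the kernels of two vertices

module _ {n : ℕ} {L : Set} (S : System n L) where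
  open System S

  restrict : ∀ {P : Word n → Set} → Regular P → System n L
  restrict R = record
    { State = State × R.State ; finite = ×-finite finite R.finite
    ; δ = λ p b → δ (proj₁ p) b , R.δ (proj₂ p) b
    ; edges = λ p → filter (λ e → R.final? (foldl R.δ (proj₂ p) (proj₁ e)) ×-dec
                                  R.final? (foldl R.δ (proj₂ p) (proj₂ (proj₂ e)))) (edges (proj₁ p)) }
    where module R = Regular R

  module _ {P : Word n → Set} (R : Regular P) where
    private
      module R = Regular R
      module SR = System (restrict R)

    restrict-step : ∀ {q x s l t} → Step q s l t → R.Final (foldl R.δ x s) → R.Final (foldl R.δ x t) →
      SR.Step (q , x) s l t
    restrict-step {q} {x} (here e) a b = SR.here (∈-filter⁺ _ e (a , b))
    restrict-step (there s) a b = SR.there (restrict-step s a b)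

    restrict-step⁻ : ∀ {q x s l t} → SR.Step (q , x) s l t →
      Step q s l t × R.Final (foldl R.δ x s) × R.Final (foldl R.δ x t)
    restrict-step⁻ {q} {x} (SR.here e) with ∈-filter⁻ (λ e → R.final? (foldl R.δ x (proj₁ e)) ×-dec
      R.final? (foldl R.δ x (proj₂ (proj₂ e)))) {xs = edges q} e
    ... | e′ , ab = here e′ , ab
    restrict-step⁻ (SR.there s) with restrict-step⁻ s
    ... | s′ , ab = there s′ , ab

  -- (l , true) is l and (l , false) its inverse.
  symmetrise : System n (L × Bool)
  symmetrise = record
    { State = State ; finite = finite ; δ = δ
    ; edges = λ q → map (λ (u , l , v) → u , (l , true) , v) (edges q) ++
                    map (λ (u , l , v) → v , (l , false) , u) (edges q) }

  private module Y = System symmetrise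

  symmetrise-symmetric : Symmetric symmetrise
  symmetrise-symmetric q e with ∈-++⁻ (map (λ (u , l , v) → u , (l , true) , v) (edges q)) e
  ... | inj₁ m with ∈-map⁻ _ m
  ...   | (u , l , v) , m′ , refl = (l , false) , ∈-++⁺ʳ (map _ (edges q)) (∈-map⁺ _ m′)
  symmetrise-symmetric q e | inj₂ m with ∈-map⁻ _ m
  ...   | (u , l , v) , m′ , refl = (l , true) , ∈-++⁺ˡ (∈-map⁺ _ m′)

  sym-forward : ∀ {q x l y} → Step q x l y → Y.Step q x (l , true) y
  sym-forward (here e) = Y.here (∈-++⁺ˡ (∈-map⁺ _ e))
  sym-forward (there s) = Y.there (sym-forward s)

  sym-backward : ∀ {q x l y} → Step q x l y → Y.Step q y (l , false) x
  sym-backward {q} (here e) = Y.here (∈-++⁺ʳ (map (λ (u , l , v) → u , (l , true) , v) (edges q)) (∈-map⁺ _ e))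
  sym-backward (there s) = Y.there (sym-backward s)

  Signed : State → Word n → L × Bool → Word n → Set
  Signed q x (l , true) y = Step q x l y
  Signed q x (l , false) y = Step q y l x

  sym-step⁻ : ∀ {q x k y} → Y.Step q x k y → Signed q x k y
  sym-step⁻ {q} (Y.here e) with ∈-++⁻ (map (λ (u , l , v) → u , (l , true) , v) (edges q)) e
  ... | inj₁ m with ∈-map⁻ _ m
  ...   | (u , l , v) , m′ , refl = here m′
  sym-step⁻ {q} (Y.here e) | inj₂ m with ∈-map⁻ _ m
  ...   | (u , l , v) , m′ , refl = here m′
  sym-step⁻ {k = l , true} (Y.there s) = there (sym-step⁻ s)
  sym-step⁻ {k = l , false} (Y.there s) = there (sym-step⁻ s)

  -- The equations `s·u = s·v` between defined paths; the diagonal pairs `(u , u)` record which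
  -- label sequences can be read from `s` at all.
  Ker : State → Word n → List L → List L → Set
  Ker q s u v = ∃ λ t → Path q s u t × Path q s v t

  Ker⊆ : State → Word n → Word n → Set
  Ker⊆ q r s = ∀ u v → Ker q r u v → Ker q s u v

  Deterministic : State → Set
  Deterministic q = ∀ {s l t t′} → Step q s l t → Step q s l t′ → t ≡ t′

  det-path : ∀ {q} → Deterministic q → ∀ {s u t t′} → Path q s u t → Path q s u t′ → t ≡ t′
  det-path d [] [] = refl
  det-path d (a ∷ p) (b ∷ p′) with d a b
  ... | refl = det-path d p p′

module Kernels {n : ℕ} {L : Set} (_≟ˡ_ : DecidableEquality L) (S : System n L) (q₀ : System.State S)
  (det : Deterministic S q₀) where
  open System S

  private
    Post : ∀ r → Regular (Reach q₀ r)
    Post r = post-regular S q₀ r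

    -- A kernel speaks only of the part reachable from `r`, but the cone argument needs undirected
    -- components: hence the symmetrisation of the restriction to that part.
    H : Word n → System n (L × Bool)
    H r = symmetrise (restrict S (Post r))

    start : ∀ r → System.State (H r)
    start r = q₀ , Regular.init (Post r)

    H-forward : ∀ {r x l y} → Reach q₀ r x → Step q₀ x l y → System.Step (H r) (start r) x (l , true) y
    H-forward {r} c s = sym-forward (restrict S (Post r)) (restrict-step S (Post r) s (Regular.complete (Post r) _ c)
      (Regular.complete (Post r) _ (reach-trans c (_ , s ∷ []))))

    H-backward : ∀ {r x l y} → Reach q₀ r x → Step q₀ x l y → System.Step (H r) (start r) y (l , false) x
    H-backward {r} c s = sym-backward (restrict S (Post r)) (restrict-step S (Post r) s (Regular.complete (Post r) _ c)
      (Regular.complete (Post r) _ (reach-trans c (_ , s ∷ []))))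

    H-forward⁻ : ∀ {r x l y} → System.Step (H r) (start r) x (l , true) y → Step q₀ x l y
    H-forward⁻ {r} s = proj₁ (restrict-step⁻ S (Post r) (sym-step⁻ (restrict S (Post r)) s))

    H-backward⁻ : ∀ {r x l y} → System.Step (H r) (start r) x (l , false) y → Step q₀ y l x × Reach q₀ r y
    H-backward⁻ {r} s with restrict-step⁻ S (Post r) (sym-step⁻ (restrict S (Post r)) s)
    ... | s′ , a , _ = s′ , Regular.sound (Post r) _ a

    module _ (r s : Word n) where
      b₁ b₂ : ℕ
      b₁ = proj₁ (System.bound (H r))
      b₂ = proj₁ (System.bound (H s))

      K : ℕ
      K = (b₁ ⊔ b₂) ⊔ (length r ⊔ length s)

      module C = Morphism (×-≡-dec _≟ˡ_ _≟ᵇ_) (H r) (H s) (symmetrise-symmetric (restrict S (Post r))) (symmetrise-symmetric (restrict S (Post s)))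
        (start r) (start s) r s {K}
        (weaken-bound (H r) (≤-trans (m≤m⊔n b₁ b₂) (m≤m⊔n _ _)) (proj₂ (System.bound (H r))))
        (weaken-bound (H s) (≤-trans (m≤n⊔m b₁ b₂) (m≤m⊔n _ _)) (proj₂ (System.bound (H s))))
        (≤-trans (m≤m⊔n (length r) _) (m≤n⊔m (b₁ ⊔ b₂) _)) (≤-trans (m≤n⊔m (length r) _) (m≤n⊔m (b₁ ⊔ b₂) _))

    certificate-⊆ : ∀ r s → C.Certificate r s → Ker⊆ S q₀ r s
    certificate-⊆ r s c with C.certificate-sound r s c
    ... | φ , e , hom = λ u v (t , p , p′) → φ t , transport p , transport p′
      where
      along : ∀ {x u t} → Reach q₀ r x → System.Reach (H r) (start r) r x → Path q₀ x u t → Path q₀ (φ x) u (φ t)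
      along cx hx [] = []
      along cx hx (st ∷ p) = H-forward⁻ (hom hx (H-forward cx st)) ∷
        along (reach-trans cx (_ , st ∷ [])) (System.reach-trans (H r) hx (_ , System._∷_ (H-forward cx st) System.[])) p
      transport : ∀ {u t} → Path q₀ r u t → Path q₀ s u (φ t)
      transport {u} {t} p = subst (λ z → Path q₀ z u (φ t)) e (along (_ , []) (_ , System.[]) p)

    Rel : Word n → Word n → Word n → Word n → Set
    Rel r s t a = ∃ λ u → Path q₀ r u t × Path q₀ s u a

    flip : ∀ {r s t a} → Rel r s t a → Rel s r a t
    flip (u , p , p′) = u , p′ , p

    functional : ∀ {r s} → Ker⊆ S q₀ r s → ∀ {t a b} → Rel r s t a → Rel r s t b → a ≡ b
    functional k (u , p , p′) (v , o , o′) with k u v (_ , p , o)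
    ... | c , z , z′ = trans (det-path S det p′ z) (det-path S det z′ o′)

    forth : ∀ {r s} → Ker⊆ S q₀ r s → ∀ {t a l t′} → Rel r s t a → System.Step (H r) (start r) t l t′ →
      ∃ λ a′ → System.Step (H s) (start s) a l a′ × Rel r s t′ a′
    forth {r} {s} k {a = a} {l , true} (u , p , p′) st with k (u ++ [ l ]) (u ++ [ l ]) (_ , p ++ᵖ (H-forward⁻ st ∷ []) , p ++ᵖ (H-forward⁻ st ∷ []))
    ... | a′ , z , _ with split-path u z
    ...   | y , z₁ , (st′ ∷ []) with det-path S det z₁ p′
    ...     | refl = a′ , H-forward (_ , p′) st′ , _ , p ++ᵖ (H-forward⁻ st ∷ []) , z
    -- The inverse edge leads to `t′`, which the restriction makes reachable, say by `u′`; the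
    -- equation `r·u′l = r·u` then holds at `s` too.
    forth {r} {s} k {a = a} {l , false} {t′} (u , p , p′) st with H-backward⁻ st
    ... | st′ , (u′ , o) with k (u′ ++ [ l ]) u (_ , o ++ᵖ (st′ ∷ []) , p)
    ...   | y , z , z′ with split-path u′ z | det-path S det z′ p′
    ...     | a′ , z₁ , (st″ ∷ []) | refl = a′ , H-backward (_ , z₁) st″ , u′ , o , z₁

    complete : ∀ r s → Ker⊆ S q₀ r s → Ker⊆ S q₀ s r → C.Certificate r s
    complete r s k k′ = C.Completeness.certificate-complete r s (Rel r s) ([] , [] , [])
      (functional k) (λ a b → functional k′ (flip a) (flip b)) (forth k)
      (λ ρ st → let t , st′ , ρ′ = forth k′ (flip ρ) st in t , st′ , flip ρ′)
      (λ { (u , p , _) → up (_ , []) p })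
      where
      up : ∀ {x u t} → Reach q₀ r x → Path q₀ x u t → System.Reach (H r) (start r) x t
      up c [] = _ , System.[]
      up c (st ∷ p) = System.reach-trans (H r) (_ , System._∷_ (H-forward c st) System.[])
        (up (reach-trans c (_ , st ∷ [])) p)

  SameKernel : Word n → Word n → Set
  SameKernel r s = Ker⊆ S q₀ r s × Ker⊆ S q₀ s r

  opaque
    -- One certificate proves one inclusion, but its existence is derived from both, which give
    -- injectivity and the backward direction. So equality of kernels is decided, not inclusion.
    sameKernel? : ∀ r s → Dec (SameKernel r s)
    sameKernel? r s = map′ (λ (c , c′) → certificate-⊆ r s c , certificate-⊆ s r c′)
      (λ (k , k′) → complete r s k k′ , complete s r k′ k)
      (C.certificate? r s ×-dec C.certificate? s r)

  sameKernel-trans : ∀ {r s t} → SameKernel r s → SameKernel s t → SameKernel r t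
  sameKernel-trans (a , b) (c , d) = (λ u v k → c u v (a u v k)) , λ u v k → b u v (d u v k)

  ker-shift : ∀ {s u t α β} → Path q₀ s u t → Ker S q₀ t α β → Ker S q₀ s (u ++ α) (u ++ β)
  ker-shift p (z , a , b) = z , p ++ᵖ a , p ++ᵖ b

  ker-unshift : ∀ {s u t α β} → Path q₀ s u t → Ker S q₀ s (u ++ α) (u ++ β) → Ker S q₀ t α β
  ker-unshift {u = u} p (z , a , b) with split-path u a | split-path u b
  ... | y , a₁ , a₂ | y′ , b₁ , b₂ with det-path S det a₁ p | det-path S det b₁ p
  ...   | refl | refl = z , a₂ , b₂

  same-after : ∀ {r s u r′ s′} → SameKernel r s → Path q₀ r u r′ → Path q₀ s u s′ → SameKernel r′ s′
  same-after (a , b) p p′ = (λ α β k → ker-unshift p′ (a _ _ (ker-shift p k))) , λ α β k → ker-unshift p (b _ _ (ker-shift p′ k))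

  -- The kernel of r a₁ ⋯ aₘ is determined by that of r a₁, which is that of r.
  module _ {r} (gen : ∀ {l t} → Step q₀ r l t → SameKernel r t) where

    same-from-root : ∀ {u t} → Path q₀ r u t → SameKernel r t
    same-from : ∀ {s u t} → SameKernel r s → Path q₀ s u t → SameKernel r t

    same-from-root [] = (λ _ _ k → k) , λ _ _ k → k
    same-from-root (_∷_ {u = u} st p) with proj₂ (gen st) u u (_ , p , p)
    -- The remaining labels `u` can also be read from `r`, so the recursion is on the label list and
    -- returns to the root.
    ... | t′ , p′ , _ = sameKernel-trans (same-from-root p′) (same-after (gen st) p′ p)

    same-from {u = u} same p with proj₂ same u u (_ , p , p)
    ... | t′ , p′ , _ = sameKernel-trans (same-from-root p′) (same-after same p′ p)

-- The system of a presentation of finite degree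

module _ {n : ℕ} where

  dfa-run : (d : DFA n) → ∀ q w → DFA.run d q w ≡ foldl (DFA.step d) q w
  dfa-run d q [] = refl
  dfa-run d q (b ∷ w) = dfa-run d (DFA.step d q b) w

  accepts-regular : (d : DFA n) → Regular (Accepts d)
  accepts-regular d = record
    { State = Fin (DFA.states d) ; finite = Fin-finite _ ; δ = DFA.step d ; init = DFA.start d
    ; Final = λ q → DFA.accept d q ≡ true ; final? = λ q → DFA.accept d q ≟ᵇ true
    ; sound = λ w e → trans (cong (DFA.accept d) (dfa-run d _ w)) e
    ; complete = λ w e → trans (cong (DFA.accept d) (sym (dfa-run d _ w))) e }

  Finitary : DFA n → Set
  Finitary d = ∃ λ us → (∀ {u} → u ∈ us → Accepts d u) × (∀ {u} → Accepts d u → u ∈ us)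

  finitary : (d : DFA n) → ∀ m → (∀ w → Accepts d w → length w < m) → Finitary d
  finitary d m h = filter a? (words≤ m) , (λ i → proj₂ (∈-filter⁻ a? {xs = words≤ m} i))
    , λ {u} a → ∈-filter⁺ a? (∈-words≤ m u (<⇒≤ (h u a))) a
    where
    a? : ∀ w → Dec (Accepts d w)
    a? w = DFA.accept d (DFA.run d (DFA.start d) w) ≟ᵇ true

  record FiniteRule (A : Set) : Set where
    field
      W     : DFA n
      us vs : List (Word n)
      label : A

  FiniteRuleEdge : {A : Set} → FiniteRule A → Word n → A → Word n → Set
  FiniteRuleEdge c s a t = ∃₂ λ w u → ∃ λ v → Accepts (FiniteRule.W c) w × u ∈ FiniteRule.us c × v ∈ FiniteRule.vs c ×
    s ≡ w ++ u × t ≡ w ++ v × a ≡ FiniteRule.label c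

  module RuleSystem {A : Set} where
    open FiniteRule

    States : List (FiniteRule A) → Set
    States [] = ⊤
    States (c ∷ cs) = Fin (DFA.states (W c)) × States cs

    states-finite : ∀ cs → Finite (States cs)
    states-finite [] = ⊤-finite
    states-finite (c ∷ cs) = ×-finite (Fin-finite _) (states-finite cs)

    next : ∀ cs → States cs → Fin n → States cs
    next [] q b = tt
    next (c ∷ cs) (q , qs) b = DFA.step (W c) q b , next cs qs b

    initial : ∀ cs → States cs
    initial [] = tt
    initial (c ∷ cs) = DFA.start (W c) , initial cs

    ruleEdges : FiniteRule A → List (Word n × A × Word n)
    ruleEdges c = cartesianProductWith (λ u v → u , label c , v) (us c) (vs c)

    edgesAt : ∀ cs → States cs → List (Word n × A × Word n)
    edgesAt [] q = []
    edgesAt (c ∷ cs) (q , qs) = (if DFA.accept (W c) q then ruleEdges c else []) ++ edgesAt cs qs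

    system : List (FiniteRule A) → System n A
    system cs = record { State = States cs ; finite = states-finite cs ; δ = next cs ; edges = edgesAt cs }

    next-run : ∀ c cs q qs w → foldl (next (c ∷ cs)) (q , qs) w ≡ (DFA.run (W c) q w , foldl (next cs) qs w)
    next-run c cs q qs [] = refl
    next-run c cs q qs (b ∷ w) = next-run c cs (DFA.step (W c) q b) (next cs qs b) w

    edge∈ : ∀ cs w {u a v} → (u , a , v) ∈ edgesAt cs (foldl (next cs) (initial cs) w) →
      ∃ λ c → c ∈ cs × Accepts (W c) w × u ∈ us c × v ∈ vs c × a ≡ label c
    edge∈ (c ∷ cs) w e rewrite next-run c cs (DFA.start (W c)) (initial cs) w
      with DFA.accept (W c) (DFA.run (W c) (DFA.start (W c)) w) in eq
    ... | false = let c′ , m , rest = edge∈ cs w e in c′ , there m , rest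
    ... | true with ∈-++⁻ (ruleEdges c) e
    ...   | inj₂ e′ = let c′ , m , rest = edge∈ cs w e′ in c′ , there m , rest
    ...   | inj₁ e′ with ∈-cartesianProductWith⁻ (λ u v → u , label c , v) (us c) (vs c) e′
    ...     | u , v , mu , mv , refl = c , here refl , eq , mu , mv , refl

    edge∈⁻ : ∀ {cs c} w {u v} → c ∈ cs → Accepts (W c) w → u ∈ us c → v ∈ vs c →
      (u , label c , v) ∈ edgesAt cs (foldl (next cs) (initial cs) w)
    edge∈⁻ {c ∷ cs} w (here refl) a mu mv rewrite next-run c cs (DFA.start (W c)) (initial cs) w | a =
      ∈-++⁺ˡ (∈-cartesianProductWith⁺ (λ u v → u , label c , v) mu mv)
    edge∈⁻ {c ∷ cs} w (there m) a mu mv rewrite next-run c cs (DFA.start (W c)) (initial cs) w =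
      ∈-++⁺ʳ (if DFA.accept (W c) (DFA.run (W c) (DFA.start (W c)) w) then ruleEdges c else []) (edge∈⁻ w m a mu mv)

    system-sound : ∀ {cs s a t} → System.Step (system cs) (initial cs) s a t → ∃ λ c → c ∈ cs × FiniteRuleEdge c s a t
    system-sound {cs} st with System.step-base (system cs) st
    ... | w , u , v , e , es , et with edge∈ cs w e
    ...   | c , m , aw , mu , mv , el = c , m , w , u , v , aw , mu , mv , es , et , el

    system-complete : ∀ {cs c s a t} → c ∈ cs → FiniteRuleEdge c s a t → System.Step (system cs) (initial cs) s a t
    system-complete {cs} m (w , u , v , aw , mu , mv , refl , refl , refl) =
      System.raise (system cs) w (System.here (edge∈⁻ {cs} w m aw mu mv))

  module Compile {A : Set} (P : Presentation n A) (fd : FiniteDegree P) where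

    -- If W, U and V are non-empty then U and V are finite, for otherwise some vertex has infinite degree.
    compileRule : (ρ : Rule n A) → ρ ∈ P → ∃ λ c →
      (∀ {s a t} → RuleEdge ρ s a t → FiniteRuleEdge c s a t) × (∀ {s a t} → FiniteRuleEdge c s a t → RuleEdge ρ s a t)
    compileRule ρ m with ∃-regular? (accepts-regular (Rule.W ρ)) | ∃-regular? (accepts-regular (Rule.U ρ)) | ∃-regular? (accepts-regular (Rule.V ρ))
    ... | yes (w , aw) | yes (u , au) | yes (v , av) = record { W = Rule.W ρ ; us = proj₁ fU ; vs = proj₁ fV ; label = Rule.label ρ }
        , (λ { (w , u , v , aw , au , av , e) → w , u , v , aw , proj₂ (proj₂ fU) au , proj₂ (proj₂ fV) av , e })
        , (λ { (w , u , v , aw , mu , mv , e) → w , u , v , aw , proj₁ (proj₂ fU) mu , proj₁ (proj₂ fV) mv , e })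
      where
      size : Word n × A × Word n → ℕ
      size (s , _ , t) = length s ⊔ length t
      edge : ∀ u v → Accepts (Rule.U ρ) u → Accepts (Rule.V ρ) v → Edge P (w ++ u) (Rule.label ρ) (w ++ v)
      edge _ _ au av = ρ , m , w , _ , _ , aw , au , av , refl , refl , refl
      long : ∀ (u : Word n) {x} → suc x ≤ length u → ¬ length (w ++ u) ≤ x
      long u h h′ = <-irrefl refl (≤-trans h (≤-trans (subst (length u ≤_) (sym (length-++ w)) (m≤n+m _ _)) h′))
      fU : Finitary (Rule.U ρ)
      fU with bounded-or-unbounded (accepts-regular (Rule.U ρ)) | fd (w ++ v)
      ... | inj₁ (k , h) | _ = finitary (Rule.U ρ) k h
      ... | inj₂ h | es , all-es with maximum size es
      ...   | x , mx with h (suc x)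
      ...     | u′ , au′ , hu = ⊥-elim (long u′ hu (≤-trans (m≤m⊔n _ _) (mx (all-es _ _ _ (edge u′ v au′ av) (inj₂ refl)))))
      fV : Finitary (Rule.V ρ)
      fV with bounded-or-unbounded (accepts-regular (Rule.V ρ)) | fd (w ++ u)
      ... | inj₁ (k , h) | _ = finitary (Rule.V ρ) k h
      ... | inj₂ h | es , all-es with maximum size es
      ...   | x , mx with h (suc x)
      ...     | v′ , av′ , hv = ⊥-elim (long v′ hv (≤-trans (m≤n⊔m (length (w ++ u)) _) (mx (all-es _ _ _ (edge u v′ au av′) (inj₁ refl)))))
    ... | no ¬w | _ | _ = record { W = Rule.W ρ ; us = [] ; vs = [] ; label = Rule.label ρ }
        , (λ { (w , _ , _ , aw , _) → ⊥-elim (¬w (w , aw)) }) , λ { (_ , _ , _ , _ , () , _) }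
    ... | yes _ | no ¬u | _ = record { W = Rule.W ρ ; us = [] ; vs = [] ; label = Rule.label ρ }
        , (λ { (_ , u , _ , _ , au , _) → ⊥-elim (¬u (u , au)) }) , λ { (_ , _ , _ , _ , () , _) }
    ... | yes _ | yes _ | no ¬v = record { W = Rule.W ρ ; us = [] ; vs = [] ; label = Rule.label ρ }
        , (λ { (_ , _ , v , _ , _ , av , _) → ⊥-elim (¬v (v , av)) }) , λ { (_ , _ , _ , _ , () , _) }

    compileAll : (R : Presentation n A) → (∀ {ρ} → ρ ∈ R → ρ ∈ P) → ∃ λ cs →
      (∀ {s a t} → Edge R s a t → ∃ λ c → c ∈ cs × FiniteRuleEdge c s a t) ×
      (∀ {s a t} → (∃ λ c → c ∈ cs × FiniteRuleEdge c s a t) → Edge R s a t)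
    compileAll [] h = [] , (λ { (_ , () , _) }) , λ { (_ , () , _) }
    compileAll (ρ ∷ R) h with compileRule ρ (h (here refl)) | compileAll R (h ∘ there)
    ... | c , to , from | cs , tos , froms = c ∷ cs
      , (λ { (_ , here refl , e) → c , here refl , to e
           ; (ρ′ , there m , e) → let c′ , m′ , e′ = tos (ρ′ , m , e) in c′ , there m′ , e′ })
      , λ { (_ , here refl , e) → ρ , here refl , from e
          ; (c′ , there m , e) → let ρ′ , m′ , e′ = froms (c′ , m , e) in ρ′ , there m′ , e′ }

  opaque
    compile : {A : Set} (P : Presentation n A) → FiniteDegree P → Σ (System n A) λ S → Σ (System.State S) λ q →
      (∀ {s a t} → Edge P s a t → System.Step S q s a t) × (∀ {s a t} → System.Step S q s a t → Edge P s a t)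
    compile P fd with Compile.compileAll P fd P id
    ... | cs , to , from = RuleSystem.system cs , RuleSystem.initial cs
      , (λ e → let c , m , e′ = to e in RuleSystem.system-complete m e′)
      , λ st → from (RuleSystem.system-sound st)

-- Local properties of suffix graphs

module _ {n : ℕ} {A : Set} (_≟_ : DecidableEquality A) (S : System n A) where
  open System S

  Simple : State → Set
  Simple q = ∀ {s a t a′ t′} → Step q s a t → Step q s a′ t′ → (a ≡ a′ → t ≡ t′) × (t ≡ t′ → a ≡ a′)

  private
    Compatible : A × Word n → A × Word n → Set
    Compatible (a , t) (a′ , t′) = (a ≡ a′ → t ≡ t′) × (t ≡ t′ → a ≡ a′)

    compatible? : ∀ e e′ → Dec (Compatible e e′)
    compatible? (a , t) (a′ , t′) = ((a ≟ a′) →-dec (t ≟ʷ t′)) ×-dec ((t ≟ʷ t′) →-dec (a ≟ a′))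

    -- When the common prefix of two edges with the same source is stripped, one of them becomes an
    -- edge of the state reached. Violations can be tested there, against all steps from its left
    -- side.
    Bad : State → Set
    Bad q = ∃ λ e → e ∈ edges q × ∃ λ e′ → e′ ∈ successors q (proj₁ e) × ¬ Compatible (proj₂ e) e′

    bad-regular : ∀ q → Regular (λ w → Bad (run q w))
    bad-regular q = record
      { State = State ; finite = finite ; δ = δ ; init = q ; Final = Bad
      ; final? = λ q → ∃∈? (λ e → ∃∈? (λ e′ → ¬? (compatible? _ e′)) (successors q (proj₁ e))) (edges q)
      ; sound = λ _ b → b ; complete = λ _ b → b }

    good⇒simple : ∀ {q} → (∀ w → ¬ Bad (run q w)) → Simple q
    good⇒simple h (here e) st = decidable-stable (compatible? _ _)
      λ ¬c → h [] (_ , e , _ , successors-complete st , ¬c)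
    good⇒simple h st@(there _) (here e) with decidable-stable (compatible? _ _) (λ ¬c → h [] (_ , e , _ , successors-complete st , ¬c))
    ... | c , c′ = (λ e₁ → sym (c (sym e₁))) , λ e₁ → sym (c′ (sym e₁))
    good⇒simple h (there {b = b} st) (there st′) with good⇒simple (λ w → h (b ∷ w)) st st′
    ... | c , c′ = (λ e → cong (b ∷_) (c e)) , λ e → c′ (∷-injectiveʳ e)

  opaque
    simple? : ∀ q → Dec (Simple q)
    simple? q with ∃-regular? (bad-regular q)
    ... | no ¬b = yes (good⇒simple λ w b → ¬b (w , b))
    ... | yes (w , (u , a , v) , e , (a′ , t′) , m , ¬c) = no λ simple →
      let c , c′ = simple (raise w (here e)) (raise w (successors-sound _ m))
      in ¬c ((λ e₁ → ++-cancelˡ w _ _ (c e₁)) , λ e₁ → c′ (cong (w ++_) e₁))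

  endpoint-regular : ∀ q → Regular (λ s → ∃₂ λ a t → Step q s a t ⊎ Step q t a s)
  endpoint-regular q = map-regular
    (λ { s (w , x , refl , m) → to w m })
    (λ { s (a , t , inj₁ st) → let w , u , v , e , es , et = step-base st in
                               w , u , es , ∈-++⁺ˡ (∈-map⁺ proj₁ e)
       ; s (a , t , inj₂ st) → let w , u , v , e , es , et = step-base st in
                               w , v , et , ∈-++⁺ʳ (map proj₁ (edges (run q w))) (∈-map⁺ (proj₂ ∘ proj₂) e) })
    (Marking.marked-regular S (λ q → map proj₁ (edges q) ++ map (proj₂ ∘ proj₂) (edges q)) q)
    where
    to : ∀ w {x} → x ∈ map proj₁ (edges (run q w)) ++ map (proj₂ ∘ proj₂) (edges (run q w)) →
      ∃₂ λ a t → Step q (w ++ x) a t ⊎ Step q t a (w ++ x)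
    to w m with ∈-++⁻ (map proj₁ (edges (run q w))) m
    ... | inj₁ m′ with ∈-map⁻ proj₁ m′
    ...   | (u , a , v) , e , refl = a , w ++ v , inj₁ (raise w (here e))
    to w m | inj₂ m′ with ∈-map⁻ (proj₂ ∘ proj₂) m′
    ...   | (u , a , v) , e , refl = a , w ++ u , inj₂ (raise w (here e))

  source-regular : ∀ a q → Regular (λ s → ∃ λ t → Step q s a t)
  source-regular a q = map-regular
    (λ { s (w , x , refl , m) → to w m })
    (λ { s (t , st) → let w , u , v , e , es , et = step-base st in
                      w , u , es , ∈-map⁺ proj₁ (∈-filter⁺ labelled? e refl) })
    (Marking.marked-regular S (λ q → map proj₁ (filter labelled? (edges q))) q)
    where
    labelled? : (e : Word n × A × Word n) → Dec (proj₁ (proj₂ e) ≡ a)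
    labelled? e = proj₁ (proj₂ e) ≟ a
    to : ∀ w {x} → x ∈ map proj₁ (filter labelled? (edges (run q w))) → ∃ λ t → Step q (w ++ x) a t
    to w m with ∈-map⁻ proj₁ m
    ... | (u , a′ , v) , e , refl with ∈-filter⁻ labelled? {xs = edges (run q w)} e
    ...   | e′ , refl = w ++ v , raise w (here e′)

record Presented {n : ℕ} {A : Set} (P : Presentation n A) : Set₁ where
  field
    ne   : NonEmpty P
    S    : System n A
    q₀   : System.State S
    to   : ∀ {s a t} → Edge P s a t → System.Step S q₀ s a t
    from : ∀ {s a t} → System.Step S q₀ s a t → Edge P s a t

module Graph {n : ℕ} {A : Set} (_≟_ : DecidableEquality A) (P : Presentation n A) (X : Presented P) where
  open Presented X public
  open System S

  private
    E : Word n → A → Word n → Set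
    E = Edge P
    V : Word n → Set
    V = Vertex P

  v₀ : Word n
  v₀ = proj₁ ne

  source : ∀ {s a t} → E s a t → V s
  source e = _ , _ , inj₁ e

  target : ∀ {s a t} → E s a t → V t
  target e = _ , _ , inj₂ e

  v₀-vertex : V v₀
  v₀-vertex = source (proj₂ (proj₂ (proj₂ ne)))

  opaque
    vertex-regular : Regular V
    vertex-regular = map-regular
      (λ { s (a , t , inj₁ st) → source (from st) ; s (a , t , inj₂ st) → target (from st) })
      (λ { s (a , t , inj₁ e) → a , t , inj₁ (to e) ; s (a , t , inj₂ e) → a , t , inj₂ (to e) })
      (endpoint-regular _≟_ S q₀)

  opaque
    vertex? : ∀ s → Dec (V s)
    vertex? = Regular.member? vertex-regular

  SimpleEdges : Set
  SimpleEdges = ∀ {s a t a′ t′} → E s a t → E s a′ t′ → (a ≡ a′ → t ≡ t′) × (t ≡ t′ → a ≡ a′)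

  CoSimpleEdges : Set
  CoSimpleEdges = ∀ {s a t a′ s′} → E s a t → E s′ a′ t → (a ≡ a′ → s ≡ s′) × (s ≡ s′ → a ≡ a′)

  OutComplete : Set
  OutComplete = ∀ {s a t s′} → V s′ → E s a t → ∃ λ t′ → E s′ a t′

  InComplete : Set
  InComplete = ∀ {s a t t′} → V t′ → E s a t → ∃ λ s′ → E s′ a t′

  opaque
    simpleEdges? : Dec SimpleEdges
    simpleEdges? = map′ down up (simple? _≟_ S q₀)
      where
      down : Simple _≟_ S q₀ → SimpleEdges
      down d e e′ = d (to e) (to e′)
      up : SimpleEdges → Simple _≟_ S q₀
      up d e e′ = d (from e) (from e′)

    coSimpleEdges? : Dec CoSimpleEdges
    coSimpleEdges? = map′ down up (simple? _≟_ (rev S) q₀)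
      where
      down : Simple _≟_ (rev S) q₀ → CoSimpleEdges
      down d e e′ = d (rev-step S (to e)) (rev-step S (to e′))
      up : CoSimpleEdges → Simple _≟_ (rev S) q₀
      up d e e′ = d (from (rev-step⁻ S e)) (from (rev-step⁻ S e′))

  private
    Uniform : (A → Word n → Set) → Set
    Uniform R = ∀ {a s s′} → R a s → V s′ → R a s′

    uniform? : ∀ {R : A → Word n → Set} → (∀ a → Regular (R a)) → (∀ {a s} → R a s → a ∈ labels) → Dec (Uniform R)
    uniform? {R} reg lab = map′ sound complete (∀∈? (λ a →
        ¬? (∃-regular? (reg a)) ⊎-dec ¬? (∃-regular? (×-regular vertex-regular (¬-regular (reg a))))) labels)
      where
      Ok : A → Set
      Ok a = ¬ ∃ (R a) ⊎ ¬ (∃ λ s → V s × ¬ R a s)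
      sound : (∀ a → a ∈ labels → Ok a) → Uniform R
      sound h {a} {s} {s′} r v with h a (lab r)
      ... | inj₁ ¬p = ⊥-elim (¬p (s , r))
      ... | inj₂ ¬p = decidable-stable (Regular.member? (reg a) s′) λ ¬r → ¬p (s′ , v , ¬r)
      complete : Uniform R → ∀ a → a ∈ labels → Ok a
      complete u a _ with ∃-regular? (reg a)
      ... | no ¬p = inj₁ ¬p
      ... | yes (_ , r) = inj₂ λ { (s , v , ¬r) → ¬r (u r v) }

  opaque
    outComplete? : Dec OutComplete
    outComplete? = map′ down up (uniform? (λ a → source-regular _≟_ S a q₀) λ (_ , st) → label∈ st)
      where
      down : Uniform (λ a s → ∃ λ t → Step q₀ s a t) → OutComplete
      down u v e = let t , st = u (_ , to e) v in t , from st
      up : OutComplete → Uniform (λ a s → ∃ λ t → Step q₀ s a t)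
      up oc (_ , st) v = let t , e = oc v (from st) in t , to e

    inComplete? : Dec InComplete
    inComplete? = map′ down up (uniform? (λ a → source-regular _≟_ (rev S) a q₀) λ (_ , st) → label∈ (rev-step⁻ S st))
      where
      down : Uniform (λ a s → ∃ λ t → System.Step (rev S) q₀ s a t) → InComplete
      down u v e = let t , st = u (_ , rev-step S (to e)) v in t , from (rev-step⁻ S st)
      up : InComplete → Uniform (λ a s → ∃ λ t → System.Step (rev S) q₀ s a t)
      up ic (_ , st) v = let t , e = ic v (from (rev-step⁻ S st)) in t , rev-step S (to e)

  successor : ∀ {s a t} → E s a t → (a , t) ∈ successors q₀ s
  successor e = successors-complete (to e)

  successor⁻ : ∀ {s a t} → (a , t) ∈ successors q₀ s → E s a t
  successor⁻ m = from (successors-sound _ m)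

  -- Off the list the value is the label of the edge given by non-emptiness.
  labelIn : List (A × Word n) → Word n → A
  labelIn [] s = proj₁ (proj₂ ne)
  labelIn ((a , t) ∷ es) s = if does (t ≟ʷ s) then a else labelIn es s

  labelFrom : Word n → Word n → A
  labelFrom r = labelIn (successors q₀ r)

  labelFrom-spec : SimpleEdges → ∀ {r a s} → E r a s → labelFrom r s ≡ a
  labelFrom-spec simple {r} {a} {s} e = go (successors q₀ r) id (successor e)
    where
    go : ∀ es → (∀ {x} → x ∈ es → x ∈ successors q₀ r) → (a , s) ∈ es →
      labelIn es s ≡ a
    go ((a′ , t) ∷ es) h m with t ≟ʷ s
    ... | yes refl = proj₂ (simple (successor⁻ (h (here refl))) e) refl
    go ((a′ , t) ∷ es) h (here refl) | no ¬e = ⊥-elim (¬e refl)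
    go ((a′ , t) ∷ es) h (there m) | no _ = go es (h ∘ there) m

  realization⇒kind : ∀ {k} → Realization P k → IsKind P k
  realization⇒kind (r , _ , op , lab , _ , d) = op , Succ P r , lab , d

  module _ {op : Word n → Word n → Word n} {Q : Word n → Set} {lab : Word n → A}
    (Q⊆V : ∀ q → Q q → V q) (lab-inj : ∀ q q′ → Q q → Q q′ → lab q ≡ lab q′ → q ≡ q′)
    (cayley : IsCayleyGraphOf P op Q lab) where

    cayley-simple : LeftCancellative V op → SimpleEdges
    cayley-simple lc {s} {a} {t} {a′} {t′} e e′ with proj₁ (cayley s a t) e | proj₁ (cayley s a′ t′) e′
    ... | vs , q , Qq , refl , refl | _ , q′ , Qq′ , refl , refl =
      (λ el → cong (op s) (lab-inj q q′ Qq Qq′ el)) , λ et → cong lab (lc s q q′ vs (Q⊆V q Qq) (Q⊆V q′ Qq′) et)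

    cayley-cosimple : SimpleEdges → RightCancellative V op → CoSimpleEdges
    cayley-cosimple simple rc {s} {a} {t} {a′} {s′} e e′ with proj₁ (cayley s a t) e | proj₁ (cayley s′ a′ t) e′
    ... | vs , q , Qq , refl , et | vs′ , q′ , Qq′ , refl , et′ =
        (λ el → rc q s s′ (Q⊆V q Qq) vs vs′ (trans (sym et) (trans et′ (cong (op s′) (sym (lab-inj q q′ Qq Qq′ el))))))
      , λ { refl → proj₂ (simple e e′) refl }

    cayley-outComplete : OutComplete
    cayley-outComplete {s} {a} {t} {s′} vs e with proj₁ (cayley s a t) e
    ... | _ , q , Qq , el , _ = op s′ q , proj₂ (cayley s′ a (op s′ q)) (vs , q , Qq , el , refl)

    cayley-inComplete : (∀ p q → V p → V q → ∃ λ s → V s × op s p ≡ q) → InComplete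
    cayley-inComplete div {s} {a} {t} {t′} vt e with proj₁ (cayley s a t) e
    ... | _ , q , Qq , el , _ with div q t′ (Q⊆V q Qq) vt
    ...   | s′ , vs′ , refl = s′ , proj₂ (cayley s′ a (op s′ q)) (vs′ , q , Qq , el , refl)

  -- Shared by all kinds: once right multiplication by each successor `q` of `r` follows the edges
  -- labelled like the one from `r` to `q`, only the algebraic axioms remain to be shown.
  module Realize (simple : SimpleEdges) (oc : OutComplete) {r : Word n} (vr : V r) {op : Word n → Word n → Word n}
    (closed : Closed V op) (follows : ∀ {s a t q} → E s a t → E r a q → op s q ≡ t) where

    lab : Word n → A
    lab = labelFrom r

    lab-inj : ∀ q q′ → Succ P r q → Succ P r q′ → lab q ≡ lab q′ → q ≡ q′
    lab-inj q q′ (a , e) (a′ , e′) el = proj₁ (simple e e′)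
      (trans (sym (labelFrom-spec simple e)) (trans el (labelFrom-spec simple e′)))

    cayley : IsCayleyGraphOf P op (Succ P r) lab
    cayley s a t = to′ , from′
      where
      to′ : E s a t → V s × (∃ λ q → Succ P r q × lab q ≡ a × t ≡ op s q)
      to′ e with oc vr e
      ... | q , eq = source e , q , (a , eq) , labelFrom-spec simple eq , sym (follows e eq)
      from′ : V s × (∃ λ q → Succ P r q × lab q ≡ a × t ≡ op s q) → E s a t
      from′ (vs , q , (b , eq) , refl , refl) with oc vs eq
      ... | t′ , e′ with labelFrom-spec simple eq
      ...   | eb = subst₂ (E s) (sym eb) (sym (follows e′ eq)) e′

    realization : ∀ k → KindAxioms P k op (Succ P r) → Realization P k
    realization _ ax = r , vr , op , lab , (λ s a e → labelFrom-spec simple e)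
      , closed , (λ { q (a , e) → target e }) , lab-inj , cayley , ax

-- Finite partial injections extend to permutations

module Extension {n : ℕ} where

  swap : Word n → Word n → Word n → Word n
  swap y z x = if does (x ≟ʷ y) then z else if does (x ≟ʷ z) then y else x

  swap-left : ∀ y z → swap y z y ≡ z
  swap-left y z with y ≟ʷ y
  ... | yes _ = refl
  ... | no ¬e = ⊥-elim (¬e refl)

  swap-right : ∀ y z → swap y z z ≡ y
  swap-right y z with z ≟ʷ y
  ... | yes e = e
  ... | no _ with z ≟ʷ z
  ...   | yes _ = refl
  ...   | no ¬e = ⊥-elim (¬e refl)

  swap-other : ∀ {y z x} → x ≢ y → x ≢ z → swap y z x ≡ x
  swap-other {y} {z} {x} a b with x ≟ʷ y
  ... | yes e = ⊥-elim (a e)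
  ... | no _ with x ≟ʷ z
  ...   | yes e = ⊥-elim (b e)
  ...   | no _ = refl

  swap-involutive : ∀ y z x → swap y z (swap y z x) ≡ x
  swap-involutive y z x with x ≟ʷ y | x ≟ʷ z
  ... | yes refl | _ = swap-right y z
  ... | no _ | yes refl = swap-left y z
  ... | no a | no b = swap-other a b

  swap-preserves : ∀ {V : Word n → Set} {y z x} → V y → V z → V x → V (swap y z x)
  swap-preserves {y = y} {z} {x} vy vz vx with x ≟ʷ y
  ... | yes _ = vz
  ... | no _ with x ≟ʷ z
  ...   | yes _ = vy
  ...   | no _ = vx

  -- Each new pair (x , y) is accommodated by a transposition of y with the current image of x.
  extend extend⁻¹ : List (Word n × Word n) → Word n → Word n
  extend [] w = w
  extend ((x , y) ∷ l) w = swap y (extend l x) (extend l w)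
  extend⁻¹ [] w = w
  extend⁻¹ ((x , y) ∷ l) w = extend⁻¹ l (swap y (extend l x) w)

  extend-inverseˡ : ∀ l w → extend⁻¹ l (extend l w) ≡ w
  extend-inverseˡ [] w = refl
  extend-inverseˡ ((x , y) ∷ l) w = trans (cong (extend⁻¹ l) (swap-involutive y (extend l x) _)) (extend-inverseˡ l w)

  extend-inverseʳ : ∀ l w → extend l (extend⁻¹ l w) ≡ w
  extend-inverseʳ [] w = refl
  extend-inverseʳ ((x , y) ∷ l) w = trans (cong (swap y (extend l x)) (extend-inverseʳ l _)) (swap-involutive y (extend l x) w)

  Injection : List (Word n × Word n) → Set
  Injection l = ∀ {x y x′ y′} → (x , y) ∈ l → (x′ , y′) ∈ l → (x ≡ x′ → y ≡ y′) × (y ≡ y′ → x ≡ x′)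

  -- Earlier pairs survive the new transposition: `y′` differs from `y` because the pairs form an
  -- injection, and from `extend l x` because `extend l` is injective.
  extend-extends : ∀ l → Injection l → ∀ {x y} → (x , y) ∈ l → extend l x ≡ y
  extend-extends ((x , y) ∷ l) inj (here refl) = swap-right y (extend l x)
  extend-extends ((x , y) ∷ l) inj {x′} {y′} (there m) with extend-extends l (λ a b → inj (there a) (there b)) m | x′ ≟ʷ x
  ... | _ | yes refl with proj₁ (inj (there m) (here refl)) refl
  ...   | refl = swap-right y (extend l x)
  extend-extends ((x , y) ∷ l) inj {x′} {y′} (there m) | e | no ¬e =
    trans (cong (swap y (extend l x)) e) (swap-other (λ ey → ¬e (proj₂ (inj (there m) (here refl)) ey))
      λ ey → ¬e (trans (sym (extend-inverseˡ l x′)) (trans (cong (extend⁻¹ l) (trans e ey)) (extend-inverseˡ l x))))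

  module _ {V : Word n → Set} where

    extend-preserves : ∀ l → (∀ {x y} → (x , y) ∈ l → V x × V y) → ∀ {w} → V w → V (extend l w)
    extend-preserves [] h v = v
    extend-preserves ((x , y) ∷ l) h v = swap-preserves {V} (proj₂ (h (here refl)))
      (extend-preserves l (h ∘ there) (proj₁ (h (here refl)))) (extend-preserves l (h ∘ there) v)

    extend⁻¹-preserves : ∀ l → (∀ {x y} → (x , y) ∈ l → V x × V y) → ∀ {w} → V w → V (extend⁻¹ l w)
    extend⁻¹-preserves [] h v = v
    extend⁻¹-preserves ((x , y) ∷ l) h v = extend⁻¹-preserves l (h ∘ there) (swap-preserves {V} (proj₂ (h (here refl)))
      (extend-preserves l (h ∘ there) (proj₁ (h (here refl)))) v)

-- Generalized Cayley graphs of left-quasigroups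

module LeftQuasigroups {n : ℕ} {A : Set} (_≟_ : DecidableEquality A) (P : Presentation n A) (X : Presented P) where
  open Graph _≟_ P X
  open System S
  open Extension {n}

  private
    V : Word n → Set
    V = Vertex P

  module Construction (simple : SimpleEdges) (oc : OutComplete) where

    private
      Entry : Set
      Entry = A × Word n

      same-label? : (e : Entry × Entry) → Dec (proj₁ (proj₁ e) ≡ proj₁ (proj₂ e))
      same-label? ((a , _) , (a′ , _)) = a ≟ a′

      candidates : Word n → List (Entry × Entry)
      candidates p = cartesianProductWith _,_ (successors q₀ v₀) (successors q₀ p)

    -- The required values v₀·a ↦ p·a of the left multiplication by p.
    pairs : Word n → List (Word n × Word n)
    pairs p = map (λ (e , e′) → proj₂ e , proj₂ e′) (filter same-label? (candidates p))

    pair∈ : ∀ {p a x y} → Edge P v₀ a x → Edge P p a y → (x , y) ∈ pairs p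
    pair∈ e e′ = ∈-map⁺ _ (∈-filter⁺ same-label? (∈-cartesianProductWith⁺ _,_ (successor e) (successor e′)) refl)

    pair∈⁻ : ∀ {p x y} → (x , y) ∈ pairs p → ∃ λ a → Edge P v₀ a x × Edge P p a y
    pair∈⁻ {p} m with ∈-map⁻ (λ ((_ , x) , (_ , y)) → x , y) m
    ... | ((a , x) , (a′ , y)) , m′ , refl with ∈-filter⁻ same-label? {xs = candidates p} m′
    ...   | m″ , refl with ∈-cartesianProductWith⁻ _,_ (successors q₀ v₀) (successors q₀ p) m″
    ...     | _ , _ , m₁ , m₂ , refl = a , successor⁻ m₁ , successor⁻ m₂

    pairs-injection : ∀ p → Injection (pairs p)
    pairs-injection p m m′ with pair∈⁻ {p} m | pair∈⁻ {p} m′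
    ... | a , e₁ , e₂ | a′ , e₁′ , e₂′ = (λ ex → proj₁ (simple e₂ e₂′) (proj₂ (simple e₁ e₁′) ex))
      , λ ey → proj₁ (simple e₁ e₁′) (proj₂ (simple e₂ e₂′) ey)

    pairs-vertices : ∀ p {x y} → (x , y) ∈ pairs p → V x × V y
    pairs-vertices p m with pair∈⁻ {p} m
    ... | a , e , e′ = target e , target e′

    op : Word n → Word n → Word n
    op p = extend (pairs p)

    leftQuasigroup : LeftQuasigroup V op
    leftQuasigroup p q vp vq =
      (extend⁻¹ (pairs p) q , extend⁻¹-preserves {V} (pairs p) (pairs-vertices p) vq , extend-inverseʳ (pairs p) q)
      , λ r r′ _ _ e e′ → trans (sym (extend-inverseˡ (pairs p) r))
          (trans (cong (extend⁻¹ (pairs p)) (trans e (sym e′))) (extend-inverseˡ (pairs p) r′))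

    realization : Realization P gen-cayley-leftQuasigroup
    realization = Realize.realization simple oc v₀-vertex
      (λ p q _ vq → extend-preserves {V} (pairs p) (pairs-vertices p) vq)
      (λ {s} e eq → extend-extends (pairs s) (pairs-injection s) (pair∈ eq e))
      gen-cayley-leftQuasigroup leftQuasigroup

  leftQuasigroup-cancellative : ∀ {op} → Closed V op → LeftQuasigroup V op → LeftCancellative V op
  leftQuasigroup-cancellative closed lq r p q vr vp vq e =
    proj₂ (lq r _ vr (closed r q vr vq)) p q vp vq e refl

  decide : Realization P gen-cayley-leftQuasigroup ⊎ ¬ IsKind P gen-cayley-leftQuasigroup
  decide with simpleEdges? | outComplete?
  ... | yes simple | yes oc = inj₁ (Construction.realization simple oc)
  ... | no ¬simple | _ = inj₂ λ { (op , Q , lab , closed , Q⊆V , inj , cay , lq) →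
    ¬simple (cayley-simple Q⊆V inj cay (leftQuasigroup-cancellative closed lq)) }
  ... | yes _ | no ¬oc = inj₂ λ { (op , Q , lab , closed , Q⊆V , inj , cay , lq) →
    ¬oc (cayley-outComplete Q⊆V inj cay) }

-- Monoid structures read off the paths of a graph

-- If all vertices have the same kernel and every vertex is b i · u for a unique i in a cancellative monoid I,
-- then (b i · u) (b j · v) = b (i ∙ j) · u v is well defined.
record IndexMonoid : Set₁ where
  field
    I       : Set
    _∙_     : I → I → I
    ε       : I
    assoc   : ∀ i j k → (i ∙ j) ∙ k ≡ i ∙ (j ∙ k)
    idˡ     : ∀ i → ε ∙ i ≡ i
    idʳ     : ∀ i → i ∙ ε ≡ i
    cancelˡ : ∀ k {i j} → k ∙ i ≡ k ∙ j → i ≡ j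

module PathMonoid {n : ℕ} {L : Set} (T : System n L) (q₀ : System.State T) (det : Deterministic T q₀)
  (V : Word n → Set) (V? : ∀ s → Dec (V s)) (V-target : ∀ {s l t} → System.Step T q₀ s l t → V t)
  (same : ∀ {s s′} → V s → V s′ → Ker⊆ T q₀ s s′) (M : IndexMonoid) (b : IndexMonoid.I M → Word n) (b-vertex : ∀ i → V (b i))
  (cover : ∀ {s} → V s → ∃ λ i → System.Reach T q₀ (b i) s)
  (unique : ∀ {i j s} → System.Reach T q₀ (b i) s → System.Reach T q₀ (b j) s → i ≡ j) where
  open System T
  open IndexMonoid M

  path-vertex : ∀ {s u t} → V s → Path q₀ s u t → V t
  path-vertex v [] = v
  path-vertex v (st ∷ p) = path-vertex (V-target st) p

  copy : ∀ {s u t s′} → V s → V s′ → Path q₀ s u t → ∃ λ t′ → Path q₀ s′ u t′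
  copy {u = u} vs vs′ p with same vs vs′ u u (_ , p , p)
  ... | t′ , p′ , _ = t′ , p′

  composite : ∀ {i j u v p q} → Path q₀ (b i) u p → Path q₀ (b j) v q → ∃ λ t → Path q₀ (b (i ∙ j)) (u ++ v) t
  composite {i} {j} pu pv = copy (b-vertex i) (b-vertex (i ∙ j)) (pu ++ᵖ proj₂ (copy (b-vertex j) (path-vertex (b-vertex i) pu) pv))

  product : ∀ {p q} → V p → V q → Word n
  product vp vq = proj₁ (composite (proj₂ (proj₂ (cover vp))) (proj₂ (proj₂ (cover vq))))

  op : Word n → Word n → Word n
  op p q with V? p | V? q
  ... | yes vp | yes vq = product vp vq
  -- The value off `V` is arbitrary: every axiom is relative to `V`.
  ... | _ | _ = []

  -- The equation `b i · u = b i · u′` transfers to `b (i ∙ j)`, and `b j · v = b j · v′` to the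
  -- vertex reached from there by `u`.
  well-defined : ∀ {i j u v p q t i′ j′ u′ v′ t′} → i ≡ i′ → j ≡ j′ →
    Path q₀ (b i) u p → Path q₀ (b j) v q → Path q₀ (b (i ∙ j)) (u ++ v) t →
    Path q₀ (b i′) u′ p → Path q₀ (b j′) v′ q → Path q₀ (b (i′ ∙ j′)) (u′ ++ v′) t′ → t ≡ t′
  well-defined {i} {j} {u} {v} {u′ = u′} {v′} refl refl pu pv pt pu′ pv′ pt′
    with split-path u pt | split-path u′ pt′ | same (b-vertex i) (b-vertex (i ∙ j)) u u′ (_ , pu , pu′)
  ... | y , pt₁ , pt₂ | y′ , pt₁′ , pt₂′ | z , pz , pz′ with det-path T det pt₁ pz | det-path T det pt₁′ pz′
  ...   | refl | refl with same (b-vertex j) (path-vertex (b-vertex _) pz) v v′ (_ , pv , pv′)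
  ...     | x , px , px′ = trans (det-path T det pt₂ px) (det-path T det px′ pt₂′)

  product-path : ∀ {i j u v p q t} (vp : V p) (vq : V q) → Path q₀ (b i) u p → Path q₀ (b j) v q →
    Path q₀ (b (i ∙ j)) (u ++ v) t → product vp vq ≡ t
  product-path vp vq pu pv pt = well-defined (unique (_ , cp) (_ , pu)) (unique (_ , cq) (_ , pv))
    cp cq (proj₂ (composite cp cq)) pu pv pt
    where
    cp = proj₂ (proj₂ (cover vp))
    cq = proj₂ (proj₂ (cover vq))

  op-path : ∀ {i j u v p q t} → Path q₀ (b i) u p → Path q₀ (b j) v q → Path q₀ (b (i ∙ j)) (u ++ v) t → op p q ≡ t
  op-path {p = p} {q} pu pv pt with V? p | V? q
  ... | yes vp | yes vq = product-path vp vq pu pv pt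
  ... | no ¬v | _ = ⊥-elim (¬v (path-vertex (b-vertex _) pu))
  ... | yes _ | no ¬v = ⊥-elim (¬v (path-vertex (b-vertex _) pv))

  op-defined : ∀ {i j u v p q} → Path q₀ (b i) u p → Path q₀ (b j) v q → Path q₀ (b (i ∙ j)) (u ++ v) (op p q)
  op-defined {i} {j} {u} {v} pu pv with composite pu pv
  ... | t , pt = subst (Path q₀ (b (i ∙ j)) (u ++ v)) (sym (op-path pu pv pt)) pt

  closed : Closed V op
  closed p q vp vq with cover vp | cover vq
  ... | i , u , pu | j , v , pv = path-vertex (b-vertex (i ∙ j)) (op-defined pu pv)

  assocᵒ : Assoc V op
  assocᵒ p q s vp vq vs with cover vp | cover vq | cover vs
  ... | i , u , pu | j , v , pv | k , w , pw = op-path (op-defined pu pv) pw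
    (subst₂ (λ m x → Path q₀ (b m) x (op p (op q s))) (sym (assoc i j k)) (sym (++-assoc u v w)) (op-defined pu (op-defined pv pw)))

  monoid : MonoidWith V op (b ε)
  monoid = b-vertex ε , assocᵒ , identity
    where
    identity : ∀ p → V p → op (b ε) p ≡ p × op p (b ε) ≡ p
    identity p vp with cover vp
    ... | i , u , pu = op-path [] pu (subst (λ m → Path q₀ (b m) u p) (sym (idˡ i)) pu)
      , op-path pu [] (subst₂ (λ m x → Path q₀ (b m) x p) (sym (idʳ i)) (sym (++-identityʳ u)) pu)

  -- By `unique`, equal products have equal indices, which cancel in `M`. Beyond the common `w`
  -- there remains an equation between `u` and `v`, which holds at `b i` as well.
  left-cancellative : LeftCancellative V op
  left-cancellative r p q vr vp vq e with cover vr | cover vp | cover vq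
  ... | k , w , pw | i , u , pu | j , v , pv with op-defined pw pu | op-defined pw pv
  ...   | a | c rewrite e with cancelˡ k (unique (_ , a) (_ , c))
  ...     | refl with split-path w a | split-path w c
  ...       | y , a₁ , a₂ | y′ , c₁ , c₂ with det-path T det a₁ c₁
  ...         | refl with same (path-vertex (b-vertex _) a₁) (b-vertex i) u v (_ , a₂ , c₂)
  ...           | z , z₁ , z₂ = trans (det-path T det pu z₁) (det-path T det z₂ pv)

  op-step : ∀ {s l t q} → V s → Step q₀ s l t → Step q₀ (b ε) l q → op s q ≡ t
  op-step {t = t} vs st sq with cover vs
  ... | i , u , pu = op-path pu (sq ∷ []) (subst (λ m → Path q₀ (b m) (u ++ _ ∷ []) t) (sym (idʳ i)) (pu ++ᵖ (st ∷ [])))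

  -- Right multiplication by `q` traces the labels that lead from the identity to `q`; for a
  -- co-simple graph this yields right cancellation.
  op-right : ∀ {p u q} → V p → Path q₀ (b ε) u q → Path q₀ p u (op p q)
  op-right {p} {u} {q} vp pq with cover vp
  ... | i , v , pv with split-path v (op-defined pv pq)
  ...   | y , a , c with det-path T det (subst (λ m → Path q₀ (b m) v y) (idʳ i) a) pv
  ...     | refl = c

  module Inverses (inv : I → I) (inverseˡ : ∀ i → inv i ∙ i ≡ ε) (inverseʳ : ∀ i → i ∙ inv i ≡ ε)
    (back : ∀ {s u t} → Path q₀ s u t → Reach q₀ t s) where

    loop : ∀ {s u i} → V s → Path q₀ s u s → i ≡ ε → Path q₀ (b i) u (b ε)
    loop {u = u} vs p refl with same vs (b-vertex ε) u [] (_ , p , [])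
    ... | _ , p′ , [] = p′

    group : GroupWith V op (b ε)
    group = monoid , inverse
      where
      inverse : ∀ p → V p → ∃ λ q → V q × op p q ≡ b ε × op q p ≡ b ε
      inverse p vp with cover vp
      ... | i , u , pu with back pu
      ...   | ū , pū with copy vp (b-vertex (inv i)) pū
      ...     | q , pq = q , path-vertex (b-vertex (inv i)) pq
        , op-path pu pq (loop (b-vertex i) (pu ++ᵖ pū) (inverseʳ i)) , op-path pq pu (loop vp (pū ++ᵖ pu) (inverseˡ i))

-- Kernels in Cayley graphs of left-cancellative monoids

module RightMultiplications {n : ℕ} {L : Set} (T : System n L) (q₀ : System.State T) (V : Word n → Set)
  (op : Word n → Word n → Word n) (e : Word n) (cl : Closed V op) (mon : MonoidWith V op e) (lc : LeftCancellative V op)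
  (multiplication : ∀ {s l t} → V s → System.Step T q₀ s l t →
    ∃ λ m → V m × t ≡ op s m × (∀ s′ → V s′ → System.Step T q₀ s′ l (op s′ m))) where
  open System T

  path-multiplication : ∀ {s u t} → V s → Path q₀ s u t →
    ∃ λ m → V m × t ≡ op s m × (∀ s′ → V s′ → Path q₀ s′ u (op s′ m))
  path-multiplication {s} vs [] = e , proj₁ mon , sym (proj₂ (proj₂ (proj₂ mon) s vs))
    , λ s′ vs′ → subst (Path q₀ s′ []) (sym (proj₂ (proj₂ (proj₂ mon) s′ vs′))) []
  path-multiplication {s} vs (_∷_ {u = u} st p) with multiplication vs st
  ... | m , vm , refl , ms with path-multiplication (cl s m vs vm) p
  ...   | m′ , vm′ , refl , ps = op m m′ , cl m m′ vm vm′ , proj₁ (proj₂ mon) s m m′ vs vm vm′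
    , λ s′ vs′ → subst (Path q₀ s′ _) (proj₁ (proj₂ mon) s′ m m′ vs′ vm vm′) (ms s′ vs′ ∷ ps (op s′ m) (cl s′ m vs′ vm))

  -- Reading `u` is right multiplication by one element `m` at every vertex. An equation at `s`
  -- gives `m ≡ m′` by left cancellation and so holds everywhere.
  kernels-agree : ∀ {s s′} → V s → V s′ → Ker⊆ T q₀ s s′
  kernels-agree {s} {s′} vs vs′ u v (t , pu , pv) with path-multiplication vs pu | path-multiplication vs pv
  ... | m , vm , em , mp | m′ , vm′ , em′ , mp′ with lc s m m′ vs vm vm′ (trans (sym em) em′)
  ...   | refl = op s′ m , mp s′ vs′ , mp′ s′ vs′

-- Cayley graphs of left-cancellative and of cancellative monoids

module Monoids {n : ℕ} {A : Set} (_≟_ : DecidableEquality A) (P : Presentation n A) (X : Presented P) where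
  open Graph _≟_ P X
  open System S

  private
    V : Word n → Set
    V = Vertex P
    E : Word n → A → Word n → Set
    E = Edge P

  deterministic : SimpleEdges → Deterministic S q₀
  deterministic simple st st′ = proj₁ (simple (from st) (from st′)) refl

  Root : Word n → Set
  Root r = ∀ s → V s → Reach q₀ r s

  opaque
    root? : ∀ r → Dec (Root r)
    root? r with ∃-regular? (×-regular vertex-regular (¬-regular (post-regular S q₀ r)))
    ... | yes (s , vs , ¬c) = no λ h → ¬c (h s vs)
    ... | no h = yes λ s vs → decidable-stable (reach? S q₀ r s) λ ¬c → h (s , vs , ¬c)

  trivial : IndexMonoid
  trivial = record { I = ⊤ ; _∙_ = λ _ _ → tt ; ε = tt ; assoc = λ _ _ _ → refl
                   ; idˡ = λ _ → refl ; idʳ = λ _ → refl ; cancelˡ = λ _ _ → refl }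

  module _ (simple : SimpleEdges) (oc : OutComplete) where

    open Kernels _≟_ S q₀ (deterministic simple)

    -- Only finitely many comparisons; `same-from-root` spreads them to all vertices reachable from
    -- `r`.
    Homogeneous : Word n → Set
    Homogeneous r = ∀ e → e ∈ successors q₀ r → SameKernel r (proj₂ e)

    opaque
      homogeneous? : ∀ r → Dec (Homogeneous r)
      homogeneous? r = ∀∈? (λ e → sameKernel? r (proj₂ e)) (successors q₀ r)

    module Construction {r} (vr : V r) (root : Root r) (hom : Homogeneous r) where

      same-as-root : ∀ {s} → V s → SameKernel r s
      same-as-root vs = same-from-root (λ st → hom _ (successors-complete st)) (proj₂ (root _ vs))

      open PathMonoid S q₀ (deterministic simple) V vertex? (λ st → target (from st))
        (λ vs vs′ u v k → proj₁ (same-as-root vs′) u v (proj₂ (same-as-root vs) u v k)) trivial (λ _ → r) (λ _ → vr)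
        (λ vs → tt , root _ vs) (λ _ _ → refl)

      generated : ∀ {s u t} → V s → Path q₀ s u t → GenMonoid V op (Succ P r) r s → GenMonoid V op (Succ P r) r t
      generated vs [] g = g
      generated vs (st ∷ p) g with oc vr (from st)
      ... | q , eq = generated (target (from st)) p
        (subst (GenMonoid V op (Succ P r) r) (op-step vs st (to eq)) (gen-op g (gen-q (_ , eq))))

      open Realize simple oc vr closed (λ e eq → op-step (source e) (to e) (to eq)) public

      generation : ∀ p → V p → GenMonoid V op (Succ P r) r p
      generation p vp = generated vr (proj₂ (root p vp)) gen-e

      left : Realization P cayley-leftCancMonoid
      left = realization cayley-leftCancMonoid (r , monoid , left-cancellative , generation)

      cancellative : CoSimpleEdges → Realization P cayley-cancMonoid
      cancellative co = realization cayley-cancMonoid (r , monoid , left-cancellative , right , generation)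
        where
        codet : ∀ {u s s′ t} → Path q₀ s u t → Path q₀ s′ u t → s ≡ s′
        codet [] [] = refl
        codet (st ∷ p) (st′ ∷ p′) with codet p p′
        ... | refl = proj₁ (co (from st) (from st′)) refl
        right : RightCancellative V op
        right s p q vs vp vq e with root s vs
        ... | u , ps = codet (op-right vp ps) (subst (Path q₀ q u) (sym e) (op-right vq ps))

    -- The labels of units are those of the edges of v₀ lying on a cycle.
    Reversible : A → Set
    Reversible a = ∃ λ e → e ∈ successors q₀ v₀ × (proj₁ e ≡ a × Reach q₀ (proj₂ e) v₀)

    reversible? : ∀ a → Dec (Reversible a)
    reversible? a = ∃∈? (λ e → (proj₁ e ≟ a) ×-dec reach? S q₀ (proj₂ e) v₀) (successors q₀ v₀)

    private
      label : Word n × A × Word n → A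
      label e = proj₁ (proj₂ e)

      unitEdge? : ∀ e → Dec (Reversible (label e))
      unitEdge? e = reversible? (label e)

      nonUnitEdge? : ∀ e → Dec (¬ Reversible (label e))
      nonUnitEdge? e = ¬? (unitEdge? e)

    unitSystem : System n A
    unitSystem = record { State = State ; finite = finite ; δ = δ ; edges = λ q → filter unitEdge? (edges q) }

    private
      module U = System unitSystem

    unit-step : ∀ {q s a t} → Reversible a → Step q s a t → U.Step q s a t
    unit-step ra (here e) = U.here (∈-filter⁺ unitEdge? e ra)
    unit-step ra (there st) = U.there (unit-step ra st)

    unit-step⁻ : ∀ {q s a t} → U.Step q s a t → Step q s a t × Reversible a
    unit-step⁻ {q} (U.here e) with ∈-filter⁻ unitEdge? {xs = edges q} e
    ... | e′ , ra = here e′ , ra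
    unit-step⁻ (U.there st) with unit-step⁻ st
    ... | st′ , ra = there st′ , ra

    open Predecessors unitSystem (λ q → map (proj₂ ∘ proj₂) (filter nonUnitEdge? (edges q))) [] q₀

    mark : ∀ {s a t} → ¬ Reversible a → Step q₀ s a t → Marked q₀ t
    mark ¬ra st with step-base st
    ... | w , u , v , e , refl , refl = raise-mark w (here (∈-map⁺ _ (∈-filter⁺ nonUnitEdge? e ¬ra)))

    mark⁻ : ∀ {t} → Marked q₀ t → ∃₂ λ s a → ¬ Reversible a × Step q₀ s a t
    mark⁻ m with mark-base m
    ... | w , x , refl , i with ∈-map⁻ _ i
    ...   | (u , a , v) , i′ , refl with ∈-filter⁻ nonUnitEdge? {xs = edges (run q₀ w)} i′
    ...     | e , ¬ra = w ++ u , a , ¬ra , raise w (here e)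

    -- In a Cayley graph the candidates are the units: no product of units has a non-unit factor.
    Candidate : Word n → Set
    Candidate s = V s × ¬ Pre s

    opaque
      candidate? : Dec (∃ Candidate)
      candidate? = ∃-regular? (×-regular vertex-regular (¬-regular pre-regular))

    module Necessary {op Q lab e} (cl : Closed V op) (Q⊆V : ∀ q → Q q → V q) (cay : IsCayleyGraphOf P op Q lab)
      (mon : MonoidWith V op e) (lc : LeftCancellative V op) (gen : ∀ p → V p → GenMonoid V op Q e p) where

      private
        ve : V e
        ve = proj₁ mon
        idl : ∀ {p} → V p → op e p ≡ p
        idl vp = proj₁ (proj₂ (proj₂ mon) _ vp)
        idr : ∀ {p} → V p → op p e ≡ p
        idr vp = proj₂ (proj₂ (proj₂ mon) _ vp)
        ass : Assoc V op
        ass = proj₁ (proj₂ mon)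

      edge-multiplication : ∀ {s l t} → V s → Step q₀ s l t →
        ∃ λ m → V m × t ≡ op s m × (∀ s′ → V s′ → Step q₀ s′ l (op s′ m))
      edge-multiplication {s} {l} {t} vs st with proj₁ (cay s l t) (from st)
      ... | _ , q , Qq , el , et = q , Q⊆V q Qq , et , λ s′ vs′ → to (proj₂ (cay s′ l (op s′ q)) (vs′ , q , Qq , el , refl))

      open RightMultiplications S q₀ V op e cl mon lc edge-multiplication

      gen-vertex : ∀ {p} → GenMonoid V op Q e p → V p
      gen-vertex gen-e = ve
      gen-vertex (gen-q Qq) = Q⊆V _ Qq
      gen-vertex (gen-op g g′) = cl _ _ (gen-vertex g) (gen-vertex g′)

      path-to : ∀ {p} → GenMonoid V op Q e p → ∀ {s} → V s → Reach q₀ s (op s p)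
      path-to gen-e {s} vs = [] , subst (Path q₀ s []) (sym (idr vs)) []
      path-to (gen-q {q} Qq) {s} vs = _ , to (proj₂ (cay s _ (op s q)) (vs , q , Qq , refl , refl)) ∷ []
      path-to (gen-op {p} {q} g g′) {s} vs = reach-trans (path-to g vs)
        (subst (Reach q₀ (op s p)) (ass s p q vs (gen-vertex g) (gen-vertex g′)) (path-to g′ (cl s p vs (gen-vertex g))))

      Unit : Word n → Set
      Unit p = V p × ∃ λ x → V x × op p x ≡ e × op x p ≡ e

      -- Left cancellation in `p · (x · p) = p · e` makes a right inverse two-sided.
      unit : ∀ {p x} → V p → V x → op p x ≡ e → Unit p
      unit {p} {x} vp vx ex = vp , x , vx , ex , lc p (op x p) e vp (cl x p vx vp) ve
        (trans (sym (ass p x p vp vx vp)) (trans (cong (λ z → op z p) ex) (trans (idl vp) (sym (idr vp)))))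

      -- From `(p · q) · y = e`: `q · y` is a right inverse of `p`, hence its inverse, and then
      -- `y · p` is a right inverse of `q`.
      unit-factors : ∀ {p q} → V p → V q → Unit (op p q) → Unit p × Unit q
      unit-factors {p} {q} vp vq (_ , y , vy , ey , _) = up , unit vq (cl y p vy vp)
          (trans (sym (ass q y p vq vy vp)) (trans (cong (λ z → op z p) qy) ep′))
        where
        pqy : op p (op q y) ≡ e
        pqy = trans (sym (ass p q y vp vq vy)) ey
        up : Unit p
        up = unit vp (cl q y vq vy) pqy
        p′ : Word n
        p′ = proj₁ (proj₂ up)
        ep′ : op p′ p ≡ e
        ep′ = proj₂ (proj₂ (proj₂ (proj₂ up)))
        qy : op q y ≡ p′
        qy = lc p (op q y) p′ vp (cl q y vq vy) (proj₁ (proj₂ (proj₂ up))) (trans pqy (sym (proj₁ (proj₂ (proj₂ (proj₂ up))))))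

      unit-product : ∀ {p q} → Unit p → Unit q → Unit (op p q)
      unit-product {p} {q} (vp , x , vx , px , _) (vq , y , vy , qy , _) = unit (cl p q vp vq) (cl y x vy vx)
        (trans (ass p q (op y x) vp vq (cl y x vy vx)) (trans (cong (op p)
          (trans (sym (ass q y x vq vy vx)) (trans (cong (λ z → op z x) qy) (idl vx)))) px))

      -- The way back from `v₀ · q` to `v₀` is right multiplication by some `y`, and
      -- `v₀ · (q · y) = v₀` cancels to `q · y = e`. So a test at `v₀` alone recognises the unit
      -- generators.
      reversible-unit : ∀ {s a q} → V q → Reversible a → Step q₀ s a (op s q) → V s → Unit q
      reversible-unit {s} {q = q} vq ((a , t) , m , refl , c) st vs with edge-multiplication vs st
      ... | q′ , vq′ , eq , sts with lc s q q′ vs vq vq′ eq | proj₁ (simple (successor⁻ m) (from (sts v₀ v₀-vertex))) refl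
      ...   | refl | refl with path-multiplication (cl v₀ q v₀-vertex vq) (proj₂ c)
      ...     | y , vy , ey , _ = unit vq vy (lc v₀ (op q y) e v₀-vertex (cl q y vq vy) ve
                  (trans (sym (ass v₀ q y v₀-vertex vq vy)) (trans (sym ey) (sym (idr v₀-vertex)))))

      unit-reversible : ∀ {s a q} → V s → Unit q → Step q₀ s a (op s q) → Reversible a
      unit-reversible {s} {a} {q} vs (vq , x , vx , qx , _) st with edge-multiplication vs st
      ... | q′ , vq′ , eq , sts with lc s q q′ vs vq vq′ eq
      ...   | refl = (a , op v₀ q) , successor (from (sts v₀ v₀-vertex)) , refl
        , subst (Reach q₀ (op v₀ q)) (trans (ass v₀ q x v₀-vertex vq vx) (trans (cong (op v₀) qx) (idr v₀-vertex)))
            (path-to (gen x vx) (cl v₀ q v₀-vertex vq))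

      unit-path : ∀ {p} → GenMonoid V op Q e p → Unit p → ∀ {s} → V s → U.Reach q₀ s (op s p)
      unit-path gen-e _ {s} vs = [] , subst (U.Path q₀ s []) (sym (idr vs)) U.[]
      unit-path (gen-q {q} Qq) uq {s} vs = _ , unit-step (unit-reversible vs uq st) st U.∷ U.[]
        where
        st : Step q₀ s (lab q) (op s q)
        st = to (proj₂ (cay s _ (op s q)) (vs , q , Qq , refl , refl))
      unit-path (gen-op {p} {q} g g′) u {s} vs with unit-factors (gen-vertex g) (gen-vertex g′) u
      ... | up , uq = U.reach-trans (unit-path g up vs)
        (subst (U.Reach q₀ (op s p)) (ass s p q vs (gen-vertex g) (gen-vertex g′)) (unit-path g′ uq (cl s p vs (gen-vertex g))))

      units-closed : ∀ {s u t} → Unit s → U.Path q₀ s u t → Unit t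
      units-closed us U.[] = us
      units-closed us (st U.∷ p) with unit-step⁻ st
      ... | st′ , ra with edge-multiplication (proj₁ us) st′
      ...   | q , vq , refl , _ = units-closed (unit-product us (reversible-unit vq ra st′ (proj₁ us))) p

      identity-candidate : Candidate e
      identity-candidate = ve , λ { (t , (_ , p) , inj₁ m) → absurd (units-closed (unit ve ve (idl ve)) p) m ; (_ , _ , inj₂ ()) }
        where
        absurd : ∀ {t} → Unit t → ¬ Marked q₀ t
        absurd ut m with mark⁻ m
        ... | s , a , ¬ra , st with edge-multiplication (source (from st)) st
        ...   | q , vq , refl , _ = ¬ra (unit-reversible (source (from st))
                    (proj₂ (unit-factors (source (from st)) vq ut)) st)

      -- Backwards from `r`: the target of a non-unit edge is marked and so lies in `Pre`, hence
      -- each edge of the path is a unit edge. It can be undone by unit edges, so avoidance of `Pre`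
      -- passes to its source.
      candidate-path : ∀ {s u r} → V s → Path q₀ s u r → ¬ Pre r → ¬ Pre s × ∃ λ m → Unit m × r ≡ op s m
      candidate-path vs [] ¬p = ¬p , e , unit ve ve (idl ve) , sym (idr vs)
      candidate-path {s} vs (st ∷ p) ¬p with edge-multiplication vs st
      ... | q , vq , refl , _ with candidate-path (cl s q vs vq) p ¬p
      ...   | ¬p₁ , m , um , er with decidable-stable (reversible? _) (λ ¬ra → ¬p₁ (_ , (_ , U.[]) , inj₁ (mark ¬ra st)))
      ...     | ra with reversible-unit vq ra st vs
      ...       | uq@(_ , x , vx , qx , xq) = (λ { (t , c , g) → ¬p₁ (t , U.reach-trans back c , g) })
          , op q m , unit-product uq um , trans er (ass s q m vs vq (proj₁ um))
        where
        back : U.Reach q₀ (op s q) s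
        back = subst (U.Reach q₀ (op s q)) (trans (ass s q x vs vq vx) (trans (cong (op s) qx) (idr vs)))
          (unit-path (gen x vx) (unit vx vq xq) (cl s q vs vq))

      candidate-root : ∀ {r} → Candidate r → Root r × Homogeneous r
      candidate-root {r} (vr , ¬p) with path-to (gen r vr) ve
      ... | u , p with candidate-path ve (subst (Path q₀ e u) (idl vr) p) ¬p
      ...   | _ , m , (vm , x , vx , mx , _) , er = root , λ { (a , t) i → let vt = target (successor⁻ {s = r} i) in
                kernels-agree vr vt , kernels-agree vt vr }
        where
        r≡m : r ≡ m
        r≡m = trans er (idl vm)
        root : Root r
        root s vs = subst (Reach q₀ r) (trans (sym (ass r x s vr vx vs)) (trans (cong (λ z → op z s) (trans (cong (λ z → op z x) r≡m) mx)) (idl vs)))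
          (path-to (gen (op x s) (cl x s vx vs)) vr)

    Admissible : Set
    Admissible = ∃ λ r → V r × Root r × Homogeneous r

    search : Admissible ⊎ (∀ {op Q lab e} → Closed V op → (∀ q → Q q → V q) → IsCayleyGraphOf P op Q lab →
      MonoidWith V op e → LeftCancellative V op → (∀ p → V p → GenMonoid V op Q e p) → ⊥)
    search with candidate?
    ... | no ¬c = inj₂ λ cl Q⊆V cay mon lc gen → ¬c (_ , Necessary.identity-candidate cl Q⊆V cay mon lc gen)
    -- A single candidate decides: in a Cayley graph it is a unit and therefore a homogeneous root,
    -- so its failure refutes all structures at once.
    ... | yes (r , vr , ¬p) with root? r | homogeneous? r
    ...   | yes root | yes hom = inj₁ (r , vr , root , hom)
    ...   | no ¬root | _ = inj₂ λ cl Q⊆V cay mon lc gen → ¬root (proj₁ (Necessary.candidate-root cl Q⊆V cay mon lc gen (vr , ¬p)))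
    ...   | yes _ | no ¬hom = inj₂ λ cl Q⊆V cay mon lc gen → ¬hom (proj₂ (Necessary.candidate-root cl Q⊆V cay mon lc gen (vr , ¬p)))

  decide-left : Realization P cayley-leftCancMonoid ⊎ ¬ IsKind P cayley-leftCancMonoid
  decide-left with simpleEdges? | outComplete?
  ... | no ¬simple | _ = inj₂ λ { (op , Q , lab , cl , Q⊆V , inj , cay , e , mon , lc , gen) → ¬simple (cayley-simple Q⊆V inj cay lc) }
  ... | yes _ | no ¬oc = inj₂ λ { (op , Q , lab , cl , Q⊆V , inj , cay , e , mon , lc , gen) → ¬oc (cayley-outComplete Q⊆V inj cay) }
  ... | yes simple | yes oc with search simple oc
  ...   | inj₁ (r , vr , root , hom) = inj₁ (Construction.left simple oc vr root hom)
  ...   | inj₂ impossible = inj₂ λ { (op , Q , lab , cl , Q⊆V , inj , cay , e , mon , lc , gen) → impossible cl Q⊆V cay mon lc gen }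

  -- Co-simplicity is the only additional test: it is necessary, and it makes the operation of the
  -- left-cancellative case right-cancellative.
  decide-cancellative : Realization P cayley-cancMonoid ⊎ ¬ IsKind P cayley-cancMonoid
  decide-cancellative with simpleEdges? | outComplete? | coSimpleEdges?
  ... | no ¬simple | _ | _ = inj₂ λ { (op , Q , lab , cl , Q⊆V , inj , cay , e , mon , lc , rc , gen) → ¬simple (cayley-simple Q⊆V inj cay lc) }
  ... | yes _ | no ¬oc | _ = inj₂ λ { (op , Q , lab , cl , Q⊆V , inj , cay , e , mon , lc , rc , gen) → ¬oc (cayley-outComplete Q⊆V inj cay) }
  ... | yes simple | yes _ | no ¬co = inj₂ λ { (op , Q , lab , cl , Q⊆V , inj , cay , e , mon , lc , rc , gen) →
    ¬co (cayley-cosimple Q⊆V inj cay simple rc) }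
  ... | yes simple | yes oc | yes co with search simple oc
  ...   | inj₁ (r , vr , root , hom) = inj₁ (Construction.cancellative simple oc vr root hom co)
  ...   | inj₂ impossible = inj₂ λ { (op , Q , lab , cl , Q⊆V , inj , cay , e , mon , lc , rc , gen) → impossible cl Q⊆V cay mon lc gen }

-- Components of symmetric systems

all-or-bad : ∀ {X B : Set} {P : X → Set} (xs : List X) → (∀ x → x ∈ xs → P x ⊎ B) → (∀ x → x ∈ xs → P x) ⊎ B
all-or-bad [] h = inj₁ λ _ ()
all-or-bad (x ∷ xs) h with h x (here refl) | all-or-bad xs (λ y m → h y (there m))
... | inj₂ b | _ = inj₂ b
... | inj₁ _ | inj₂ b = inj₂ b
... | inj₁ p | inj₁ ps = inj₁ λ { _ (here refl) → p ; y (there m) → ps y m }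

module Components {n : ℕ} {L : Set} (_≟ˡ_ : DecidableEquality L) (T : System n L) (symm : Symmetric T)
  (q₀ : System.State T) where
  open System T
  open Symmetry T symm

  private
    K : ℕ
    K = proj₁ bound

  Moves : Word n → Set
  Moves s = ∃₂ λ l t → Step q₀ s l t

  -- w z is an end of an edge whose rewriting takes place above a proper prefix of w.
  Low : Word n → Word n → Set
  Low z w = ∃₂ λ w₁ w₂ → w ≡ w₁ ++ w₂ × w₂ ≢ [] × ∃ λ e → e ∈ edges (run q₀ w₁) × proj₁ e ≡ w₂ ++ z

  private
    source? : ∀ (x : Word n) q → Dec (∃ λ e → e ∈ edges q × proj₁ e ≡ x)
    source? x q = ∃∈? (λ e → proj₁ e ≟ʷ x) (edges q)

    lowMark? : ∀ z q w₂ → Dec (w₂ ≢ [] × ∃ λ e → e ∈ edges q × proj₁ e ≡ w₂ ++ z)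
    lowMark? z q w₂ = ¬? (w₂ ≟ʷ []) ×-dec source? (w₂ ++ z) q

  opaque
    low-regular : ∀ z → Regular (Low z)
    low-regular z = map-regular
      (λ { w (w₁ , w₂ , e , m) → w₁ , w₂ , e , proj₂ (∈-filter⁻ (lowMark? z (run q₀ w₁)) {xs = words≤ K} m) })
      (λ { w (w₁ , w₂ , refl , ne , ed , m , e) → w₁ , w₂ , refl , ∈-filter⁺ (lowMark? z (run q₀ w₁))
           (∈-words≤ K w₂ (≤-trans (subst (length w₂ ≤_) (trans (sym (length-++ w₂)) (cong length (sym e))) (m≤m+n _ _)) (proj₁ (proj₂ bound _ m))))
           (ne , ed , m , e) })
      (Marking.marked-regular T (λ q → filter (lowMark? z q) (words≤ K)) q₀)

  -- No edge leaves the copy above w of the component of x in the cone of q.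
  Isolated : State → Word n → Word n → Set
  Isolated q x w = run q₀ w ≡ q × (∀ z → z ∈ words≤ K → ¬ (Reach q x z × Low z w))

  opaque
    isolated-regular : ∀ q x → Regular (Isolated q x)
    isolated-regular q x = ×-regular
      (record { State = State ; finite = finite ; δ = δ ; init = q₀ ; Final = _≡ q ; final? = λ q′ → Finite._≟_ finite q′ q
              ; sound = λ _ e → e ; complete = λ _ e → e })
      (⋂-regular (λ z → ¬-regular (×-regular (constant-regular (reach? T q x z)) (low-regular z))) (words≤ K))

  climb : ∀ w {q z l t} → Step q (w ++ z) l t →
    (∃ λ y → t ≡ w ++ y × Step (run q w) z l y) ⊎
    (∃₂ λ w₁ w₂ → w ≡ w₁ ++ w₂ × w₂ ≢ [] × ∃ λ e → e ∈ edges (run q w₁) × proj₁ e ≡ w₂ ++ z)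
  climb [] st = inj₁ (_ , refl , st)
  climb (b ∷ w) (here e) = inj₂ ([] , b ∷ w , refl , (λ ()) , _ , e , refl)
  climb (b ∷ w) (there st) with climb w st
  ... | inj₁ (y , refl , st′) = inj₁ (y , refl , st′)
  ... | inj₂ (w₁ , w₂ , refl , rest) = inj₂ (b ∷ w₁ , w₂ , refl , rest)

  low-length : ∀ {z w} → Low z w → length z ≤ K
  low-length {z} (_ , w₂ , _ , _ , _ , m , e) =
    ≤-trans (subst (length z ≤_) (trans (sym (length-++ w₂)) (cong length (sym e))) (m≤n+m _ (length w₂))) (proj₁ (proj₂ bound _ m))

  isolated-path : ∀ {q x w} → Isolated q x w → ∀ {z u t} → Reach q x z → Path q₀ (w ++ z) u t →
    ∃ λ y → t ≡ w ++ y × Path q z u y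
  isolated-path I c [] = _ , refl , []
  isolated-path {w = w} I@(refl , iso) {z} c (st ∷ p) with climb w st
  ... | inj₂ low = ⊥-elim (iso z (∈-words≤ K z (low-length low)) (c , low))
  ... | inj₁ (y , refl , st′) with isolated-path I (reach-trans c (_ , st′ ∷ [])) p
  ...   | y′ , e , p′ = y′ , e , st′ ∷ p′

  isolated-kernel : ∀ {q x w w′} → Isolated q x w → Isolated q x w′ → Ker⊆ T q₀ (w ++ x) (w′ ++ x)
  isolated-kernel {w = w} {w′} I (refl , _) u v (t , p , p′) with isolated-path I (_ , []) p | isolated-path I (_ , []) p′
  ... | y , refl , a | y′ , e , a′ with ++-cancelˡ w y y′ e
  ...   | refl = w′ ++ y , raise-path w′ a , raise-path w′ a′

  Origin : Word n → Set
  Origin s = ∃₂ λ w e → e ∈ edges (run q₀ w) × Isolated (run q₀ w) (proj₁ e) w × Reach q₀ (w ++ proj₁ e) s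

  -- If an edge leaves the component above `w`, it is based at a proper prefix `w₁` of `w` and its
  -- left side is connected to the present vertex; the search restarts there.
  origin-from : ∀ fuel w {e s} → length w < fuel → e ∈ edges (run q₀ w) → Reach q₀ (w ++ proj₁ e) s → Origin s
  origin-from (suc fuel) w {e} {s} (s≤s h) m c
    with ∃∈? (λ z → reach? T (run q₀ w) (proj₁ e) z ×-dec Regular.member? (low-regular z) w) (words≤ K)
  ... | no none = w , e , m , (refl , λ z i p → none (z , i , p)) , c
  ... | yes (z , _ , c′ , w₁ , w₂ , refl , ne , e₁ , m₁ , eq) =
    origin-from fuel w₁ (≤-trans (shorter w₁ w₂ ne) h) m₁
      (reach-trans (subst (λ t → Reach q₀ t ((w₁ ++ w₂) ++ proj₁ e)) (trans (++-assoc w₁ w₂ z) (cong (w₁ ++_) (sym eq)))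
        (raise-reach (w₁ ++ w₂) (reach-sym c′))) c)
    where
    shorter : ∀ (w₁ w₂ : Word n) → w₂ ≢ [] → length w₁ < length (w₁ ++ w₂)
    shorter [] [] ne = ⊥-elim (ne refl)
    shorter [] (b ∷ w₂) ne = s≤s z≤n
    shorter (b ∷ w₁) w₂ ne = s≤s (shorter w₁ w₂ ne)

  origin : ∀ {s} → Moves s → Origin s
  origin (l , t , st) with step-base st
  ... | w , u , v , m , refl , refl = origin-from (suc (length w)) w ≤-refl m (_ , [])

  origin-moves : ∀ {w e} → e ∈ edges (run q₀ w) → Moves (w ++ proj₁ e)
  origin-moves {w} m = _ , _ , raise w (here m)

  FinitelyMany Unbounded : Set
  FinitelyMany = ∃ λ ts → (∀ {t} → t ∈ ts → Moves t) × (∀ {s} → Moves s → ∃ λ t → t ∈ ts × Reach q₀ t s)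
  Unbounded = ∀ m → ∃ λ s → Moves s × (∀ {t} → Reach q₀ s t → m ≤ length t)

  opaque
    -- Each component has an isolated origin of one of finitely many types, a state with an edge. If
    -- every type occurs only above bounded prefixes, finitely many origins represent all
    -- components; otherwise some type has occurrences lying entirely above arbitrarily long
    -- prefixes.
    finitely-many-or-unbounded : FinitelyMany ⊎ Unbounded
    finitely-many-or-unbounded = combine (all-or-bad (Finite.elements finite) λ q _ → all-or-bad (edges q) (perEdge q))
      where
      Bounded′ : State → Word n × L × Word n → Set
      Bounded′ q e = ∃ λ m → ∀ w → Isolated q (proj₁ e) w → length w < m
      perEdge : ∀ q e → e ∈ edges q → Bounded′ q e ⊎ Unbounded
      perEdge q e i with bounded-or-unbounded (isolated-regular q (proj₁ e))
      ... | inj₁ b = inj₁ b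
      ... | inj₂ unb = inj₂ λ m → high m (unb m)
        where
        high : ∀ m → (∃ λ w → Isolated q (proj₁ e) w × m ≤ length w) →
          ∃ λ s → Moves s × (∀ {t} → Reach q₀ s t → m ≤ length t)
        high m (w , I@(refl , _) , h) = w ++ proj₁ e , origin-moves i , above
          where
          above : ∀ {t} → Reach q₀ (w ++ proj₁ e) t → m ≤ length t
          above (u , p) with isolated-path I (_ , []) p
          ... | y , refl , _ = ≤-trans h (subst (length w ≤_) (sym (length-++ w)) (m≤m+n _ _))
      combine : (∀ q → q ∈ Finite.elements finite → ∀ e → e ∈ edges q → Bounded′ q e) ⊎ Unbounded → FinitelyMany ⊎ Unbounded
      combine (inj₂ u) = inj₂ u
      combine (inj₁ b) = inj₁ (concatMap ends prefixes
        , (λ i → ends-move (find (∈-concatMap⁻ ends {xs = prefixes} i))) , covered)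
        where
        perState : ∀ q → ∃ λ m → ∀ e → e ∈ edges q → ∀ w → Isolated q (proj₁ e) w → length w < m
        perState q = gather (edges q) (b q (Finite.member finite q))
          where
          gather : ∀ es → (∀ e → e ∈ es → Bounded′ q e) → ∃ λ m → ∀ e → e ∈ es → ∀ w → Isolated q (proj₁ e) w → length w < m
          gather [] h = 0 , λ _ ()
          gather (e ∷ es) h with h e (here refl) | gather es (λ e′ i → h e′ (there i))
          ... | m , hm | m′ , hm′ = m ⊔ m′ , λ { _ (here refl) w I → <-≤-trans (hm w I) (m≤m⊔n _ _)
                                               ; e′ (there i) w I → <-≤-trans (hm′ e′ i w I) (m≤n⊔m m _) }
        M : ∃ λ m → ∀ {q} → q ∈ Finite.elements finite → proj₁ (perState q) ≤ m
        M = maximum (proj₁ ∘ perState) (Finite.elements finite)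
        prefixes : List (Word n)
        prefixes = words≤ (proj₁ M)
        ends : Word n → List (Word n)
        ends w = map (λ e → w ++ proj₁ e) (edges (run q₀ w))
        ends-move : ∀ {t} → (∃ λ w → w ∈ prefixes × t ∈ ends w) → Moves t
        ends-move (w , _ , i) with ∈-map⁻ _ i
        ... | e , m , refl = origin-moves m
        covered : ∀ {s} → Moves s → ∃ λ t → t ∈ concatMap ends prefixes × Reach q₀ t s
        covered mv with origin mv
        ... | w , e , m , I , c = w ++ proj₁ e
          , ∈-concatMap⁺ ends (lose (∈-words≤ _ w (≤-trans (<⇒≤ (proj₂ (perState _) e m w I)) (proj₂ M (Finite.member finite _))))
              (∈-map⁺ _ m)) , c

  module _ (det : Deterministic T q₀) where
    open Kernels _≟ˡ_ T q₀ det

    KernelsAgree : Set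
    KernelsAgree = ∀ {s s′} → Moves s → Moves s′ → Ker⊆ T q₀ s s′

    -- Up to translation there are only finitely many isolated components, so finitely many comparisons suffice.
    kernelsAgree? : ∀ {r} → Moves r → Dec KernelsAgree
    kernelsAgree? {r} mr = combine (all-or-bad (successors q₀ r) step-check)
      (all-or-bad (Finite.elements finite) λ q _ → all-or-bad (edges q) (type-check q))
      where
      Differ : Set
      Differ = ∃ λ t → Moves t × ¬ SameKernel r t
      refute : Differ → ¬ KernelsAgree
      refute (t , mt , ¬same) agree = ¬same (agree mr mt , agree mt mr)
      step-check : ∀ e → e ∈ successors q₀ r → SameKernel r (proj₂ e) ⊎ Differ
      step-check (l , t) i with sameKernel? r t
      ... | yes s = inj₁ s
      ... | no ¬s = inj₂ (t , (_ , _ , proj₂ (step-sym (successors-sound r i))) , ¬s)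
      Good : State → Word n × L × Word n → Set
      Good q e = ¬ (∃ λ w → Isolated q (proj₁ e) w) ⊎ (∃ λ w → Isolated q (proj₁ e) w × SameKernel r (w ++ proj₁ e))
      type-check : ∀ q e → e ∈ edges q → Good q e ⊎ Differ
      type-check q e i with ∃-regular? (isolated-regular q (proj₁ e))
      ... | no none = inj₁ (inj₁ none)
      ... | yes (w , I@(refl , _)) with sameKernel? r (w ++ proj₁ e)
      ...   | yes s = inj₁ (inj₂ (w , I , s))
      ...   | no ¬s = inj₂ (_ , origin-moves i , ¬s)
      combine : (∀ e → e ∈ successors q₀ r → SameKernel r (proj₂ e)) ⊎ Differ →
        (∀ q → q ∈ Finite.elements finite → ∀ e → e ∈ edges q → Good q e) ⊎ Differ → Dec KernelsAgree
      combine (inj₂ d) _ = no (refute d)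
      combine (inj₁ _) (inj₂ d) = no (refute d)
      combine (inj₁ steps) (inj₁ good) = yes λ ms ms′ → λ u v k → proj₁ (same ms′) u v (proj₂ (same ms) u v k)
        where
        same : ∀ {s} → Moves s → SameKernel r s
        same ms with origin ms
        ... | w , e , m , I , c with good _ (Finite.member finite _) e m
        ...   | inj₁ none = ⊥-elim (none (w , I))
        ...   | inj₂ (w′ , I′ , s) = same-from (λ st → steps _ (successors-complete st))
                  (sameKernel-trans s (isolated-kernel I′ I , isolated-kernel I I′)) (proj₂ c)

-- Index groups

record IndexGroup : Set₁ where
  field
    I        : Set
    _∙_      : I → I → I
    ε        : I
    inv      : I → I
    assoc    : ∀ i j k → (i ∙ j) ∙ k ≡ i ∙ (j ∙ k)
    idˡ      : ∀ i → ε ∙ i ≡ i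
    idʳ      : ∀ i → i ∙ ε ≡ i
    inverseˡ : ∀ i → inv i ∙ i ≡ ε
    inverseʳ : ∀ i → i ∙ inv i ≡ ε

  indexMonoid : IndexMonoid
  indexMonoid = record { I = I ; _∙_ = _∙_ ; ε = ε ; assoc = assoc ; idˡ = idˡ ; idʳ = idʳ ; cancelˡ = cancel }
    where
    undo : ∀ k i → inv k ∙ (k ∙ i) ≡ i
    undo k i = trans (sym (assoc (inv k) k i)) (trans (cong (_∙ i) (inverseˡ k)) (idˡ i))
    cancel : ∀ k {i j} → k ∙ i ≡ k ∙ j → i ≡ j
    cancel k {i} {j} e = trans (sym (undo k i)) (trans (cong (inv k ∙_) e) (undo k j))

integers : IndexGroup
integers = record { I = ℤ.ℤ ; _∙_ = ℤ._+_ ; ε = ℤ.0ℤ ; inv = ℤ.-_ ; assoc = ℤ.+-assoc ; idˡ = ℤ.+-identityˡ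
                  ; idʳ = ℤ.+-identityʳ ; inverseˡ = ℤ.+-inverseˡ ; inverseʳ = ℤ.+-inverseʳ }

module Cyclic (m : ℕ) where
  private
    k : ℕ
    k = suc m

  residue : ℕ → Fin k
  residue x = fromℕ< (m%n<n x k)

  toℕ-residue : ∀ x → toℕ (residue x) ≡ x % k
  toℕ-residue x = toℕ-fromℕ< (m%n<n x k)

  residue-toℕ : ∀ (i : Fin k) → toℕ i % k ≡ toℕ i
  residue-toℕ i = m<n⇒m%n≡m (toℕ<n i)

  _⊕_ : Fin k → Fin k → Fin k
  i ⊕ j = residue (toℕ i + toℕ j)

  %-absorbˡ : ∀ x y → (x % k + y) % k ≡ (x + y) % k
  %-absorbˡ x y = trans (%-distribˡ-+ (x % k) y k) (trans (cong (λ z → (z + y % k) % k) (m%n%n≡m%n x k)) (sym (%-distribˡ-+ x y k)))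

  ⊕-comm : ∀ i j → i ⊕ j ≡ j ⊕ i
  ⊕-comm i j = cong residue (+-comm (toℕ i) (toℕ j))

  ⊕-value : ∀ i j l → toℕ ((i ⊕ j) ⊕ l) ≡ (toℕ i + toℕ j + toℕ l) % k
  ⊕-value i j l = trans (toℕ-residue (toℕ (i ⊕ j) + toℕ l)) (trans (cong (λ z → (z + toℕ l) % k) (toℕ-residue (toℕ i + toℕ j))) (%-absorbˡ (toℕ i + toℕ j) (toℕ l)))

  ⊕-assoc : ∀ i j l → (i ⊕ j) ⊕ l ≡ i ⊕ (j ⊕ l)
  ⊕-assoc i j l = toℕ-injective (trans (⊕-value i j l) (trans (cong (_% k) (trans (+-assoc (toℕ i) (toℕ j) (toℕ l)) (+-comm (toℕ i) _)))
    (sym (trans (cong toℕ (⊕-comm i (j ⊕ l))) (⊕-value j l i)))))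

  ⊕-idˡ : ∀ i → zero ⊕ i ≡ i
  ⊕-idˡ i = toℕ-injective (trans (toℕ-residue (toℕ i)) (residue-toℕ i))

  negate : Fin k → Fin k
  negate i = residue (k ∸ toℕ i)

  ⊕-inverseʳ : ∀ i → i ⊕ negate i ≡ zero
  ⊕-inverseʳ i = toℕ-injective (trans (cong toℕ (⊕-comm i (negate i))) (trans (toℕ-residue (toℕ (negate i) + toℕ i))
    (trans (cong (λ z → (z + toℕ i) % k) (toℕ-residue (k ∸ toℕ i))) (trans (%-absorbˡ (k ∸ toℕ i) (toℕ i))
      (trans (cong (_% k) (m∸n+n≡m (<⇒≤ (toℕ<n i)))) (n%n≡0 k))))))

  cyclic : IndexGroup
  cyclic = record { I = Fin k ; _∙_ = _⊕_ ; ε = zero ; inv = negate ; assoc = ⊕-assoc ; idˡ = ⊕-idˡ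
                  ; idʳ = λ i → trans (⊕-comm i zero) (⊕-idˡ i) ; inverseˡ = λ i → trans (⊕-comm (negate i) i) (⊕-inverseʳ i)
                  ; inverseʳ = ⊕-inverseʳ }

-- 0, 1, 2, 3, … correspond to 0, −1, 1, −2, …
fromNonNeg fromNeg : ℕ → ℕ
fromNonNeg zero = 0
fromNonNeg (suc i) = suc (fromNeg i)
fromNeg i = suc (fromNonNeg i)

fromℤ : ℤ.ℤ → ℕ
fromℤ (ℤ.+ i) = fromNonNeg i
fromℤ (ℤ.-[1+ i ]) = fromNeg i

toℤ : ℕ → ℤ.ℤ
toℤ zero = ℤ.+ 0
toℤ (suc m) with toℤ m
... | ℤ.+ i = ℤ.-[1+ i ]
... | ℤ.-[1+ i ] = ℤ.+ suc i

toℤ-fromNonNeg : ∀ i → toℤ (fromNonNeg i) ≡ ℤ.+ i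
toℤ-fromNonNeg zero = refl
toℤ-fromNonNeg (suc i) rewrite toℤ-fromNonNeg i = refl

toℤ-fromℤ : ∀ z → toℤ (fromℤ z) ≡ z
toℤ-fromℤ (ℤ.+ i) = toℤ-fromNonNeg i
toℤ-fromℤ (ℤ.-[1+ i ]) rewrite toℤ-fromNonNeg i = refl

fromℤ-toℤ : ∀ m → fromℤ (toℤ m) ≡ m
fromℤ-toℤ zero = refl
fromℤ-toℤ (suc m) with toℤ m | fromℤ-toℤ m
... | ℤ.+ i | e = cong suc e
... | ℤ.-[1+ i ] | e = cong suc e

-- Choosing one vertex in every component

nth : ∀ {X : Set} → List X → ℕ → Maybe X
nth [] i = nothing
nth (x ∷ xs) zero = just x
nth (x ∷ xs) (suc i) = nth xs i

nth-++ : ∀ {X : Set} (xs ys : List X) i {x} → nth xs i ≡ just x → nth (xs ++ ys) i ≡ just x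
nth-++ (x ∷ xs) ys zero e = e
nth-++ (x ∷ xs) ys (suc i) e = nth-++ xs ys i e

nth-∈ : ∀ {X : Set} (xs : List X) i {x} → nth xs i ≡ just x → x ∈ xs
nth-∈ (x ∷ xs) zero refl = here refl
nth-∈ (x ∷ xs) (suc i) e = there (nth-∈ xs i e)

∈-nth : ∀ {X : Set} {xs : List X} {x} → x ∈ xs → ∃ λ i → i < length xs × nth xs i ≡ just x
∈-nth (here refl) = 0 , s≤s z≤n , refl
∈-nth (there m) = let i , h , e = ∈-nth m in suc i , s≤s h , e

nth-< : ∀ {X : Set} (xs : List X) {i} → i < length xs → ∃ λ x → nth xs i ≡ just x
nth-< (x ∷ xs) {zero} h = x , refl
nth-< (x ∷ xs) {suc i} (s≤s h) = nth-< xs h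

longer-++ : ∀ {X : Set} (L M : List X) {x} → x ∈ L ++ M → x ∉ L → length L < length (L ++ M)
longer-++ [] (y ∷ M) m ¬m = s≤s z≤n
longer-++ (y ∷ L) M (here e) ¬m = ⊥-elim (¬m (here e))
longer-++ (y ∷ L) M (there m) ¬m = s≤s (longer-++ L M m (¬m ∘ there))

module Representatives {n : ℕ} (V : Word n → Set) (V? : ∀ s → Dec (V s)) (_~_ : Word n → Word n → Set)
  (_~?_ : ∀ s t → Dec (s ~ t)) (~-refl : ∀ {s} → s ~ s) (~-sym : ∀ {s t} → s ~ t → t ~ s)
  (~-trans : ∀ {s t u} → s ~ t → t ~ u → s ~ u) where

  data Independent : List (Word n) → Set where
    []  : Independent []
    _∷_ : ∀ {s L} → (∀ {t} → t ∈ L → ¬ s ~ t) → Independent L → Independent (s ∷ L)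

  independent-snoc : ∀ {L s} → Independent L → (∀ {t} → t ∈ L → ¬ t ~ s) → Independent (L ∷ʳ s)
  independent-snoc [] h = (λ ()) ∷ []
  independent-snoc {x ∷ L} (f ∷ I) h =
    (λ m → case ∈-++⁻ L m of λ { (inj₁ m′) → f m′ ; (inj₂ (here refl)) → h (here refl) }) ∷ independent-snoc I (h ∘ there)

  independent-nth : ∀ {L i j s t} → Independent L → nth L i ≡ just s → nth L j ≡ just t → s ~ t → i ≡ j
  independent-nth {x ∷ L} {zero} {zero} I e e′ c = refl
  independent-nth {x ∷ L} {zero} {suc j} (f ∷ I) refl e′ c = ⊥-elim (f (nth-∈ L j e′) c)
  independent-nth {x ∷ L} {suc i} {zero} (f ∷ I) e refl c = ⊥-elim (f (nth-∈ L i e) (~-sym c))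
  independent-nth {x ∷ L} {suc i} {suc j} (f ∷ I) e e′ c = cong suc (independent-nth I e e′ c)

  record System-of (L : List (Word n)) : Set where
    field
      vertices    : ∀ {s} → s ∈ L → V s
      independent : Independent L
  open System-of

  -- By `list-eq` representatives are only appended, so a position once filled keeps its vertex in
  -- all later stages.
  record Refines (L : List (Word n)) (xs : List (Word n)) : Set where
    field
      list    : List (Word n)
      tail    : List (Word n)
      list-eq : list ≡ L ++ tail
      system  : System-of list
      covers  : ∀ {s} → s ∈ xs → V s → ∃ λ t → t ∈ list × t ~ s
  open Refines

  refine : ∀ L xs → System-of L → Refines L xs
  refine L [] S = record { list = L ; tail = [] ; list-eq = sym (++-identityʳ L) ; system = S ; covers = λ () }
  refine L (x ∷ xs) S with V? x | ∃∈? (λ t → t ~? x) L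
  ... | no ¬v | _ = let R = refine L xs S in record
    { list = list R ; tail = tail R ; list-eq = list-eq R ; system = system R
    ; covers = λ { (here refl) v → ⊥-elim (¬v v) ; (there m) v → covers R m v } }
  ... | yes _ | yes (t , m , c) = let R = refine L xs S in record
    { list = list R ; tail = tail R ; list-eq = list-eq R ; system = system R
    ; covers = λ { (here refl) v → t , subst (t ∈_) (sym (list-eq R)) (∈-++⁺ˡ m) , c ; (there m) v → covers R m v } }
  ... | yes v | no none = let R = refine (L ∷ʳ x) xs S′ in record
    { list = list R ; tail = x ∷ tail R ; list-eq = trans (list-eq R) (∷ʳ-++ L x (tail R)) ; system = system R
    ; covers = λ { (here refl) _ → x , subst (x ∈_) (sym (list-eq R)) (∈-++⁺ˡ (∈-++⁺ʳ L (here refl))) , ~-refl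
                 ; (there m) v → covers R m v } }
    where
    S′ : System-of (L ∷ʳ x)
    vertices S′ m with ∈-++⁻ L m
    ... | inj₁ m′ = vertices S m′
    ... | inj₂ (here refl) = v
    independent S′ = independent-snoc (independent S) λ {t} m c → none (t , m , c)

  record Indexing : Set₁ where
    field
      G        : IndexGroup
      b        : IndexGroup.I G → Word n
      b-vertex : ∀ i → V (b i)
      cover    : ∀ {s} → V s → ∃ λ i → b i ~ s
      unique   : ∀ {i j s} → b i ~ s → b j ~ s → i ≡ j

  finite-indexing : ∃ V → (ts : List (Word n)) → (∀ {s} → V s → ∃ λ t → t ∈ ts × V t × t ~ s) → Indexing
  finite-indexing (v , vv) ts h = build (list R) (system R) λ {s} vs →
    let t , m , vt , c = h vs ; t′ , m′ , c′ = covers R m vt in t′ , m′ , ~-trans c′ c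
    where
    R : Refines [] ts
    R = refine [] ts (record { vertices = λ () ; independent = [] })
    build : ∀ L → System-of L → (∀ {s} → V s → ∃ λ t → t ∈ L × t ~ s) → Indexing
    build [] S c = case proj₁ (proj₂ (c vv)) of λ ()
    build L@(x ∷ L′) S c = record
      { G = Cyclic.cyclic (length L′) ; b = b ; b-vertex = λ i → vertices S (nth-∈ L (toℕ i) (b-nth i))
      ; cover = λ vs → index (c vs)
      ; unique = λ {i} {j} e e′ → toℕ-injective (independent-nth (independent S) (b-nth i) (b-nth j) (~-trans e (~-sym e′))) }
      where
      b : Fin (length L) → Word n
      b i = proj₁ (nth-< L (toℕ<n i))
      b-nth : ∀ i → nth L (toℕ i) ≡ just (b i)
      b-nth i = proj₂ (nth-< L (toℕ<n i))
      index : ∀ {s} → (∃ λ t → t ∈ L × t ~ s) → ∃ λ i → b i ~ s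
      index {s} (t , m , c′) with ∈-nth m
      ... | i , h , e = fromℕ< h , subst (_~ s) (just-injective (trans (sym e)
              (trans (cong (nth L) (sym (toℕ-fromℕ< h))) (b-nth (fromℕ< h))))) c′
        where open import Data.Maybe.Properties using (just-injective)

  module _ (unbounded : ∀ m → ∃ λ s → V s × (∀ {t} → s ~ t → m ≤ length t)) where

    stage : ℕ → ∃ System-of
    step : ∀ m → Refines (proj₁ (stage m)) (words≤ (suc m))
    stage zero = list R₀ , system R₀
      where
      R₀ : Refines [] (words≤ 0)
      R₀ = refine [] (words≤ 0) (record { vertices = λ () ; independent = [] })
    stage (suc m) = list (step m) , system (step m)
    step m = refine (proj₁ (stage m)) (words≤ (suc m)) (proj₂ (stage m))

    stage-extends : ∀ m d → ∃ λ M → proj₁ (stage (d + m)) ≡ proj₁ (stage m) ++ M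
    stage-extends m zero = [] , sym (++-identityʳ _)
    stage-extends m (suc d) with stage-extends m d
    ... | M , e = M ++ tail (step (d + m)) , trans (list-eq (step (d + m)))
      (trans (cong (_++ tail (step (d + m))) e) (++-assoc (proj₁ (stage m)) M _))

    nth-later : ∀ m d i {x} → nth (proj₁ (stage m)) i ≡ just x → nth (proj₁ (stage (d + m))) i ≡ just x
    nth-later m d i {x} e with stage-extends m d
    ... | M , eq = subst (λ L → nth L i ≡ just x) (sym eq) (nth-++ (proj₁ (stage m)) M i e)

    stage-covers : ∀ {s} → V s → ∃ λ t → t ∈ proj₁ (stage (suc (length s))) × t ~ s
    stage-covers {s} v = covers (step (length s)) (∈-words≤ (suc (length s)) s (n≤1+n _)) v

    -- Some component has only vertices longer than all representatives chosen so far; its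
    -- representative at a later stage is therefore new.
    grows : ∀ i → ∃ λ m → i < length (proj₁ (stage m))
    grows zero with unbounded 0
    ... | s , v , _ with stage-covers v
    ...   | t , mt , _ = suc (length s) , let i , h , _ = ∈-nth mt in ≤-trans (s≤s z≤n) h
    grows (suc i) with grows i
    ... | m , h with maximum length (proj₁ (stage m))
    ...   | x , mx with unbounded (suc x)
    ...     | s , v , far with stage-covers v
    ...       | t , mt , c = suc (length s) + m , longer
      where
      absent : t ∉ proj₁ (stage m)
      absent mt′ = <-irrefl refl (≤-trans (far (~-sym c)) (mx mt′))
      later : ∃ λ M → proj₁ (stage (suc (length s) + m)) ≡ proj₁ (stage m) ++ M
      later = stage-extends m (suc (length s))
      later′ : ∃ λ M → proj₁ (stage (m + suc (length s))) ≡ proj₁ (stage (suc (length s))) ++ M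
      later′ = stage-extends (suc (length s)) m
      present : t ∈ proj₁ (stage m) ++ proj₁ later
      present = subst (t ∈_) (trans (cong (proj₁ ∘ stage) (+-comm m (suc (length s)))) (proj₂ later))
        (subst (t ∈_) (sym (proj₂ later′)) (∈-++⁺ˡ mt))
      longer : suc i < length (proj₁ (stage (suc (length s) + m)))
      longer = ≤-trans (s≤s h) (subst (λ L → suc (length (proj₁ (stage m))) ≤ length L) (sym (proj₂ later))
        (longer-++ (proj₁ (stage m)) (proj₁ later) present absent))

    b : ℕ → Word n
    b i = proj₁ (nth-< (proj₁ (stage (proj₁ (grows i)))) (proj₂ (grows i)))

    b-nth : ∀ i → nth (proj₁ (stage (proj₁ (grows i)))) i ≡ just (b i)
    b-nth i = proj₂ (nth-< (proj₁ (stage (proj₁ (grows i)))) (proj₂ (grows i)))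

    same-index : ∀ {m m′ i j s t} → nth (proj₁ (stage m)) i ≡ just s → nth (proj₁ (stage m′)) j ≡ just t → s ~ t → i ≡ j
    same-index {m} {m′} {i} {j} {s} {t} e e′ = independent-nth (independent (proj₂ (stage (m′ + m)))) (nth-later m m′ i e)
      (subst (λ k → nth (proj₁ (stage k)) j ≡ just t) (+-comm m m′) (nth-later m′ m j e′))

    infinite-indexing : Indexing
    infinite-indexing = record
      { G = integers ; b = b ∘ fromℤ
      ; b-vertex = λ i → vertices (proj₂ (stage (proj₁ (grows (fromℤ i))))) (nth-∈ _ (fromℤ i) (b-nth (fromℤ i)))
      ; cover = covering
      ; unique = λ {i} {j} e e′ → trans (sym (toℤ-fromℤ i)) (trans (cong toℤ
          (same-index {proj₁ (grows (fromℤ i))} {proj₁ (grows (fromℤ j))} (b-nth (fromℤ i)) (b-nth (fromℤ j)) (~-trans e (~-sym e′)))) (toℤ-fromℤ j)) }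
      where
      covering : ∀ {s} → V s → ∃ λ i → b (fromℤ i) ~ s
      covering {s} v with stage-covers v
      ... | t , mt , c with ∈-nth mt
      ...   | i , _ , e = toℤ i , subst (λ k → b k ~ s) (sym (fromℤ-toℤ i)) (~-trans t~b c)
        where
        open import Data.Maybe.Properties using (just-injective)
        g : ℕ
        g = proj₁ (grows i)
        t~b : b i ~ t
        t~b = subst (_~ t) (just-injective (trans (sym (nth-later (suc (length s)) g i e))
          (subst (λ k → nth (proj₁ (stage k)) i ≡ just (b i)) (+-comm (suc (length s)) g) (nth-later g (suc (length s)) i (b-nth i))))) ~-refl

-- Cayley graphs and generalized Cayley graphs of groups

module Groups {n : ℕ} {A : Set} (_≟_ : DecidableEquality A) (P : Presentation n A) (X : Presented P) where
  open Graph _≟_ P X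

  private
    V : Word n → Set
    V = Vertex P
    T : System n (A × Bool)
    T = symmetrise S

  open System T
  open Symmetry T (symmetrise-symmetric S)
  open Components (×-≡-dec _≟_ _≟ᵇ_) T (symmetrise-symmetric S) q₀

  moves : ∀ {s} → V s → Moves s
  moves (a , t , inj₁ e) = _ , t , sym-forward S (to e)
  moves (a , t , inj₂ e) = _ , t , sym-backward S (to e)

  step-vertices : ∀ {s k t} → Step q₀ s k t → V s × V t
  step-vertices {k = a , true} st = let e = from (sym-step⁻ S st) in source e , target e
  step-vertices {k = a , false} st = let e = from (sym-step⁻ S st) in target e , source e

  moves⁻ : ∀ {s} → Moves s → V s
  moves⁻ (_ , _ , st) = proj₁ (step-vertices st)

  deterministic : SimpleEdges → CoSimpleEdges → Deterministic T q₀
  deterministic simple co {l = a , true} st st′ = proj₁ (simple (from (sym-step⁻ S st)) (from (sym-step⁻ S st′))) refl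
  deterministic simple co {l = a , false} st st′ = proj₁ (co (from (sym-step⁻ S st)) (from (sym-step⁻ S st′))) refl

  Connected : Set
  Connected = ∀ {s} → V s → Reach q₀ v₀ s

  opaque
    connected? : Dec Connected
    connected? with ∃-regular? (×-regular vertex-regular (¬-regular (post-regular T q₀ v₀)))
    ... | yes (s , vs , ¬c) = no λ h → ¬c (h vs)
    ... | no h = yes λ {s} vs → decidable-stable (reach? T q₀ v₀ s) λ ¬c → h (s , vs , ¬c)

  module Reps = Representatives V vertex? (Reach q₀) (reach? T q₀) (_ , []) reach-sym reach-trans

  opaque
    indexing : Reps.Indexing
    indexing with finitely-many-or-unbounded
    ... | inj₁ (ts , mv , cov) = Reps.finite-indexing (v₀ , v₀-vertex) ts
      λ vs → let t , m , c = cov (moves vs) in t , m , moves⁻ (mv m) , c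
    ... | inj₂ unb = Reps.infinite-indexing λ m → let s , ms , far = unb m in s , moves⁻ ms , far

  module _ (simple : SimpleEdges) (co : CoSimpleEdges) (agree : KernelsAgree (deterministic simple co)) where
    open Reps.Indexing indexing
    open IndexGroup G using (ε; inv; inverseˡ; inverseʳ; indexMonoid)

    private
      module PM = PathMonoid T q₀ (deterministic simple co) V vertex? (λ st → proj₂ (step-vertices st))
        (λ vs vs′ → agree (moves vs) (moves vs′)) indexMonoid b b-vertex cover unique
    open PM

    r : Word n
    r = b ε

    -- Out-completeness comes for free: the diagonal pair of a single label belongs to every kernel
    -- as soon as it belongs to one.
    outComplete : OutComplete
    outComplete {s} {a} vs e with agree (moves (source e)) (moves vs) [ a , true ] [ a , true ]
      (_ , sym-forward S (to e) ∷ [] , sym-forward S (to e) ∷ [])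
    ... | t , st ∷ [] , _ = t , from (sym-step⁻ S st)

    open Realize simple outComplete (b-vertex ε) closed (λ e eq → op-step (source e) (sym-forward S (to e)) (sym-forward S (to eq)))

    private
      isGroup : GroupWith V op r
      isGroup = Inverses.group inv inverseˡ inverseʳ (λ p → reach-sym (_ , p))

    generalized : Realization P gen-cayley-group
    generalized = realization gen-cayley-group (r , isGroup)

    generated : ∀ {s u t} → V s → Path q₀ s u t → GenGroup V op (Succ P r) r s → GenGroup V op (Succ P r) r t
    generated vs [] g = g
    generated {s} vs (_∷_ {l = a , true} st p) g with outComplete (b-vertex ε) (from (sym-step⁻ S st))
    ... | q , eq = generated (proj₂ (step-vertices st)) p (subst (GenGroup V op (Succ P r) r)
      (op-step vs st (sym-forward S (to eq))) (gen-op g (gen-q (_ , eq))))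
    generated {s} vs (_∷_ {l = a , false} {y = s₁} st p) g with outComplete (b-vertex ε) (from (sym-step⁻ S st))
    ... | q , eq with proj₂ isGroup q (target eq)
    ...   | x , vx , qx , xq = generated vs₁ p (subst (GenGroup V op (Succ P r) r) divides (gen-op g (gen-inv (gen-q (_ , eq)) vx qx xq)))
      where
      vs₁ : V s₁
      vs₁ = proj₂ (step-vertices st)
      divides : op s x ≡ s₁
      divides = trans (cong (λ z → op z x) (sym (op-step vs₁ (sym-forward S (sym-step⁻ S st)) (sym-forward S (to eq)))))
        (trans (proj₁ (proj₂ (proj₁ isGroup)) s₁ q x vs₁ (target eq) vx)
          (trans (cong (op s₁) qx) (proj₂ (proj₂ (proj₂ (proj₁ isGroup)) s₁ vs₁))))

    cayley-graph : Connected → Realization P cayley-group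
    cayley-graph conn = realization cayley-group (r , isGroup , λ p vp →
      generated (b-vertex ε) (proj₂ (reach-trans (reach-sym (conn (b-vertex ε))) (conn vp))) gen-e)

  module Necessary {op Q lab e} (cl : Closed V op) (Q⊆V : ∀ q → Q q → V q)
    (inj : ∀ q q′ → Q q → Q q′ → lab q ≡ lab q′ → q ≡ q′) (cay : IsCayleyGraphOf P op Q lab)
    (grp : GroupWith V op e) where

    private
      ve : V e
      ve = proj₁ (proj₁ grp)
      ass : Assoc V op
      ass = proj₁ (proj₂ (proj₁ grp))
      idl : ∀ {p} → V p → op e p ≡ p
      idl vp = proj₁ (proj₂ (proj₂ (proj₁ grp)) _ vp)
      idr : ∀ {p} → V p → op p e ≡ p
      idr vp = proj₂ (proj₂ (proj₂ (proj₁ grp)) _ vp)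

    left-cancellative : LeftCancellative V op
    left-cancellative s p q vs vp vq eq with proj₂ grp s vs
    ... | x , vx , _ , xs = trans (sym (undo vp)) (trans (cong (op x) eq) (undo vq))
      where
      undo : ∀ {z} → V z → op x (op s z) ≡ z
      undo {z} vz = trans (sym (ass x s z vx vs vz)) (trans (cong (λ y → op y z) xs) (idl vz))

    cancelʳ : ∀ {s x z} → V s → V x → V z → op s x ≡ e → op (op z s) x ≡ z
    cancelʳ {s} {x} {z} vs vx vz sx = trans (ass z s x vz vs vx) (trans (cong (op z) sx) (idr vz))

    right-cancellative : RightCancellative V op
    right-cancellative s p q vs vp vq eq with proj₂ grp s vs
    ... | x , vx , sx , _ = trans (sym (cancelʳ vs vx vp sx)) (trans (cong (λ y → op y x) eq) (cancelʳ vs vx vq sx))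

    simple : SimpleEdges
    simple = cayley-simple Q⊆V inj cay left-cancellative

    co : CoSimpleEdges
    co = cayley-cosimple Q⊆V inj cay simple right-cancellative

    -- An inverse label acts as right multiplication by the inverse of its generator.
    multiplication : ∀ {s l t} → V s → Step q₀ s l t →
      ∃ λ m → V m × t ≡ op s m × (∀ s′ → V s′ → Step q₀ s′ l (op s′ m))
    multiplication {s} {a , true} {t} vs st with proj₁ (cay s a t) (from (sym-step⁻ S st))
    ... | _ , q , Qq , el , et = q , Q⊆V q Qq , et
      , λ s′ vs′ → sym-forward S (to (proj₂ (cay s′ a (op s′ q)) (vs′ , q , Qq , el , refl)))
    multiplication {s} {a , false} {t} vs st with proj₁ (cay t a s) (from (sym-step⁻ S st))
    ... | vt , q , Qq , el , refl with proj₂ grp q (Q⊆V q Qq)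
    ...   | x , vx , qx , xq = x , vx , sym (cancelʳ (Q⊆V q Qq) vx vt qx)
      , λ s′ vs′ → sym-backward S (to (proj₂ (cay (op s′ x) a s′) (cl s′ x vs′ vx , q , Qq , el
          , sym (cancelʳ vx (Q⊆V q Qq) vs′ xq))))

    agree : (d : Deterministic T q₀) → KernelsAgree d
    agree d ms ms′ = RightMultiplications.kernels-agree T q₀ V op e cl (proj₁ grp) left-cancellative multiplication (moves⁻ ms) (moves⁻ ms′)

    gen-vertex : ∀ {p} → GenGroup V op Q e p → V p
    gen-vertex gen-e = ve
    gen-vertex (gen-q Qq) = Q⊆V _ Qq
    gen-vertex (gen-op g g′) = cl _ _ (gen-vertex g) (gen-vertex g′)
    gen-vertex (gen-inv g vx _ _) = vx

    path-to : ∀ {p} → GenGroup V op Q e p → ∀ {s} → V s → Reach q₀ s (op s p)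
    path-to gen-e {s} vs = [] , subst (Path q₀ s []) (sym (idr vs)) []
    path-to (gen-q {q} Qq) {s} vs = _ , sym-forward S (to (proj₂ (cay s _ (op s q)) (vs , q , Qq , refl , refl))) ∷ []
    path-to (gen-op {p} {q} g g′) {s} vs = reach-trans (path-to g vs)
      (subst (Reach q₀ (op s p)) (ass s p q vs (gen-vertex g) (gen-vertex g′)) (path-to g′ (cl s p vs (gen-vertex g))))
    path-to (gen-inv {p} {x} g vx px xp) {s} vs = reach-sym (subst (Reach q₀ (op s x))
      (cancelʳ vx (gen-vertex g) vs xp) (path-to g (cl s x vs vx)))

    connected : (∀ p → V p → GenGroup V op Q e p) → Connected
    connected gen {s} vs = reach-trans (reach-sym (from-identity v₀-vertex)) (from-identity vs)
      where
      from-identity : ∀ {p} → V p → Reach q₀ e p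
      from-identity {p} vp = subst (Reach q₀ e) (idl vp) (path-to (gen p vp) ve)

  private
    Impossible : Set₁
    Impossible = ∀ {op Q lab e} → Closed V op → (∀ q → Q q → V q) → (∀ q q′ → Q q → Q q′ → lab q ≡ lab q′ → q ≡ q′) →
      IsCayleyGraphOf P op Q lab → GroupWith V op e → ⊥

    GroupLike : Set
    GroupLike = Σ SimpleEdges λ simple → Σ CoSimpleEdges λ co → KernelsAgree (deterministic simple co)

    groupLike : GroupLike ⊎ Impossible
    groupLike with simpleEdges? | coSimpleEdges?
    ... | no ¬simple | _ = inj₂ λ cl Q⊆V inj cay grp → ¬simple (Necessary.simple cl Q⊆V inj cay grp)
    ... | yes _ | no ¬co = inj₂ λ cl Q⊆V inj cay grp → ¬co (Necessary.co cl Q⊆V inj cay grp)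
    ... | yes simple | yes co with kernelsAgree? (deterministic simple co) (moves v₀-vertex)
    ...   | yes agree = inj₁ (simple , co , agree)
    ...   | no ¬agree = inj₂ λ cl Q⊆V inj cay grp → ¬agree (Necessary.agree cl Q⊆V inj cay grp (deterministic simple co))

  decide-generalized : Realization P gen-cayley-group ⊎ ¬ IsKind P gen-cayley-group
  decide-generalized with groupLike
  ... | inj₁ (simple , co , agree) = inj₁ (generalized simple co agree)
  ... | inj₂ no-group = inj₂ λ { (op , Q , lab , cl , Q⊆V , inj , cay , e , grp) → no-group cl Q⊆V inj cay grp }

  decide-cayley : Realization P cayley-group ⊎ ¬ IsKind P cayley-group
  decide-cayley with groupLike | connected?
  ... | inj₁ (simple , co , agree) | yes conn = inj₁ (cayley-graph simple co agree conn)
  ... | inj₂ no-group | _ = inj₂ λ { (op , Q , lab , cl , Q⊆V , inj , cay , e , grp , gen) → no-group cl Q⊆V inj cay grp }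
  ... | inj₁ _ | no ¬conn = inj₂ λ { (op , Q , lab , cl , Q⊆V , inj , cay , e , grp , gen) →
    ¬conn (Necessary.connected cl Q⊆V inj cay grp gen) }

-- Generalized Cayley graphs of quasigroups

module Quasigroups {n : ℕ} {A : Set} (_≟_ : DecidableEquality A) (P : Presentation n A) (X : Presented P) where
  open Graph _≟_ P X
  open System S
  open LeftQuasigroups _≟_ P X using (leftQuasigroup-cancellative)

  private
    V : Word n → Set
    V = Vertex P
    E : Word n → A → Word n → Set
    E = Edge P

  -- Infinite vertex sets: a partial multiplication table is completed one requirement at a time

  Triple : Set
  Triple = Word n × Word n × Word n

  -- The condition on a partial Latin square: any two coordinates determine the third.
  Agree : Triple → Triple → Set
  Agree (p , q , t) (p′ , q′ , t′) =
    (p ≡ p′ → q ≡ q′ → t ≡ t′) × (p ≡ p′ → t ≡ t′ → q ≡ q′) × (q ≡ q′ → t ≡ t′ → p ≡ p′)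

  agree-refl : ∀ x → Agree x x
  agree-refl x = (λ _ _ → refl) , (λ _ _ → refl) , λ _ _ → refl

  agree-sym : ∀ x y → Agree x y → Agree y x
  agree-sym _ _ (a , b , c) = (λ e f → sym (a (sym e) (sym f))) , (λ e f → sym (b (sym e) (sym f))) , λ e f → sym (c (sym e) (sym f))

  module InfiniteCase (simple : SimpleEdges) (co : CoSimpleEdges) (oc : OutComplete) (ic : InComplete)
    (unbounded : ∀ m → ∃ λ w → V w × m ≤ length w) where

    -- The entries in the columns v₀·a are prescribed by the edges.
    Prescribed : Triple → Set
    Prescribed (p , q , t) = ∃ λ a → E v₀ a q × E p a t

    -- There may be infinitely many prescribed entries; they stay implicit in the edge relation, and
    -- only the finitely many added ones are stored.
    Holds : List Triple → Triple → Set
    Holds T x = x ∈ T ⊎ Prescribed x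

    record Table : Set where
      field
        entries    : List Triple
        vertices   : ∀ {p q t} → (p , q , t) ∈ entries → V p × V q × V t
        consistent : ∀ {x y} → Holds entries x → Holds entries y → Agree x y
    open Table

    _⊑_ : Table → Table → Set
    T ⊑ T′ = ∀ {x} → x ∈ entries T → x ∈ entries T′

    holds-mono : ∀ {T T′ x} → T ⊑ T′ → Holds (entries T) x → Holds (entries T′) x
    holds-mono h (inj₁ m) = inj₁ (h m)
    holds-mono h (inj₂ p) = inj₂ p

    prescribed-agree : ∀ {x y} → Prescribed x → Prescribed y → Agree x y
    prescribed-agree (a , e , f) (a′ , e′ , f′) = ab , bc , ca
      where
      ab : _ → _ → _
      ab refl refl = proj₁ (simple f f′) (proj₂ (simple e e′) refl)
      bc : _ → _ → _
      bc refl refl = proj₁ (simple e e′) (proj₂ (simple f f′) refl)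
      ca : _ → _ → _
      ca refl refl = proj₁ (co f f′) (proj₂ (simple e e′) refl)

    empty : Table
    empty = record { entries = [] ; vertices = λ () ; consistent = λ { (inj₂ x) (inj₂ y) → prescribed-agree x y } }

    insert : (T : Table) → ∀ {p q t} → V p → V q → V t → (∀ {y} → Holds (entries T) y → Agree (p , q , t) y) → Table
    insert T {p} {q} {t} vp vq vt h = record
      { entries = (p , q , t) ∷ entries T
      ; vertices = λ { (here refl) → vp , vq , vt ; (there m) → vertices T m }
      ; consistent = λ { {x} {y} a b → both x y a b } }
      where
      both : ∀ x y → Holds ((p , q , t) ∷ entries T) x → Holds ((p , q , t) ∷ entries T) y → Agree x y
      both _ _ (inj₁ (here refl)) (inj₁ (here refl)) = agree-refl _
      both _ _ (inj₁ (here refl)) (inj₁ (there m)) = h (inj₁ m)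
      both _ _ (inj₁ (here refl)) (inj₂ y) = h (inj₂ y)
      both x _ (inj₁ (there m)) (inj₁ (here refl)) = agree-sym _ x (h (inj₁ m))
      both x _ (inj₂ m) (inj₁ (here refl)) = agree-sym _ x (h (inj₂ m))
      both _ _ (inj₁ (there m)) (inj₁ (there m′)) = consistent T (inj₁ m) (inj₁ m′)
      both _ _ (inj₁ (there m)) (inj₂ y) = consistent T (inj₁ m) (inj₂ y)
      both _ _ (inj₂ x) (inj₁ (there m)) = consistent T (inj₂ x) (inj₁ m)
      both _ _ (inj₂ x) (inj₂ y) = consistent T (inj₂ x) (inj₂ y)

    fresh : (ws : List (Word n)) → ∃ λ w → V w × w ∉ ws
    fresh ws with maximum length ws
    ... | m , h with unbounded (suc m)
    ...   | w , v , l = w , v , λ i → <-irrefl refl (≤-trans l (h i))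

    module _ (T : Table) where

      coordinates : List (Word n)
      coordinates = concatMap (λ (p , q , t) → p ∷ q ∷ t ∷ []) (entries T)

      coordinates∈ : ∀ {p q t} → (p , q , t) ∈ entries T → p ∈ coordinates × q ∈ coordinates × t ∈ coordinates
      coordinates∈ m = at (here refl) , at (there (here refl)) , at (there (there (here refl)))
        where
        at : ∀ {w} → w ∈ _ → w ∈ coordinates
        at i = ∈-concatMap⁺ (λ (p , q , t) → p ∷ q ∷ t ∷ []) (lose m i)

      Extends : (Table → Set) → Set
      Extends Φ = ∃ λ T′ → T ⊑ T′ × Φ T′

      column? : ∀ q → Dec (∃ λ e → e ∈ successors q₀ v₀ × q ≡ proj₂ e)
      column? q = ∃∈? (λ e → q ≟ʷ proj₂ e) (successors q₀ v₀)

      column-of : ∀ {a q} → E v₀ a q → ∃ λ e → e ∈ successors q₀ v₀ × q ≡ proj₂ e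
      column-of e = _ , successor e , refl

      fill-cell : ∀ {p q} → V p → V q → Extends λ T′ → ∃ λ t → V t × Holds (entries T′) (p , q , t)
      fill-cell {p} {q} vp vq with column? q
      ... | yes (_ , m , refl) with oc vp (successor⁻ {s = v₀} m)
      ...   | t , e = T , id , t , target e , inj₂ (_ , successor⁻ {s = v₀} m , e)
      fill-cell {p} {q} vp vq | no ¬c with ∃∈? (λ (p′ , q′ , _) → (p ≟ʷ p′) ×-dec (q ≟ʷ q′)) (entries T)
      ... | yes ((_ , _ , t) , m , refl , refl) = T , id , t , proj₂ (proj₂ (vertices T m)) , inj₁ m
      -- The new value must also avoid the prescribed values of row `p`; they are successors of `p`,
      -- hence finitely many.
      ... | no ¬m with fresh (coordinates ++ map proj₂ (successors q₀ p))
      ...   | t , vt , ¬t = insert T vp vq vt compatible , there , t , vt , inj₁ (here refl)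
        where
        compatible : ∀ {y} → Holds (entries T) y → Agree (p , q , t) y
        compatible (inj₁ m) = (λ { refl refl → ⊥-elim (¬m (_ , m , refl , refl)) })
          , (λ { _ refl → ⊥-elim (¬t (∈-++⁺ˡ (proj₂ (proj₂ (coordinates∈ m))))) })
          , λ { _ refl → ⊥-elim (¬t (∈-++⁺ˡ (proj₂ (proj₂ (coordinates∈ m))))) }
        compatible (inj₂ (a , e , f)) = (λ { _ refl → ⊥-elim (¬c (column-of e)) })
          , (λ { refl refl → ⊥-elim (¬t (∈-++⁺ʳ coordinates (∈-map⁺ proj₂ (successor f)))) })
          , λ { refl _ → ⊥-elim (¬c (column-of e)) }

      fill-row : ∀ {p t} → V p → V t → Extends λ T′ → ∃ λ q → V q × Holds (entries T′) (p , q , t)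
      fill-row {p} {t} vp vt with ∃∈? (λ e → t ≟ʷ proj₂ e) (successors q₀ p)
      ... | yes (_ , m , refl) with oc v₀-vertex (successor⁻ {s = p} m)
      ...   | q , e = T , id , q , target e , inj₂ (_ , e , successor⁻ m)
      fill-row {p} {t} vp vt | no ¬e with ∃∈? (λ (p′ , _ , t′) → (p ≟ʷ p′) ×-dec (t ≟ʷ t′)) (entries T)
      ... | yes ((_ , q , _) , m , refl , refl) = T , id , q , proj₁ (proj₂ (vertices T m)) , inj₁ m
      -- The new column must not be one of the finitely many prescribed columns.
      ... | no ¬m with fresh (coordinates ++ map proj₂ (successors q₀ v₀))
      ...   | q , vq , ¬q = insert T vp vq vt compatible , there , q , vq , inj₁ (here refl)
        where
        compatible : ∀ {y} → Holds (entries T) y → Agree (p , q , t) y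
        compatible (inj₁ m) = (λ { _ refl → ⊥-elim (¬q (∈-++⁺ˡ (proj₁ (proj₂ (coordinates∈ m))))) })
          , (λ { refl refl → ⊥-elim (¬m (_ , m , refl , refl)) })
          , λ { refl _ → ⊥-elim (¬q (∈-++⁺ˡ (proj₁ (proj₂ (coordinates∈ m))))) }
        compatible (inj₂ (a , e , f)) = (λ { _ refl → ⊥-elim (¬q (∈-++⁺ʳ coordinates (∈-map⁺ proj₂ (successor e)))) })
          , (λ { refl refl → ⊥-elim (¬e (_ , successor f , refl)) })
          , λ { refl _ → ⊥-elim (¬q (∈-++⁺ʳ coordinates (∈-map⁺ proj₂ (successor e)))) }

      fill-column : ∀ {q t} → V q → V t → Extends λ T′ → ∃ λ p → V p × Holds (entries T′) (p , q , t)
      fill-column {q} {t} vq vt with column? q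
      ... | yes (_ , m , refl) with ic vt (successor⁻ {s = v₀} m)
      ...   | p , e = T , id , p , source e , inj₂ (_ , successor⁻ {s = v₀} m , e)
      fill-column {q} {t} vq vt | no ¬c with ∃∈? (λ (_ , q′ , t′) → (q ≟ʷ q′) ×-dec (t ≟ʷ t′)) (entries T)
      ... | yes ((p , _ , _) , m , refl , refl) = T , id , p , proj₁ (vertices T m) , inj₁ m
      -- The new row must not already carry `t` as a prescribed value, so the sources of edges into
      -- `t` are avoided.
      ... | no ¬m with fresh (coordinates ++ map proj₂ (System.successors (rev S) q₀ t))
      ...   | p , vp , ¬p = insert T vp vq vt compatible , there , p , vp , inj₁ (here refl)
        where
        compatible : ∀ {y} → Holds (entries T) y → Agree (p , q , t) y
        compatible (inj₁ m) = (λ { refl _ → ⊥-elim (¬p (∈-++⁺ˡ (proj₁ (coordinates∈ m)))) })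
          , (λ { refl _ → ⊥-elim (¬p (∈-++⁺ˡ (proj₁ (coordinates∈ m)))) })
          , λ { refl refl → ⊥-elim (¬m (_ , m , refl , refl)) }
        compatible (inj₂ (a , e , f)) = (λ { _ refl → ⊥-elim (¬c (column-of e)) })
          , (λ { refl refl → ⊥-elim (¬p (∈-++⁺ʳ coordinates (∈-map⁺ proj₂ (System.successors-complete (rev S) (rev-step S (to f)))))) })
          , λ { refl _ → ⊥-elim (¬c (column-of e)) }

    record Complete (T : Table) (x y : Word n) : Set where
      field
        cell   : ∃ λ t → V t × Holds (entries T) (x , y , t)
        row    : ∃ λ q → V q × Holds (entries T) (x , q , y)
        column : ∃ λ p → V p × Holds (entries T) (p , x , y)
    open Complete

    complete-mono : ∀ {T T′ x y} → T ⊑ T′ → Complete T x y → Complete T′ x y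
    complete-mono {T} {T′} h C = record
      { cell = let t , v , i = cell C in t , v , holds-mono {T} {T′} h i
      ; row = let t , v , i = row C in t , v , holds-mono {T} {T′} h i
      ; column = let t , v , i = column C in t , v , holds-mono {T} {T′} h i }

    complete-pair : ∀ T {x y} → V x → V y → ∃ λ T′ → T ⊑ T′ × Complete T′ x y
    complete-pair T vx vy with fill-cell T vx vy
    ... | T₁ , h₁ , t , vt , i with fill-row T₁ vx vy
    ...   | T₂ , h₂ , q , vq , j with fill-column T₂ vx vy
    ...     | T₃ , h₃ , p , vp , k = T₃ , h₃ ∘ h₂ ∘ h₁ , record
      { cell = t , vt , holds-mono {T₁} {T₃} (h₃ ∘ h₂) i ; row = q , vq , holds-mono {T₂} {T₃} h₃ j ; column = p , vp , k }

    complete-list : ∀ T (l : List (Word n × Word n)) →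
      ∃ λ T′ → T ⊑ T′ × (∀ {x y} → (x , y) ∈ l → V x → V y → Complete T′ x y)
    complete-list T [] = T , id , λ ()
    complete-list T ((x , y) ∷ l) with vertex? x | vertex? y
    ... | yes vx | yes vy = let T₁ , h₁ , C = complete-pair T vx vy ; T₂ , h₂ , Cs = complete-list T₁ l in
      T₂ , h₂ ∘ h₁ , λ { (here refl) _ _ → complete-mono {T₁} {T₂} h₂ C ; (there m) → Cs m }
    ... | no ¬v | _ = let T₂ , h₂ , Cs = complete-list T l in
      T₂ , h₂ , λ { (here refl) v _ → ⊥-elim (¬v v) ; (there m) → Cs m }
    ... | yes _ | no ¬v = let T₂ , h₂ , Cs = complete-list T l in
      T₂ , h₂ , λ { (here refl) _ v → ⊥-elim (¬v v) ; (there m) → Cs m }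

    pairs≤ : ℕ → List (Word n × Word n)
    pairs≤ m = cartesianProductWith _,_ (words≤ m) (words≤ m)

    pair∈ : ∀ m {x y} → length x ≤ m → length y ≤ m → (x , y) ∈ pairs≤ m
    pair∈ m {x} {y} hx hy = ∈-cartesianProductWith⁺ _,_ (∈-words≤ m x hx) (∈-words≤ m y hy)

    opaque
      stage : ℕ → Table
      stage zero = proj₁ (complete-list empty (pairs≤ 0))
      stage (suc m) = proj₁ (complete-list (stage m) (pairs≤ (suc m)))

      stage-step : ∀ m → stage m ⊑ stage (suc m)
      stage-step m = proj₁ (proj₂ (complete-list (stage m) (pairs≤ (suc m))))

      stage-complete : ∀ m {x y} → length x ≤ m → length y ≤ m → V x → V y → Complete (stage m) x y
      stage-complete zero hx hy = proj₂ (proj₂ (complete-list empty (pairs≤ 0))) (pair∈ 0 hx hy)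
      stage-complete (suc m) hx hy = proj₂ (proj₂ (complete-list (stage m) (pairs≤ (suc m)))) (pair∈ (suc m) hx hy)

    stage-mono : ∀ d m → stage m ⊑ stage (d + m)
    stage-mono zero m i = i
    stage-mono (suc d) m i = stage-step (d + m) (stage-mono d m i)

    Entry : Triple → Set
    Entry x = ∃ λ m → Holds (entries (stage m)) x

    entries-agree : ∀ {x y} → Entry x → Entry y → Agree x y
    entries-agree {y = y} (m , h) (m′ , h′) = consistent (stage (m′ + m)) (holds-mono {stage m} {stage (m′ + m)} (stage-mono m′ m) h)
      (subst (λ k → Holds (entries (stage k)) y) (+-comm m m′) (holds-mono {stage m′} {stage (m + m′)} (stage-mono m m′) h′))

    completed : ∀ x y → V x → V y → Complete (stage (length x ⊔ length y)) x y
    completed x y = stage-complete _ (m≤m⊔n _ _) (m≤n⊔m (length x) _)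

    op : Word n → Word n → Word n
    op p q with vertex? p | vertex? q
    ... | yes vp | yes vq = proj₁ (cell (completed p q vp vq))
    ... | _ | _ = []

    op-entry : ∀ {p q} → V p → V q → V (op p q) × Entry (p , q , op p q)
    op-entry {p} {q} vp vq with vertex? p | vertex? q
    ... | yes vp′ | yes vq′ = let t , vt , h = cell (completed p q vp′ vq′) in vt , _ , h
    ... | no ¬v | _ = ⊥-elim (¬v vp)
    ... | yes _ | no ¬v = ⊥-elim (¬v vq)

    op-unique : ∀ {p q t} → V p → V q → Entry (p , q , t) → op p q ≡ t
    op-unique vp vq h = proj₁ (entries-agree (proj₂ (op-entry vp vq)) h) refl refl

    entry-of : ∀ {p q t} → V p → V q → op p q ≡ t → Entry (p , q , t)
    entry-of vp vq refl = proj₂ (op-entry vp vq)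

    quasigroup : Quasigroup V op
    quasigroup = (λ p q vp vq → solve-row p q vp vq
        , λ r r′ vr vr′ e e′ → proj₁ (proj₂ (entries-agree (entry-of vp vr e) (entry-of vp vr′ e′))) refl refl)
      , λ p q vp vq → solve-column p q vp vq
        , λ s s′ vs vs′ e e′ → proj₂ (proj₂ (entries-agree (entry-of vs vp e) (entry-of vs′ vp e′))) refl refl
      where
      solve-row : ∀ p q → V p → V q → ∃ λ r → V r × op p r ≡ q
      solve-row p q vp vq with row (completed p q vp vq)
      ... | r , vr , h = r , vr , op-unique vp vr (_ , h)
      solve-column : ∀ p q → V p → V q → ∃ λ s → V s × op s p ≡ q
      solve-column p q vp vq with column (completed p q vp vq)
      ... | s , vs , h = s , vs , op-unique vs vp (_ , h)

    realization : Realization P gen-cayley-quasigroup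
    realization = Realize.realization simple oc v₀-vertex (λ p q vp vq → proj₁ (op-entry vp vq))
      (λ e eq → op-unique (source e) (target eq) (0 , inj₂ (_ , eq , e))) gen-cayley-quasigroup quasigroup

  -- Finite vertex sets: exhaustive search

  module FiniteCase (simple : SimpleEdges) (oc : OutComplete) {m : ℕ} (bnd : ∀ w → V w → length w < m) where

    vs : List (Word n)
    vs = filter vertex? (words≤ m)

    vs∈ : ∀ {w} → V w → w ∈ vs
    vs∈ {w} v = ∈-filter⁺ vertex? (∈-words≤ m w (<⇒≤ (bnd w v))) v

    vs∈⁻ : ∀ {w} → w ∈ vs → V w
    vs∈⁻ i = proj₂ (∈-filter⁻ vertex? {xs = words≤ m} i)

    record Latin (op : Word n → Word n → Word n) : Set where
      field
        closed    : ∀ p → p ∈ vs → ∀ q → q ∈ vs → op p q ∈ vs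
        row       : ∀ p → p ∈ vs → ∀ q → q ∈ vs → ∃ λ r → r ∈ vs × op p r ≡ q
        row-inj   : ∀ p → p ∈ vs → ∀ r → r ∈ vs → ∀ r′ → r′ ∈ vs → op p r ≡ op p r′ → r ≡ r′
        col       : ∀ p → p ∈ vs → ∀ q → q ∈ vs → ∃ λ s → s ∈ vs × op s p ≡ q
        col-inj   : ∀ p → p ∈ vs → ∀ s → s ∈ vs → ∀ s′ → s′ ∈ vs → op s p ≡ op s′ p → s ≡ s′
        follows   : ∀ s → s ∈ vs → ∀ e → e ∈ successors q₀ s → ∀ e′ → e′ ∈ successors q₀ v₀ →
                    proj₁ e ≡ proj₁ e′ → op s (proj₂ e′) ≡ proj₂ e

    latin? : ∀ op → Dec (Latin op)
    latin? op = map′ (λ (a , b , c , d , e , f) → record { closed = a ; row = b ; row-inj = c ; col = d ; col-inj = e ; follows = f })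
      (λ l → let open Latin l in closed , row , row-inj , col , col-inj , follows)
      (∀∈? (λ p → ∀∈? (λ q → op p q ∈? vs) vs) vs ×-dec
       ∀∈? (λ p → ∀∈? (λ q → ∃∈? (λ r → op p r ≟ʷ q) vs) vs) vs ×-dec
       ∀∈? (λ p → ∀∈? (λ r → ∀∈? (λ r′ → (op p r ≟ʷ op p r′) →-dec (r ≟ʷ r′)) vs) vs) vs ×-dec
       ∀∈? (λ p → ∀∈? (λ q → ∃∈? (λ s → op s p ≟ʷ q) vs) vs) vs ×-dec
       ∀∈? (λ p → ∀∈? (λ s → ∀∈? (λ s′ → (op s p ≟ʷ op s′ p) →-dec (s ≟ʷ s′)) vs) vs) vs ×-dec
       ∀∈? (λ s → ∀∈? (λ e → ∀∈? (λ e′ → (proj₁ e ≟ proj₁ e′) →-dec (op s (proj₂ e′) ≟ʷ proj₂ e)) (successors q₀ v₀)) (successors q₀ s)) vs)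
      where open import Data.List.Membership.DecPropositional (_≟ʷ_ {n}) using (_∈?_)

    -- `Latin` sees only the values on `vs`, so any operation may be replaced by its finite table;
    -- this makes the search exhaustive.
    latin-cong : ∀ {op op′} → (∀ {p q} → p ∈ vs → q ∈ vs → op p q ≡ op′ p q) → Latin op → Latin op′
    latin-cong {op} {op′} eq l = record
      { closed = λ p i q j → subst (_∈ vs) (eq i j) (closed p i q j)
      ; row = λ p i q j → let r , k , e = row p i q j in r , k , trans (sym (eq i k)) e
      ; row-inj = λ p i r j r′ k e → row-inj p i r j r′ k (trans (eq i j) (trans e (sym (eq i k))))
      ; col = λ p i q j → let s , k , e = col p i q j in s , k , trans (sym (eq k i)) e
      ; col-inj = λ p i s j s′ k e → col-inj p i s j s′ k (trans (eq j i) (trans e (sym (eq k i))))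
      ; follows = λ s i e j e′ k el → trans (sym (eq i (vs∈ (target (successor⁻ {s = v₀} k))))) (follows s i e j e′ k el) }
      where open Latin l

    Rows : Set
    Rows = Vec (Vec (Word n) (length vs)) (length vs)

    opOf : Rows → Word n → Word n → Word n
    opOf M p q = apply [] vs (apply (tabulateOn vs (λ _ → [])) vs M p) q

    tables : List Rows
    tables = vectors (vectors vs (length vs)) (length vs)

    table-of : ∀ op → Latin op → ∃ λ M → M ∈ tables × Latin (opOf M)
    table-of op l = tabulateOn vs (λ p → tabulateOn vs (op p))
      , ∈-vectors vs _ (λ {p} i → ∈-vectors vs (op p) (λ {q} j → Latin.closed l p i q j))
      , latin-cong (λ {p} {q} i j → sym (trans (cong (λ v → apply [] vs v q) (apply-tabulateOn _ vs (λ p → tabulateOn vs (op p)) i))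
          (apply-tabulateOn [] vs (op p) j))) l

    realization : ∀ {op} → Latin op → Realization P gen-cayley-quasigroup
    realization {op} l = Realize.realization simple oc v₀-vertex (λ p q vp vq → vs∈⁻ (closed p (vs∈ vp) q (vs∈ vq)))
      (λ e eq → follows _ (vs∈ (source e)) _ (successor e) _ (successor eq) refl) gen-cayley-quasigroup
      ( (λ p q vp vq → (let r , i , e = row p (vs∈ vp) q (vs∈ vq) in r , vs∈⁻ i , e)
          , λ r r′ vr vr′ e e′ → row-inj p (vs∈ vp) r (vs∈ vr) r′ (vs∈ vr′) (trans e (sym e′)))
      , λ p q vp vq → (let s , i , e = col p (vs∈ vp) q (vs∈ vq) in s , vs∈⁻ i , e)
          , λ s s′ vs′ vs″ e e′ → col-inj p (vs∈ vp) s (vs∈ vs′) s′ (vs∈ vs″) (trans e (sym e′)) )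
      where open Latin l

    -- Passing from p·q to p·(v₀\q) turns the generators into the successors of v₀.
    latin-of : ∀ {op Q lab} → Closed V op → (∀ q → Q q → V q) → (∀ q q′ → Q q → Q q′ → lab q ≡ lab q′ → q ≡ q′) →
      IsCayleyGraphOf P op Q lab → Quasigroup V op → ∃ Latin
    latin-of {op} {Q} {lab} cl Q⊆V inj cay (lq , rq) = (λ p q → op p (divide q)) , record
      { closed = λ p i q j → vs∈ (cl p _ (vs∈⁻ i) (divide-vertex (vs∈⁻ j)))
      ; row = λ p i q j → solve-row p q (vs∈⁻ i) (vs∈⁻ j)
      ; row-inj = λ p i r j r′ k e → divide-inj (vs∈⁻ j) (vs∈⁻ k)
          (leftQuasigroup-cancellative cl lq p _ _ (vs∈⁻ i) (divide-vertex (vs∈⁻ j)) (divide-vertex (vs∈⁻ k)) e)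
      ; col = λ p i q j → let s , vs , e = proj₁ (rq (divide p) q (divide-vertex (vs∈⁻ i)) (vs∈⁻ j)) in s , vs∈ vs , e
      ; col-inj = λ p i s j s′ k e → proj₂ (rq (divide p) _ (divide-vertex (vs∈⁻ i)) (cl s′ _ (vs∈⁻ k) (divide-vertex (vs∈⁻ i))))
          s s′ (vs∈⁻ j) (vs∈⁻ k) e refl
      ; follows = λ { s i (a , t) j (a′ , q) k refl → follow (successor⁻ {s = s} j) (successor⁻ k) } }
      where
      divide : Word n → Word n
      divide q with vertex? q
      ... | yes vq = proj₁ (proj₁ (lq v₀ q v₀-vertex vq))
      ... | no _ = []
      divide-spec : ∀ {q} → V q → V (divide q) × op v₀ (divide q) ≡ q
      divide-spec {q} vq with vertex? q
      ... | yes vq′ = proj₂ (proj₁ (lq v₀ q v₀-vertex vq′))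
      ... | no ¬v = ⊥-elim (¬v vq)
      divide-vertex : ∀ {q} → V q → V (divide q)
      divide-vertex vq = proj₁ (divide-spec vq)
      divide-inj : ∀ {r r′} → V r → V r′ → divide r ≡ divide r′ → r ≡ r′
      divide-inj vr vr′ e = trans (sym (proj₂ (divide-spec vr))) (trans (cong (op v₀) e) (proj₂ (divide-spec vr′)))
      divide-op : ∀ {x} → V x → divide (op v₀ x) ≡ x
      divide-op {x} vx = leftQuasigroup-cancellative cl lq v₀ _ x v₀-vertex (divide-vertex (cl v₀ x v₀-vertex vx)) vx
        (proj₂ (divide-spec (cl v₀ x v₀-vertex vx)))
      solve-row : ∀ p q → V p → V q → ∃ λ r → r ∈ vs × op p (divide r) ≡ q
      solve-row p q vp vq with proj₁ (lq p q vp vq)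
      ... | x , vx , e = op v₀ x , vs∈ (cl v₀ x v₀-vertex vx) , trans (cong (op p) (divide-op vx)) e
      follow : ∀ {s a t q} → E s a t → E v₀ a q → op s (divide q) ≡ t
      follow {s} {a} {t} {q} e eq with proj₁ (cay s a t) e | proj₁ (cay v₀ a q) eq
      ... | _ , x , Qx , ex , refl | _ , x′ , Qx′ , ex′ , refl with inj x x′ Qx Qx′ (trans ex (sym ex′))
      ...   | refl = cong (op s) (divide-op (Q⊆V x Qx))

    decide : Realization P gen-cayley-quasigroup ⊎ ¬ IsKind P gen-cayley-quasigroup
    decide with ∃∈? (λ M → latin? (opOf M)) tables
    ... | yes (M , _ , l) = inj₁ (realization l)
    ... | no none = inj₂ λ { (op , Q , lab , cl , Q⊆V , inj , cay , qg) →
      let op′ , l = latin-of cl Q⊆V inj cay qg in none (table-of op′ l) }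

  module Necessary {op Q lab} (cl : Closed V op) (Q⊆V : ∀ q → Q q → V q)
    (inj : ∀ q q′ → Q q → Q q′ → lab q ≡ lab q′ → q ≡ q′) (cay : IsCayleyGraphOf P op Q lab) (qg : Quasigroup V op) where

    simple : SimpleEdges
    simple = cayley-simple Q⊆V inj cay (leftQuasigroup-cancellative cl (proj₁ qg))

    co : CoSimpleEdges
    co = cayley-cosimple Q⊆V inj cay simple
      λ r p q vr vp vq e → proj₂ (proj₂ qg r _ vr (cl q r vq vr)) p q vp vq e refl

    out : OutComplete
    out = cayley-outComplete Q⊆V inj cay

    into : InComplete
    into = cayley-inComplete Q⊆V inj cay λ p q vp vq → proj₁ (proj₂ qg p q vp vq)

  decide : Realization P gen-cayley-quasigroup ⊎ ¬ IsKind P gen-cayley-quasigroup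
  decide with simpleEdges? | outComplete? | coSimpleEdges? | inComplete?
  ... | no ¬simple | _ | _ | _ = inj₂ λ { (_ , _ , _ , cl , Q⊆V , inj , cay , qg) → ¬simple (Necessary.simple cl Q⊆V inj cay qg) }
  ... | yes _ | no ¬oc | _ | _ = inj₂ λ { (_ , _ , _ , cl , Q⊆V , inj , cay , qg) → ¬oc (Necessary.out cl Q⊆V inj cay qg) }
  ... | yes _ | yes _ | no ¬co | _ = inj₂ λ { (_ , _ , _ , cl , Q⊆V , inj , cay , qg) → ¬co (Necessary.co cl Q⊆V inj cay qg) }
  ... | yes _ | yes _ | yes _ | no ¬ic = inj₂ λ { (_ , _ , _ , cl , Q⊆V , inj , cay , qg) → ¬ic (Necessary.into cl Q⊆V inj cay qg) }
  ... | yes simple | yes oc | yes co | yes ic with bounded-or-unbounded vertex-regular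
  ...   | inj₁ (_ , bnd) = FiniteCase.decide simple oc bnd
  ...   | inj₂ unbounded = inj₁ (InfiniteCase.realization simple co oc ic unbounded)

-- The decision procedure for the six kinds

decideKind : {A : Set} → DecidableEquality A → {n : ℕ} (k : Kind) (P : Presentation n A) → Presented P →
  Realization P k ⊎ ¬ IsKind P k
decideKind _≟_ cayley-leftCancMonoid P X = Monoids.decide-left _≟_ P X
decideKind _≟_ cayley-cancMonoid P X = Monoids.decide-cancellative _≟_ P X
decideKind _≟_ cayley-group P X = Groups.decide-cayley _≟_ P X
decideKind _≟_ gen-cayley-leftQuasigroup P X = LeftQuasigroups.decide _≟_ P X
decideKind _≟_ gen-cayley-quasigroup P X = Quasigroups.decide _≟_ P X
decideKind _≟_ gen-cayley-group P X = Groups.decide-generalized _≟_ P X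

presented : ∀ {n A} (P : Presentation n A) → NonEmpty P → FiniteDegree P → Presented P
presented P ne fd with compile P fd
... | S , q₀ , to , from = record { ne = ne ; S = S ; q₀ = q₀ ; to = to ; from = from }

theorem8p12 : {A : Set} → DecidableEquality A →
    (n : ℕ) (k : Kind) (P : Presentation n A) →
    NonEmpty P → FiniteDegree P →
    Dec (IsKind P k) × (IsKind P k → Realization P k)
theorem8p12 _≟_ n k P ne fd with presented P ne fd
... | X with decideKind _≟_ k P X
...   | inj₁ R = yes (Graph.realization⇒kind _≟_ P X R) , λ _ → R
...   | inj₂ ¬K = no ¬K , λ K → ⊥-elim (¬K K)
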